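{- For every positive integer $n$, the thickness of the Kronecker product of $K_{n,n,n}$ and $K_2$ is $$\theta(K_{n,n,n}\times K_2)=\Big\lceil\frac{n+1}{2}\Big\rceil.$$
   Context: The thickness $\theta(G)$ of a graph $G$ is the minimum number of planar subgraphs whose union is $G$. $K_{n,n,n}$ denotes the complete tripartite graph with three parts of size $n$. The Kronecker product $G\times H$ of graphs $G$ and $H$ has vertex set $V(G)\times V(H)$, with $(g,h)$ adjacent to $(g',h')$ if and only if $gg'\in E(G)$ and $hh'\in E(H)$. -}

module Defs where

open import Data.Nat using (ℕ; zero; suc; _+_; _*_; _≤ᵇ_)
open import Data.Fin using (Fin; zero; suc; toℕ; remQuot)
open import Data.Bool using (Bool; true; false; _∧_; _∨_; not; if_then_else_)
open import Data.Bool.Properties using (∧-zeroʳ)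
open import Data.Product using (Σ; ∃; _×_; _,_; proj₁; proj₂)
open import Relation.Binary.PropositionalEquality using (_≡_; refl; cong; cong₂; trans)

eqF : ∀ {n} → Fin n → Fin n → Bool
eqF zero    zero    = true
eqF zero    (suc _) = false
eqF (suc _) zero    = false
eqF (suc a) (suc b) = eqF a b

eqF-refl : ∀ {n} (a : Fin n) → eqF a a ≡ true
eqF-refl zero    = refl
eqF-refl (suc a) = eqF-refl a

eqF-sym : ∀ {n} (a b : Fin n) → eqF a b ≡ eqF b a
eqF-sym zero    zero    = refl
eqF-sym zero    (suc _) = refl
eqF-sym (suc _) zero    = refl
eqF-sym (suc a) (suc b) = eqF-sym a b

count : ∀ {n} → (Fin n → Bool) → ℕ
count {zero}  p = 0
count {suc n} p = (if p zero then 1 else 0) + count (λ i → p (suc i))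

sumF : ∀ {n} → (Fin n → ℕ) → ℕ
sumF {zero}  f = 0
sumF {suc n} f = f zero + sumF (λ i → f (suc i))

anyF : ∀ {n} → (Fin n → Bool) → Bool
anyF {zero}  p = false
anyF {suc n} p = p zero ∨ anyF (λ i → p (suc i))

allF : ∀ {n} → (Fin n → Bool) → Bool
allF {zero}  p = true
allF {suc n} p = p zero ∧ allF (λ i → p (suc i))

allBelow : ℕ → (ℕ → Bool) → Bool
allBelow zero    p = true
allBelow (suc k) p = p k ∧ allBelow k p

iter : ∀ {A : Set} → (A → A) → ℕ → A → A
iter f zero    x = x
iter f (suc k) x = f (iter f k x)

record Graph (N : ℕ) : Set where
  field
    adj    : Fin N → Fin N → Bool
    sym    : ∀ u v → adj u v ≡ adj v u
    irrefl : ∀ v → adj v v ≡ false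
open Graph public

_⊆G_ : ∀ {N} → Graph N → Graph N → Set
H ⊆G G = ∀ u v → adj H u v ≡ true → adj G u v ≡ true

-- Planarity, combinatorially: a rotation system (combinatorial embedding)
-- of genus 0 on every connected component.
--
-- A rotation system assigns to each vertex u a cyclic permutation of its
-- neighbours: ρ u v is the neighbour following v around u.

IsRotation : ∀ {N} → Graph N → (Fin N → Fin N → Fin N) → Set
IsRotation {N} G ρ =
  (∀ u v → adj G u v ≡ true → adj G u (ρ u v) ≡ true) ×
  (∀ u v w → adj G u v ≡ true → adj G u w ≡ true →
     ∃ λ i → iter (ρ u) i v ≡ w)

module _ {N : ℕ} (G : Graph N) (ρ : Fin N → Fin N → Fin N) where

  faceStep : Fin N × Fin N → Fin N × Fin N
  faceStep (u , v) = (v , ρ v u)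

  key : Fin N × Fin N → ℕ
  key (u , v) = toℕ u * N + toℕ v

  #darts : ℕ
  #darts = sumF (λ u → count (λ v → adj G u v))

  -- a dart is the representative of its face if it is the least
  -- (lexicographically) dart in its faceStep-orbit
  faceRep : Fin N → Fin N → Bool
  faceRep u v = adj G u v ∧
    allBelow (N * N) (λ i → key (u , v) ≤ᵇ key (iter faceStep i (u , v)))

  #faces : ℕ
  #faces = sumF (λ u → count (λ v → faceRep u v))

  reach : ℕ → Fin N → Fin N → Bool
  reach zero    u v = eqF u v
  reach (suc k) u v = reach k u v ∨ anyF (λ w → reach k u w ∧ adj G w v)

  compRep : Fin N → Bool
  compRep v = allF (λ u → not (reach N v u) ∨ (toℕ v ≤ᵇ toℕ u))

  hasNbr : Fin N → Bool
  hasNbr v = anyF (λ w → adj G v w)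

  #bigComps : ℕ
  #bigComps = count (λ v → compRep v ∧ hasNbr v)

  #isolated : ℕ
  #isolated = count (λ v → not (hasNbr v))

  -- Euler's formula V − E + F = 2 on every non-trivial component
  -- (isolated vertices contribute V − E + F = 1), multiplied by 2:
  --   2V + 2F = 2E + 4·#bigComps + 2·#isolated
  EulerGenus0 : Set
  EulerGenus0 = 2 * N + 2 * #faces ≡ #darts + 4 * #bigComps + 2 * #isolated

Planar : ∀ {N} → Graph N → Set
Planar {N} G = Σ (Fin N → Fin N → Fin N) λ ρ → IsRotation G ρ × EulerGenus0 G ρ

PlanarDecomposition : ∀ {N} → Graph N → ℕ → Set
PlanarDecomposition {N} G t =
  Σ (Fin t → Graph N) λ H →
    (∀ i → Planar (H i)) ×
    (∀ i → H i ⊆G G) ×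
    (∀ u v → adj G u v ≡ true → ∃ λ i → adj (H i) u v ≡ true)

Thickness : ∀ {N} → Graph N → ℕ → Set
Thickness G t =
  PlanarDecomposition G t × (∀ k → PlanarDecomposition G k → t Data.Nat.≤ k)

_⊗_ : ∀ {N M} → Graph N → Graph M → Graph (N * M)
_⊗_ {N} {M} G H = record
  { adj    = λ x y → adj G (fst x) (fst y) ∧ adj H (snd x) (snd y)
  ; sym    = λ x y → cong₂ _∧_ (sym G (fst x) (fst y)) (sym H (snd x) (snd y))
  ; irrefl = λ x → cong (_∧ adj H (snd x) (snd x)) (irrefl G (fst x))
  }
  where
  fst : Fin (N * M) → Fin N
  fst x = proj₁ (remQuot {N} M x)
  snd : Fin (N * M) → Fin M
  snd x = proj₂ (remQuot {N} M x)

K₂ : Graph 2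
K₂ = record
  { adj    = λ u v → not (eqF u v)
  ; sym    = λ u v → cong not (eqF-sym u v)
  ; irrefl = λ v → cong not (eqF-refl v)
  }

Knnn : (n : ℕ) → Graph (3 * n)
Knnn n = record
  { adj    = λ x y → not (eqF (part x) (part y))
  ; sym    = λ x y → cong not (eqF-sym (part x) (part y))
  ; irrefl = λ x → cong not (eqF-refl (part x))
  }
  where
  part : Fin (3 * n) → Fin 3
  part x = proj₁ (remQuot {3} n x)

{-# OPTIONS --safe #-}
module Submission where

open import Defs
open import Data.Nat using (ℕ; zero; suc; _+_; _*_; _≤_; _<_; _≥_; z≤n; s≤s; _≤ᵇ_; ⌊_/2⌋; ⌈_/2⌉)
import Data.Nat as ℕ
open import Data.Nat.DivMod using (_%_; _/_; m≡m%n+[m/n]*n; m%n<n)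
open import Data.Nat.Properties hiding (_≟_)
open import Data.Nat.Tactic.RingSolver using (solve-∀)
open import Data.Fin using (Fin; zero; suc; toℕ; fromℕ; fromℕ<; combine; remQuot; _↑ˡ_; _↑ʳ_)
open import Data.Fin.Properties using (_≟_; all?; toℕ-injective; toℕ<n; pigeonhole; remQuot-combine; combine-remQuot; combine-injective; toℕ-combine; toℕ-fromℕ; toℕ-fromℕ<)
import Data.Fin.Properties as F
open import Data.Bool using (Bool; true; false; _∧_; _∨_; not; if_then_else_)
import Data.Bool as B
open import Data.Bool.Properties using (T-≡; ∧-comm; ∨-comm)
open import Data.Product using (Σ; ∃; _×_; _,_; proj₁; proj₂; uncurry)
open import Data.Product.Properties using (≡-dec)
open import Data.Sum using (_⊎_; inj₁; inj₂; [_,_]′)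
open import Data.Empty using (⊥; ⊥-elim)
open import Data.Unit using (⊤; tt)
open import Function using (_∘_; case_of_; Equivalence)
open import Relation.Nullary using (¬_; Dec; yes; no)
open import Relation.Nullary.Decidable using (⌊_⌋; toWitness; _→-dec_; _⊎-dec_; _×-dec_; ¬?)
open import Relation.Binary.PropositionalEquality using (_≡_; _≢_; refl; cong; cong₂; trans; subst; subst₂; module ≡-Reasoning) renaming (sym to ≡-sym)

-- G = K_{n,n,n} × K₂ is the blow-up of the hexagon in which each vertex becomes a class of n
-- independent vertices.
--
-- Lower bound: G is bipartite, so a face of a plane subgraph has length at least 4 unless its
-- component is a single edge; Euler's formula then gives fewer than 2 · 6n edges per layer, while
-- G has 6n² edges, so k layers need 2k > n.
--
-- Upper bound: pair up the indices in every class. In the layer of a pair, the twelve paired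
-- vertices span nested 4-cycles (everything but the four edges between classes 5 and 0), and each
-- other vertex of class i goes, with degree two, into a face containing the pair of class i + 1.
-- One extra layer takes the missing 4-cycles and the edges at the last vertex z_i of each class:
-- it consists of the hexagon z_0 … z_5, all of class 5 joined to z_0 and z_4 with the missing
-- 4-cycles in between, and stars. For that, in the layer of a pair, z_i is attached to the pair of
-- class i - 1 instead of i + 1 for i = 1, 2, 4. All layers arise from an edge by hanging on leaves
-- and cutting off corners of faces, apart from one chord closing the hexagon.

-- Booleans and finite sums

-- The least k with 2k > n is ⌊n/2⌋ + 1, so the bound leaves room for just one layer besides those
-- of the pairs, whatever the parity of n. For even n the `z_i` belong to the last pair themselves,
-- so the layers are built without distinguishing parities.
--
-- Six 4-cycles closing up around a pair would give 24 edges on 12 vertices, while a bipartite plane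
-- graph on 12 vertices has at most 2 · 12 - 4 = 20: hence exactly four edges per pair are left
-- over. The redirected `z_i` are due to these leftovers. If every `z_{i+1}` saw all of class i in
-- the extra layer, then p, q in class 5 and p', q' in class 0 spanning a leftover 4-cycle would
-- form, with `z_0` and `z_1`, a K_{3,3} with sides p, q, `z_1` and p', q', `z_0`.
--
-- Faces of unbounded size are never described. The invariants record corners only, because a vertex
-- of degree two placed at one corner destroys at most two other corners.

ι : Bool → ℕ
ι b = if b then 1 else 0

∧-true : ∀ {a b} → a ∧ b ≡ true → a ≡ true × b ≡ true
∧-true {true} {true} _ = refl , refl

∧-intro : ∀ {a b} → a ≡ true → b ≡ true → a ∧ b ≡ true
∧-intro refl refl = refl

∨-true : ∀ {a b} → a ∨ b ≡ true → a ≡ true ⊎ b ≡ true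
∨-true {true}  _ = inj₁ refl
∨-true {false} e = inj₂ e

∨-introˡ : ∀ {a b} → a ≡ true → a ∨ b ≡ true
∨-introˡ refl = refl

∨-introʳ : ∀ {a b} → b ≡ true → a ∨ b ≡ true
∨-introʳ {true}  refl = refl
∨-introʳ {false} refl = refl

true≢false : ∀ {b} → b ≡ true → b ≡ false → ⊥
true≢false refl ()

¬true⇒false : ∀ {b} → ¬ (b ≡ true) → b ≡ false
¬true⇒false {true}  h = ⊥-elim (h refl)
¬true⇒false {false} _ = refl

not-true : ∀ {b} → not b ≡ true → b ≡ false
not-true {false} _ = refl

bool-ext : ∀ {a b} → (a ≡ true → b ≡ true) → (b ≡ true → a ≡ true) → a ≡ b
bool-ext {true}  {true}  _ _ = refl
bool-ext {true}  {false} f _ = ≡-sym (f refl)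
bool-ext {false} {true}  _ g = g refl
bool-ext {false} {false} _ _ = refl

≤ᵇ-true : ∀ {m n} → m ≤ n → (m ≤ᵇ n) ≡ true
≤ᵇ-true p = Equivalence.to T-≡ (≤⇒≤ᵇ p)

≤ᵇ-sound : ∀ {m n} → (m ≤ᵇ n) ≡ true → m ≤ n
≤ᵇ-sound e = ≤ᵇ⇒≤ _ _ (Equivalence.from T-≡ e)

eqF-true : ∀ {n} {a b : Fin n} → eqF a b ≡ true → a ≡ b
eqF-true {a = zero}  {zero}  _ = refl
eqF-true {a = suc a} {suc b} e = cong suc (eqF-true e)

eqF-false : ∀ {n} {a b : Fin n} → a ≢ b → eqF a b ≡ false
eqF-false h = ¬true⇒false (h ∘ eqF-true)

anyF-true : ∀ {n} {p : Fin n → Bool} → anyF p ≡ true → ∃ λ i → p i ≡ true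
anyF-true {suc n} {p} e with p zero in eq
... | true  = zero , eq
... | false = let i , h = anyF-true {n} e in suc i , h

anyF-intro : ∀ {n} {p : Fin n → Bool} i → p i ≡ true → anyF p ≡ true
anyF-intro zero    e = ∨-introˡ e
anyF-intro {p = p} (suc i) e = ∨-introʳ {p zero} (anyF-intro i e)

allF-true : ∀ {n} {p : Fin n → Bool} → allF p ≡ true → ∀ i → p i ≡ true
allF-true e zero    = proj₁ (∧-true e)
allF-true {p = p} e (suc i) = allF-true (proj₂ (∧-true {p zero} e)) i

allF-intro : ∀ {n} {p : Fin n → Bool} → (∀ i → p i ≡ true) → allF p ≡ true
allF-intro {zero}  h = refl
allF-intro {suc n} h = ∧-intro (h zero) (allF-intro (h ∘ suc))

allBelow-true : ∀ {m} {p : ℕ → Bool} → allBelow m p ≡ true → ∀ {i} → i < m → p i ≡ true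
allBelow-true {suc m} {p} e {i} (s≤s i≤m) with m≤n⇒m<n∨m≡n i≤m
... | inj₁ i<m  = allBelow-true (proj₂ (∧-true {p m} e)) i<m
... | inj₂ refl = proj₁ (∧-true e)

allBelow-intro : ∀ {m} {p : ℕ → Bool} → (∀ i → i < m → p i ≡ true) → allBelow m p ≡ true
allBelow-intro {zero}  h = refl
allBelow-intro {suc m} h = ∧-intro (h m ≤-refl) (allBelow-intro λ i i<m → h i (m≤n⇒m≤1+n i<m))

count-sum : ∀ {n} (p : Fin n → Bool) → count p ≡ sumF (ι ∘ p)
count-sum {zero}  p = refl
count-sum {suc n} p = cong (ι (p zero) +_) (count-sum (p ∘ suc))

sumF-cong : ∀ {n} {f g : Fin n → ℕ} → (∀ i → f i ≡ g i) → sumF f ≡ sumF g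
sumF-cong {zero}  h = refl
sumF-cong {suc n} h = cong₂ _+_ (h zero) (sumF-cong (h ∘ suc))

sumF-mono : ∀ {n} {f g : Fin n → ℕ} → (∀ i → f i ≤ g i) → sumF f ≤ sumF g
sumF-mono {zero}  h = z≤n
sumF-mono {suc n} h = +-mono-≤ (h zero) (sumF-mono (h ∘ suc))

sumF-+ : ∀ {n} (f g : Fin n → ℕ) → sumF (λ i → f i + g i) ≡ sumF f + sumF g
sumF-+ {zero}  f g = refl
sumF-+ {suc n} f g = trans (cong (f zero + g zero +_) (sumF-+ (f ∘ suc) (g ∘ suc))) (lem (f zero) (g zero) _ _)
  where
  lem : ∀ a b c d → a + b + (c + d) ≡ a + c + (b + d)
  lem = solve-∀

sumF-const : ∀ n c → sumF {n} (λ _ → c) ≡ n * c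
sumF-const zero    c = refl
sumF-const (suc n) c = cong (c +_) (sumF-const n c)

sumF-0 : ∀ {n} {f : Fin n → ℕ} → (∀ i → f i ≡ 0) → sumF f ≡ 0
sumF-0 {n} h = trans (sumF-cong h) (trans (sumF-const n 0) (*-zeroʳ n))

sumF-swap : ∀ {m n} (f : Fin m → Fin n → ℕ) →
            sumF (λ i → sumF (f i)) ≡ sumF (λ j → sumF (λ i → f i j))
sumF-swap {zero} {n} f = ≡-sym (sumF-0 {n} λ _ → refl)
sumF-swap {suc m} f = trans (cong (sumF (f zero) +_) (sumF-swap (f ∘ suc)))
  (≡-sym (sumF-+ (f zero) (λ j → sumF (λ i → f (suc i) j))))

sumF-* : ∀ {n} c (f : Fin n → ℕ) → sumF (λ i → c * f i) ≡ c * sumF f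
sumF-* {zero}  c f = ≡-sym (*-zeroʳ c)
sumF-* {suc n} c f = trans (cong (c * f zero +_) (sumF-* c (f ∘ suc))) (≡-sym (*-distribˡ-+ c (f zero) _))

sumF-point : ∀ {n} (a : Fin n) {f : Fin n → ℕ} → (∀ i → i ≢ a → f i ≡ 0) → sumF f ≡ f a
sumF-point zero    {f} h = trans (cong (f zero +_) (sumF-0 λ i → h (suc i) λ ())) (+-identityʳ _)
sumF-point (suc a) {f} h = trans (cong (_+ sumF (f ∘ suc)) (h zero λ ()))
  (sumF-point a λ i i≢a → h (suc i) λ { refl → i≢a refl })

sumF-≥ : ∀ {n} (a : Fin n) (f : Fin n → ℕ) → f a ≤ sumF f
sumF-≥ zero    f = m≤m+n _ _
sumF-≥ (suc a) f = ≤-trans (sumF-≥ a (f ∘ suc)) (m≤n+m _ _)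

sumF-++ : ∀ m {n} (f : Fin (m + n) → ℕ) → sumF f ≡ sumF (λ i → f (i ↑ˡ n)) + sumF (λ j → f (m ↑ʳ j))
sumF-++ zero    f = refl
sumF-++ (suc m) f = trans (cong (f zero +_) (sumF-++ m (f ∘ suc))) (≡-sym (+-assoc (f zero) _ _))

sumF-combine : ∀ m {n} (f : Fin (m * n) → ℕ) → sumF f ≡ sumF {m} (λ i → sumF {n} (λ j → f (combine i j)))
sumF-combine zero    f = refl
sumF-combine (suc m) {n} f = trans (sumF-++ n f) (cong (sumF (λ j → f (j ↑ˡ (m * n))) +_) (sumF-combine m (λ k → f (n ↑ʳ k))))

-- Sums over darts

Dart : ℕ → Set
Dart N = Fin N × Fin N

_≟D_ : ∀ {N} (d e : Dart N) → Dec (d ≡ e)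
_≟D_ = ≡-dec _≟_ _≟_

sumD : ∀ {N} → (Dart N → ℕ) → ℕ
sumD f = sumF λ u → sumF λ v → f (u , v)

sumD-cong : ∀ {N} {f g : Dart N → ℕ} → (∀ d → f d ≡ g d) → sumD f ≡ sumD g
sumD-cong h = sumF-cong λ u → sumF-cong λ v → h (u , v)

sumD-mono : ∀ {N} {f g : Dart N → ℕ} → (∀ d → f d ≤ g d) → sumD f ≤ sumD g
sumD-mono h = sumF-mono λ u → sumF-mono λ v → h (u , v)

sumD-+ : ∀ {N} (f g : Dart N → ℕ) → sumD (λ d → f d + g d) ≡ sumD f + sumD g
sumD-+ {N} f g = trans
  (sumF-cong {N} λ u → sumF-+ (λ v → f (u , v)) (λ v → g (u , v)))
  (sumF-+ {N} (λ u → sumF λ v → f (u , v)) (λ u → sumF λ v → g (u , v)))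

sumD-* : ∀ {N} c (f : Dart N → ℕ) → sumD (λ d → c * f d) ≡ c * sumD f
sumD-* {N} c f = trans
  (sumF-cong {N} λ u → sumF-* c (λ v → f (u , v)))
  (sumF-* {N} c (λ u → sumF λ v → f (u , v)))

sumD-0 : ∀ {N} {f : Dart N → ℕ} → (∀ d → f d ≡ 0) → sumD f ≡ 0
sumD-0 h = sumF-0 λ u → sumF-0 λ v → h (u , v)

sumDF-swap : ∀ {N m} (f : Dart N → Fin m → ℕ) → sumD (λ d → sumF (f d)) ≡ sumF (λ l → sumD (λ d → f d l))
sumDF-swap {N} f = trans
  (sumF-cong {N} λ u → sumF-swap (λ v l → f (u , v) l))
  (sumF-swap {N} (λ u l → sumF λ v → f (u , v) l))

sumD-swap : ∀ {N} (f : Dart N → Dart N → ℕ) → sumD (λ d → sumD (f d)) ≡ sumD (λ e → sumD (λ d → f d e))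
sumD-swap {N} f = trans
  (sumDF-swap {N} (λ d u → sumF λ v → f d (u , v)))
  (sumF-cong {N} λ u → sumDF-swap (λ d v → f d (u , v)))

sumD-point : ∀ {N} (a : Dart N) {f : Dart N → ℕ} → (∀ d → d ≢ a → f d ≡ 0) → sumD f ≡ f a
sumD-point (a , b) h = trans
  (sumF-point a λ u u≢a → sumF-0 λ v → h (u , v) λ { refl → u≢a refl })
  (sumF-point b λ v v≢b → h (a , v) λ { refl → v≢b refl })

δ : ∀ {N} → Dart N → Dart N → ℕ
δ a d = ι ⌊ a ≟D d ⌋

δ-refl : ∀ {N} (a : Dart N) → δ a a ≡ 1
δ-refl a with a ≟D a
... | yes _ = refl
... | no h  = ⊥-elim (h refl)

δ-≢ : ∀ {N} {a d : Dart N} → a ≢ d → δ a d ≡ 0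
δ-≢ {a = a} {d} h with a ≟D d
... | yes e = ⊥-elim (h e)
... | no _  = refl

sumD-δ : ∀ {N} (a : Dart N) → sumD (δ a) ≡ 1
sumD-δ a = trans (sumD-point a λ d d≢a → δ-≢ (d≢a ∘ ≡-sym)) (δ-refl a)

-- Iteration

module _ {A : Set} where

  iter-+ : (f : A → A) (m n : ℕ) (x : A) → iter f (m + n) x ≡ iter f m (iter f n x)
  iter-+ f zero    n x = refl
  iter-+ f (suc m) n x = cong f (iter-+ f m n x)

  iter-suc : (f : A → A) (n : ℕ) (x : A) → iter f n (f x) ≡ f (iter f n x)
  iter-suc f zero    x = refl
  iter-suc f (suc n) x = cong f (iter-suc f n x)

  iter-* : (f : A → A) (p q : ℕ) {x : A} → iter f p x ≡ x → iter f (q * p) x ≡ x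
  iter-* f p zero    e = refl
  iter-* f p (suc q) e = trans (iter-+ f p (q * p) _) (trans (cong (iter f p) (iter-* f p q e)) e)

  Reach : (A → A) → A → A → Set
  Reach f x y = ∃ λ i → iter f i x ≡ y

  reach-refl : ∀ {f x} → Reach f x x
  reach-refl = 0 , refl

  reach-step : ∀ {f x y} → f x ≡ y → Reach f x y
  reach-step e = 1 , e

  reach-trans : ∀ {f x y z} → Reach f x y → Reach f y z → Reach f x z
  reach-trans {f} {x} (i , refl) (j , refl) = j + i , iter-+ f j i x

  Closed : (A → Set) → (A → A) → Set
  Closed P f = ∀ x → P x → P (f x)

  iter-closed : ∀ {P : A → Set} {f} → Closed P f → ∀ i x → P x → P (iter f i x)
  iter-closed c zero    x p = p
  iter-closed {P} c (suc i) x p = c _ (iter-closed {P} c i x p)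

  InjOn : (A → Set) → (A → A) → Set
  InjOn P f = ∀ x y → P x → P y → f x ≡ f y → x ≡ y

  CycOn : (A → Set) → (A → A) → Set
  CycOn P f = Closed P f × (∀ x y → P x → P y → Reach f x y)

  -- Rotations are only assumed to be transitive on neighbours, not injective. Transitivity gives
  -- each of `x` and `y` a period; one step less than a common multiple of both periods leads from
  -- `f x ≡ f y` back to `x` and also to `y`.
  cyc⇒inj : ∀ {P f} → CycOn P f → InjOn P f
  cyc⇒inj {P} {f} (c , r) x y px py e with r _ _ (c x px) px | r _ _ (c y py) py
  ... | i , ei | j , ej = begin
    x                        ≡⟨ ≡-sym (iter-* f (suc i) (suc j) ex) ⟩
    iter f (suc j * suc i) x ≡⟨ ≡-sym (iter-suc f (i + j * suc i) x) ⟩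
    iter f (i + j * suc i) (f x) ≡⟨ cong (iter f (i + j * suc i)) e ⟩
    iter f (i + j * suc i) (f y) ≡⟨ iter-suc f (i + j * suc i) y ⟩
    iter f (suc j * suc i) y ≡⟨ cong (λ k → iter f k y) (*-comm (suc j) (suc i)) ⟩
    iter f (suc i * suc j) y ≡⟨ iter-* f (suc j) (suc i) ey ⟩
    y ∎
    where
    open ≡-Reasoning
    ex : iter f (suc i) x ≡ x
    ex = trans (≡-sym (iter-suc f i x)) ei
    ey : iter f (suc j) y ≡ y
    ey = trans (≡-sym (iter-suc f j y)) ej

  iter-cancel : ∀ {P f} → Closed P f → InjOn P f → ∀ i x y → P x → P y → iter f i x ≡ iter f i y → x ≡ y
  iter-cancel c inj zero    x y px py e = e
  iter-cancel {P} c inj (suc i) x y px py e = iter-cancel {P} c inj i x y px py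
    (inj _ _ (iter-closed {P} c i x px) (iter-closed {P} c i y py) e)

-- Simulating single steps suffices. As `m` may identify points, a step of `f` may be matched by no
-- step of `f′` or by several.
reach-map : ∀ {A B : Set} {P : A → Set} {f : A → A} {f′ : B → B} (m : A → B) → Closed P f →
            (∀ x → P x → Reach f′ (m x) (m (f x))) →
            ∀ x y → P x → Reach f x y → Reach f′ (m x) (m y)
reach-map m c h x _ px (zero , refl) = reach-refl
reach-map {P = P} {f} m c h x _ px (suc i , refl) = reach-trans
  (reach-map m c h x (iter f i x) px (i , refl)) (h _ (iter-closed {P = P} c i x px))

-- Rotation systems and their faces

Adj : ∀ {N} → Graph N → Fin N → Fin N → Set
Adj G u v = adj G u v ≡ true

IsDart : ∀ {N} → Graph N → Dart N → Set
IsDart G (u , v) = Adj G u v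

adj-sym : ∀ {N} (G : Graph N) {u v} → Adj G u v → Adj G v u
adj-sym G {u} {v} e = trans (sym G v u) e

adj-≢ : ∀ {N} (G : Graph N) {u v} → Adj G u v → u ≢ v
adj-≢ G {u} e refl = true≢false e (irrefl G u)

key-injective : ∀ {N} (G : Graph N) ρ (d e : Dart N) → key G ρ d ≡ key G ρ e → d ≡ e
key-injective {N} G ρ (u , v) (u′ , v′) eq =
  let p , q = combine-injective u v u′ v′ (toℕ-injective
        (trans (toℕ-key u v) (trans eq (≡-sym (toℕ-key u′ v′)))))
  in cong₂ _,_ p q
  where
  toℕ-key : ∀ u v → toℕ (combine u v) ≡ key G ρ (u , v)
  toℕ-key u v = trans (toℕ-combine u v) (cong (_+ toℕ v) (*-comm N (toℕ u)))

argmin : (f : ℕ → ℕ) (m : ℕ) → ∃ λ i → i < suc m × (∀ j → j < suc m → f i ≤ f j)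
argmin f zero = 0 , s≤s z≤n , λ { zero _ → ≤-refl ; (suc _) (s≤s ()) }
argmin f (suc m) with argmin f m
... | i , i<m , h with ≤-total (f i) (f (suc m))
...   | inj₁ fi≤ = i , m≤n⇒m≤1+n i<m , λ j j< → [ h j , (λ { refl → fi≤ }) ]′ (m≤n⇒m<n∨m≡n (≤-pred j<))
...   | inj₂ fi≥ = suc m , ≤-refl , λ j j< →
  [ (λ q → ≤-trans fi≥ (h j q)) , (λ { refl → ≤-refl }) ]′ (m≤n⇒m<n∨m≡n (≤-pred j<))

module Rotation {N : ℕ} (G : Graph N) (ρ : Fin N → Fin N → Fin N) (isRot : IsRotation G ρ) where

  φ : Dart N → Dart N
  φ = faceStep G ρ

  rep : Dart N → Bool
  rep (u , v) = faceRep G ρ u v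

  #faces-sumD : #faces G ρ ≡ sumD (ι ∘ rep)
  #faces-sumD = sumF-cong λ u → count-sum (λ v → rep (u , v))

  ρ-cyc : ∀ u → CycOn (Adj G u) (ρ u)
  ρ-cyc u = proj₁ isRot u , proj₂ isRot u

  ρ-inj : ∀ u → InjOn (Adj G u) (ρ u)
  ρ-inj u = cyc⇒inj (ρ-cyc u)

  φ-closed : Closed (IsDart G) φ
  φ-closed (u , v) e = proj₁ isRot v u (adj-sym G e)

  φ-inj : InjOn (IsDart G) φ
  φ-inj (u , v) (u′ , v′) e e′ eq with cong proj₁ eq
  ... | refl = cong (_, v) (ρ-inj v u u′ (adj-sym G e) (adj-sym G e′) (cong proj₂ eq))

  iter-dart : ∀ i d → IsDart G d → IsDart G (iter φ i d)
  iter-dart = iter-closed {P = IsDart G} φ-closed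

  -- Two of the first N * N + 1 iterates coincide, as darts are coded in `Fin (N * N)`. Injectivity
  -- cancels the common initial steps, so the repetition starts at `d` itself.
  φ-period : ∀ d → IsDart G d → ∃ λ p → suc p ≤ N * N × iter φ (suc p) d ≡ d
  φ-period d dd with pigeonhole (n<1+n (N * N)) (λ i → uncurry combine (iter φ (toℕ i) d))
  ... | i , j , i<j , eq with m≤n⇒∃[o]m+o≡n i<j
  ...   | p , ip≡j = p , p<NN ,
    ≡-sym (iter-cancel {P = IsDart G} φ-closed φ-inj (toℕ i) d (iter φ (suc p) d) dd (iter-dart (suc p) d dd) eq′)
    where
    eq″ : iter φ (toℕ i) d ≡ iter φ (toℕ j) d
    eq″ = let a , b = combine-injective _ _ _ _ eq in cong₂ _,_ a b
    j≡ : toℕ j ≡ toℕ i + suc p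
    j≡ = trans (≡-sym ip≡j) (≡-sym (+-suc (toℕ i) p))
    eq′ : iter φ (toℕ i) d ≡ iter φ (toℕ i) (iter φ (suc p) d)
    eq′ = trans eq″ (trans (cong (λ k → iter φ k d) j≡) (iter-+ φ (toℕ i) (suc p) d))
    p<NN : suc p ≤ N * N
    p<NN = ≤-trans (m≤n+m (suc p) (toℕ i)) (≤-trans (≤-reflexive (≡-sym j≡)) (≤-pred (toℕ<n j)))

  -- `faceRep` inspects only the first N * N iterates; this shows that they make up the whole orbit.
  reach-bounded : ∀ d e → IsDart G d → Reach φ d e → ∃ λ i → i < N * N × iter φ i d ≡ e
  reach-bounded d e dd (m , eq) with φ-period d dd
  ... | p , p<NN , per = m % suc p , <-≤-trans (m%n<n m (suc p)) p<NN , trans (≡-sym (begin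
    iter φ m d                                              ≡⟨ cong (λ k → iter φ k d) (m≡m%n+[m/n]*n m (suc p)) ⟩
    iter φ (m % suc p + m / suc p * suc p) d                ≡⟨ iter-+ φ (m % suc p) (m / suc p * suc p) d ⟩
    iter φ (m % suc p) (iter φ (m / suc p * suc p) d)       ≡⟨ cong (iter φ (m % suc p)) (iter-* φ (suc p) (m / suc p) per) ⟩
    iter φ (m % suc p) d ∎)) eq
    where open ≡-Reasoning

  reach-sym : ∀ d e → IsDart G d → Reach φ d e → Reach φ e d
  reach-sym d e dd (m , eq) with φ-period d dd
  ... | p , _ , per = m * p , (begin
    iter φ (m * p) e            ≡⟨ cong (iter φ (m * p)) (≡-sym eq) ⟩
    iter φ (m * p) (iter φ m d) ≡⟨ ≡-sym (iter-+ φ (m * p) m d) ⟩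
    iter φ (m * p + m) d        ≡⟨ cong (λ k → iter φ k d) (lem m p) ⟩
    iter φ (m * suc p) d        ≡⟨ iter-* φ (suc p) m per ⟩
    d ∎)
    where
    open ≡-Reasoning
    lem : ∀ m p → m * p + m ≡ m * suc p
    lem = solve-∀

  rep-dart : ∀ d → rep d ≡ true → IsDart G d
  rep-dart (u , v) r = proj₁ (∧-true r)

  rep-least : ∀ d e → rep d ≡ true → Reach φ d e → key G ρ d ≤ key G ρ e
  rep-least d@(u , v) e r path with reach-bounded d e (rep-dart d r) path
  ... | i , i< , refl = ≤ᵇ-sound (allBelow-true {N * N} (proj₂ (∧-true {adj G u v} r)) i<)

  rep-unique : ∀ d e → rep d ≡ true → rep e ≡ true → Reach φ d e → d ≡ e
  rep-unique d e rd re path = key-injective G ρ d e (≤-antisym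
    (rep-least d e rd path) (rep-least e d re (reach-sym d e (rep-dart d rd) path)))

  rep-exists : ∀ d → IsDart G d → ∃ λ e → rep e ≡ true × Reach φ d e
  rep-exists d dd with argmin (λ i → key G ρ (iter φ i d)) (N * N)
  ... | i , _ , least = iter φ i d ,
    ∧-intro (iter-dart i d dd) (allBelow-intro {N * N} λ j _ → ≤ᵇ-true (below j)) , (i , refl)
    where
    below : ∀ j → key G ρ (iter φ i d) ≤ key G ρ (iter φ j (iter φ i d))
    below j with reach-bounded d (iter φ j (iter φ i d)) dd (j + i , iter-+ φ j i d)
    ... | k , k< , e = ≤-trans (least k (m≤n⇒m≤1+n k<)) (≤-reflexive (cong (key G ρ) e))

-- A labelling of the P-elements by 0, …, k - 1 whose classes are exactly the φ-orbits.
record OrbitLabelling {D : Set} (P : D → Set) (φ : D → D) : Set where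
  field
    size   : ℕ
    lab    : D → ℕ
    inv    : ∀ d → P d → lab (φ d) ≡ lab d
    conn   : ∀ d e → P d → P e → lab d ≡ lab e → Reach φ d e
    bound  : ∀ d → P d → lab d < size
    onto   : ∀ l → l < size → ∃ λ d → P d × lab d ≡ l

  lab-iter : Closed P φ → ∀ i d → P d → lab (iter φ i d) ≡ lab d
  lab-iter c zero    d p = refl
  lab-iter c (suc i) d p = trans (inv _ (iter-closed {P = P} c i d p)) (lab-iter c i d p)

-- Each representative has exactly one label and each label exactly one representative; `cell`
-- records these incidences, and they are summed in both orders. Labels can be carried through the
-- insertion of an edge more easily than least darts.
#faces-labelling : ∀ {N} (G : Graph N) ρ → IsRotation G ρ →
  (L : OrbitLabelling (IsDart G) (faceStep G ρ)) → #faces G ρ ≡ OrbitLabelling.size L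
#faces-labelling {N} G ρ isRot L = begin
  #faces G ρ                                          ≡⟨ #faces-sumD ⟩
  sumD (ι ∘ rep)                                      ≡⟨ sumD-cong split ⟩
  sumD (λ d → sumF {size} (λ l → cell d l))           ≡⟨ sumDF-swap cell ⟩
  sumF {size} (λ l → sumD (λ d → cell d l))           ≡⟨ sumF-cong one ⟩
  sumF {size} (λ l → 1)                               ≡⟨ sumF-const size 1 ⟩
  size * 1                                            ≡⟨ *-identityʳ size ⟩
  size ∎
  where
  open ≡-Reasoning
  open Rotation G ρ isRot
  open OrbitLabelling L
  cell : Dart N → Fin size → ℕ
  cell d l = ι (rep d ∧ ⌊ lab d ℕ.≟ toℕ l ⌋)
  cell-1 : ∀ d l → rep d ≡ true → lab d ≡ toℕ l → cell d l ≡ 1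
  cell-1 d l r e with lab d ℕ.≟ toℕ l
  ... | yes _ rewrite r = refl
  ... | no h = ⊥-elim (h e)
  cell-0 : ∀ d l → ¬ (rep d ≡ true × lab d ≡ toℕ l) → cell d l ≡ 0
  cell-0 d l h with rep d | lab d ℕ.≟ toℕ l
  ... | true  | yes e = ⊥-elim (h (refl , e))
  ... | true  | no _  = refl
  ... | false | _     = refl
  split : ∀ d → ι (rep d) ≡ sumF (cell d)
  split d with rep d in eq
  ... | false = ≡-sym (sumF-0 {size} λ l → refl)
  ... | true  = ≡-sym (trans
    (sumF-point l λ l′ l′≢l → trans (cong (λ b → ι (b ∧ ⌊ lab d ℕ.≟ toℕ l′ ⌋)) (≡-sym eq))
      (cell-0 d l′ λ (_ , e) → l′≢l (toℕ-injective (trans (≡-sym e) (≡-sym (toℕ-fromℕ< lt))))))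
    (trans (cong (λ b → ι (b ∧ ⌊ lab d ℕ.≟ toℕ l ⌋)) (≡-sym eq)) (cell-1 d l eq (≡-sym (toℕ-fromℕ< lt)))))
    where
    lt = bound d (rep-dart d eq)
    l = fromℕ< lt
  one : ∀ l → sumD (λ d → cell d l) ≡ 1
  one l with onto (toℕ l) (toℕ<n l)
  ... | d , dd , ld with rep-exists d dd
  ...   | e , re , (i , refl) = trans
    (sumD-point e λ d′ d′≢e → cell-0 d′ l λ (r′ , l′) →
      d′≢e (rep-unique d′ e r′ re (conn d′ e (rep-dart d′ r′) (rep-dart e re) (trans l′ (≡-sym le)))))
    (cell-1 e l re le)
    where
    le : lab e ≡ toℕ l
    le = trans (lab-iter φ-closed i d dd) ld

-- Components

module Components {N : ℕ} (G : Graph N) (ρ : Fin N → Fin N → Fin N) where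

  hasNbr-intro : ∀ {u v} → Adj G u v → hasNbr G ρ u ≡ true
  hasNbr-intro {v = v} e = anyF-intro v e

  hasNbr-elim : ∀ {u} → hasNbr G ρ u ≡ true → ∃ λ v → Adj G u v
  hasNbr-elim = anyF-true

  reach-adj : ∀ k {u v} → reach G ρ k u v ≡ true → u ≢ v → hasNbr G ρ v ≡ true
  reach-adj zero    r u≢v = ⊥-elim (u≢v (eqF-true r))
  reach-adj (suc k) {u} {v} r u≢v with ∨-true {reach G ρ k u v} r
  ... | inj₁ r′ = reach-adj k r′ u≢v
  ... | inj₂ r′ = let w , h = anyF-true r′ in
    hasNbr-intro {v} {w} (adj-sym G (proj₂ (∧-true {reach G ρ k u w} h)))

  least-hasNbr : ∀ {u} → hasNbr G ρ u ≡ true →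
    ∃ λ v → hasNbr G ρ v ≡ true × (∀ w → hasNbr G ρ w ≡ true → toℕ v ≤ toℕ w)
  least-hasNbr {u} h = search u N h (toℕ<n u) 
    where
    search : ∀ u k → hasNbr G ρ u ≡ true → toℕ u < k →
      ∃ λ v → hasNbr G ρ v ≡ true × (∀ w → hasNbr G ρ w ≡ true → toℕ v ≤ toℕ w)
    search u (suc k) h u<k with anyF (λ w → hasNbr G ρ w ∧ not (toℕ u ≤ᵇ toℕ w)) in eq
    ... | false = u , h , λ w hw → ≮⇒≥ λ w<u → true≢false
      (anyF-intro {p = λ w → hasNbr G ρ w ∧ not (toℕ u ≤ᵇ toℕ w)} w
        (∧-intro hw (cong not (¬true⇒false λ e → <⇒≱ w<u (≤ᵇ-sound e))))) eq
    ... | true with anyF-true eq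
    ...   | w , e = search w k (proj₁ (∧-true e))
      (<-≤-trans (≰⇒> λ u≤w → true≢false (≤ᵇ-true u≤w) (not-true (proj₂ (∧-true {hasNbr G ρ w} e)))) (≤-pred u<k))

  least-compRep : ∀ {v} → (∀ w → hasNbr G ρ w ≡ true → toℕ v ≤ toℕ w) → compRep G ρ v ≡ true
  least-compRep {v} h = allF-intro below
    where
    below : ∀ u → not (reach G ρ N v u) ∨ (toℕ v ≤ᵇ toℕ u) ≡ true
    below u with reach G ρ N v u in eq
    ... | false = refl
    ... | true with v ≟ u
    ...   | yes refl = ≤ᵇ-true {toℕ v} ≤-refl
    ...   | no v≢u   = ≤ᵇ-true (h u (reach-adj N eq v≢u))

  compRep-least : ∀ {u v} → compRep G ρ u ≡ true → reach G ρ N u v ≡ true → toℕ u ≤ toℕ v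
  compRep-least {u} {v} c r = ≤ᵇ-sound (lem (allF-true c v) r)
    where
    lem : ∀ {a b} → not a ∨ b ≡ true → a ≡ true → b ≡ true
    lem e refl = e

  ClosedUnder : (Fin N → Bool) → Set
  ClosedUnder P = ∀ u v → Adj G u v → P u ≡ true → P v ≡ true

  reach-self : ∀ k u → reach G ρ k u u ≡ true
  reach-self zero    u = eqF-refl u
  reach-self (suc k) u = ∨-introˡ (reach-self k u)

  -- Until it is closed, the ball around u gains a vertex with every step.
  reach-grows : ∀ k u → ClosedUnder (reach G ρ k u) ⊎ k < sumF (ι ∘ reach G ρ k u)
  reach-grows zero u = inj₂ (≤-trans (≤-reflexive (cong ι (≡-sym (reach-self 0 u)))) (sumF-≥ u (ι ∘ reach G ρ 0 u)))
  reach-grows (suc k) u with reach-grows k u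
  ... | inj₁ c = inj₁ λ v w e r → ∨-introˡ (c v w e (back v r))
    where
    back : ∀ v → reach G ρ (suc k) u v ≡ true → reach G ρ k u v ≡ true
    back v r with ∨-true {reach G ρ k u v} r
    ... | inj₁ r′ = r′
    ... | inj₂ r′ = let w , h = anyF-true r′ ; a , b = ∧-true {reach G ρ k u w} h in c w v b a
  ... | inj₂ k< with anyF (λ v → reach G ρ (suc k) u v ∧ not (reach G ρ k u v)) in eq
  ...   | false = inj₁ λ v w e r → ∨-introˡ (back w (∨-introʳ {reach G ρ k u w} (anyF-intro v (∧-intro (back v r) e))))
    where
    back : ∀ v → reach G ρ (suc k) u v ≡ true → reach G ρ k u v ≡ true
    back v r = case-not (λ nr → true≢false
      (anyF-intro {p = λ v → reach G ρ (suc k) u v ∧ not (reach G ρ k u v)} v (∧-intro r nr)) eq)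
      where
      case-not : ∀ {b} → ¬ (not b ≡ true) → b ≡ true
      case-not {true}  _ = refl
      case-not {false} h = ⊥-elim (h refl)
  ...   | true with anyF-true eq
  ...     | v , e = inj₂ (≤-trans (s≤s k<) (strict v (proj₁ (∧-true e)) (proj₂ (∧-true {reach G ρ (suc k) u v} e))))
    where
    ι-mono : ∀ {a b} → (a ≡ true → b ≡ true) → ι a ≤ ι b
    ι-mono {true}  h rewrite h refl = ≤-refl
    ι-mono {false} h = z≤n
    strict : ∀ v → reach G ρ (suc k) u v ≡ true → not (reach G ρ k u v) ≡ true →
      sumF (ι ∘ reach G ρ k u) < sumF (ι ∘ reach G ρ (suc k) u)
    strict v r nr = ≤-trans (≤-reflexive (≡-sym (trans (cong (_+ S) (sumF-eq v)) refl)))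
      (≤-trans (≤-reflexive (≡-sym (sumF-+ (λ w → ι (eqF v w)) (ι ∘ reach G ρ k u)))) (sumF-mono le))
      where
      S = sumF (ι ∘ reach G ρ k u)
      sumF-eq : ∀ v → sumF (λ w → ι (eqF v w)) ≡ 1
      sumF-eq v = trans (sumF-point v {λ w → ι (eqF v w)} λ i i≢v → cong ι (eqF-false (i≢v ∘ ≡-sym))) (cong ι (eqF-refl v))
      le : ∀ w → ι (eqF v w) + ι (reach G ρ k u w) ≤ ι (reach G ρ (suc k) u w)
      le w with eqF v w in e′
      ... | false = ι-mono {reach G ρ k u w} ∨-introˡ
      ... | true with eqF-true {a = v} {w} e′
      ...   | refl rewrite r | not-true nr = ≤-refl

  -- If it were still growing after N steps, the ball would have more than N vertices.
  reach-closed : ∀ u → ClosedUnder (reach G ρ N u)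
  reach-closed u with reach-grows N u
  ... | inj₁ c  = c
  ... | inj₂ N< = ⊥-elim (<⇒≱ N< (≤-trans (sumF-mono λ v → ι≤1 (reach G ρ N u v)) (≤-reflexive (trans (sumF-const N 1) (*-identityʳ N)))))
    where
    ι≤1 : ∀ b → ι b ≤ 1
    ι≤1 true  = ≤-refl
    ι≤1 false = z≤n

  -- Paths are avoided: connected means that closed sets of vertices are trivial.
  Connected : Set
  Connected = ∀ P → ClosedUnder P → ∀ {u v} → hasNbr G ρ u ≡ true → hasNbr G ρ v ≡ true → P u ≡ true → P v ≡ true

  -- The closed ball around a representative with a neighbour contains the least vertex `r` that has
  -- a neighbour, so the representative is at most `r`, hence equal to it.
  #bigComps-connected : ∀ {u v} → Adj G u v → Connected → #bigComps G ρ ≡ 1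
  #bigComps-connected {u} {v} e conn with least-hasNbr {u} (hasNbr-intro e)
  ... | r , hr , least = trans (count-sum λ w → compRep G ρ w ∧ hasNbr G ρ w) (trans
    (sumF-point r {λ w → ι (compRep G ρ w ∧ hasNbr G ρ w)} λ w w≢r → cong ι (¬true⇒false λ h → w≢r (unique w h)))
    (cong ι (∧-intro (least-compRep least) hr)))
    where
    unique : ∀ w → compRep G ρ w ∧ hasNbr G ρ w ≡ true → w ≡ r
    unique w h = let c , hw = ∧-true h in toℕ-injective (≤-antisym
      (compRep-least c (conn (reach G ρ N w) (reach-closed w) hw hr (reach-self N w))) (least w hw))

  #bigComps-positive : ∀ {u v} → Adj G u v → 1 ≤ #bigComps G ρ
  #bigComps-positive {u} {v} e with least-hasNbr {u} (hasNbr-intro e)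
  ... | r , hr , least = ≤-trans (≤-reflexive (≡-sym (cong ι (∧-intro (least-compRep least) hr))))
    (≤-trans (sumF-≥ r (λ w → ι (compRep G ρ w ∧ hasNbr G ρ w))) (≤-reflexive (≡-sym (count-sum λ w → compRep G ρ w ∧ hasNbr G ρ w))))

-- Bipartite planar graphs have fewer than 2N edges

sumF-unique : ∀ {n} (p : Fin n → Bool) → (∀ i j → p i ≡ true → p j ≡ true → i ≡ j) → sumF (ι ∘ p) ≤ 1
sumF-unique p h with anyF p in eq
... | true with anyF-true eq
...   | i , pi = ≤-reflexive (trans
  (sumF-point i {ι ∘ p} λ j j≢i → cong ι (¬true⇒false λ pj → j≢i (h j i pj pi))) (cong ι pi))
sumF-unique p h | false = ≤-trans
  (≤-reflexive (sumF-0 {f = ι ∘ p} λ i → cong ι (¬true⇒false λ pi → true≢false (anyF-intro i pi) eq))) z≤n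

sumD-unique : ∀ {N} (p : Dart N → Bool) → (∀ d e → p d ≡ true → p e ≡ true → d ≡ e) → sumD (ι ∘ p) ≤ 1
sumD-unique {N} p h with anyF (λ u → anyF λ v → p (u , v)) in eq
... | true with anyF-true eq
...   | u , e with anyF-true e
...     | v , puv = ≤-reflexive (trans
  (sumD-point (u , v) {ι ∘ p} λ d d≢ → cong ι (¬true⇒false λ pd → d≢ (h d (u , v) pd puv))) (cong ι puv))
sumD-unique {N} p h | false = ≤-trans
  (≤-reflexive (sumD-0 {f = ι ∘ p} λ (u , v) → cong ι (¬true⇒false λ pd → true≢false
    (anyF-intro {p = λ u → anyF λ v → p (u , v)} u (anyF-intro {p = λ v → p (u , v)} v pd)) eq))) z≤n

#darts-sumD : ∀ {N} (G : Graph N) ρ → #darts G ρ ≡ sumD (λ (u , v) → ι (adj G u v))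
#darts-sumD G ρ = sumF-cong λ u → count-sum (adj G u)

⌊⌋-true : ∀ {A : Set} (d : Dec A) → ⌊ d ⌋ ≡ true → A
⌊⌋-true (yes a) _ = a

⌊⌋-intro : ∀ {A : Set} (d : Dec A) → A → ⌊ d ⌋ ≡ true
⌊⌋-intro (yes _) _ = refl
⌊⌋-intro (no h)  a = ⊥-elim (h a)

module Bipartite {N : ℕ} (G : Graph N) (ρ : Fin N → Fin N → Fin N) (isRot : IsRotation G ρ)
  (c : Fin N → Bool) (proper : ∀ u v → Adj G u v → c v ≡ not (c u)) where

  open Rotation G ρ isRot
  open Components G ρ

  φ² φ³ : Dart N → Dart N
  φ² d = φ (φ d)
  φ³ d = φ (φ² d)

  digon : Dart N → Bool
  digon d = rep d ∧ ⌊ φ² d ≟D d ⌋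

  colour-φ : ∀ d → IsDart G d → c (proj₁ (φ d)) ≡ not (c (proj₁ d))
  colour-φ (u , v) e = proper u v e

  φ-≢ : ∀ d → IsDart G d → φ d ≢ d
  φ-≢ d e eq = not-fix (trans (≡-sym (colour-φ d e)) (cong (c ∘ proj₁) eq))
    where
    not-fix : ∀ {b} → not b ≡ b → ⊥
    not-fix {true} ()
    not-fix {false} ()

  φ³-≢ : ∀ d → IsDart G d → φ³ d ≢ d
  φ³-≢ d e eq = not³-fix (trans
    (≡-sym (trans (colour-φ (φ² d) (iter-dart 2 d e)) (cong not (trans (colour-φ (φ d) (φ-closed d e)) (cong not (colour-φ d e))))))
    (cong (c ∘ proj₁) eq))
    where
    not³-fix : ∀ {b} → not (not (not b)) ≡ b → ⊥
    not³-fix {true} ()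
    not³-fix {false} ()

  mem : Dart N → Dart N → Bool
  mem r d = ⌊ r ≟D d ⌋ ∨ ⌊ φ r ≟D d ⌋ ∨ ⌊ φ² r ≟D d ⌋ ∨ ⌊ φ³ r ≟D d ⌋

  mem-reach : ∀ r d → mem r d ≡ true → Reach φ r d
  mem-reach r d e with ∨-true {⌊ r ≟D d ⌋} e
  ... | inj₁ e₁ = 0 , ⌊⌋-true (r ≟D d) e₁
  ... | inj₂ e′ with ∨-true {⌊ φ r ≟D d ⌋} e′
  ...   | inj₁ e₁ = 1 , ⌊⌋-true (φ r ≟D d) e₁
  ...   | inj₂ e″ with ∨-true {⌊ φ² r ≟D d ⌋} e″
  ...     | inj₁ e₁ = 2 , ⌊⌋-true (φ² r ≟D d) e₁
  ...     | inj₂ e₁ = 3 , ⌊⌋-true (φ³ r ≟D d) e₁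

  cov : Dart N → Dart N → ℕ
  cov r d = ι (rep r ∧ mem r d)

  -- A representative is charged with the first four darts of its face. Odd numbers of steps change
  -- the colour of the tail, and `φ² r ≡ r` holds only on a digon. So the four darts are distinct,
  -- or there are two of them on a digon, where `2 * ι (digon r)` makes up for the rest.
  cov-row : ∀ r → 4 * ι (rep r) ≤ sumD (cov r) + 2 * ι (digon r)
  cov-row r with rep r in eq
  ... | false = z≤n
  ... | true with φ² r ≟D r
  ...   | yes _ = +-monoˡ-≤ 2 (≤-trans
    (≤-reflexive (≡-sym (trans (sumD-+ (δ r) (δ (φ r))) (cong₂ _+_ (sumD-δ r) (sumD-δ (φ r))))))
    (sumD-mono le))
    where
    le : ∀ d → δ r d + δ (φ r) d ≤ ι (mem r d)
    le d with r ≟D d | φ r ≟D d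
    ... | yes refl | yes e = ⊥-elim (φ-≢ r (rep-dart r eq) e)
    ... | yes _    | no _  = ≤-refl
    ... | no _     | yes _ = ≤-refl
    ... | no _     | no _  = z≤n
  ...   | no ¬φ² = ≤-trans
    (≤-reflexive (≡-sym (trans (sumD-+ _ (λ d → δ (φ r) d + (δ (φ² r) d + δ (φ³ r) d)))
      (cong₂ _+_ (sumD-δ r) (trans (sumD-+ _ (λ d → δ (φ² r) d + δ (φ³ r) d))
        (cong₂ _+_ (sumD-δ (φ r)) (trans (sumD-+ (δ (φ² r)) (δ (φ³ r))) (cong₂ _+_ (sumD-δ (φ² r)) (sumD-δ (φ³ r))))))))))
    (≤-trans (sumD-mono le) (m≤m+n _ 0))
    where
    e₀ = rep-dart r eq
    e₁ = φ-closed r e₀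
    e₂ = φ-closed (φ r) e₁
    le : ∀ d → δ r d + (δ (φ r) d + (δ (φ² r) d + δ (φ³ r) d)) ≤ ι (mem r d)
    le d with r ≟D d | φ r ≟D d | φ² r ≟D d | φ³ r ≟D d
    ... | yes refl | yes e  | _      | _      = ⊥-elim (φ-≢ r e₀ e)
    ... | yes refl | _      | yes e  | _      = ⊥-elim (¬φ² e)
    ... | yes refl | _      | _      | yes e  = ⊥-elim (φ³-≢ r e₀ e)
    ... | no _ | yes refl | yes e | _         = ⊥-elim (φ-≢ (φ r) e₁ e)
    ... | no _ | yes refl | _     | yes e     = ⊥-elim (¬φ² (φ-inj (φ² r) r e₂ e₀ e))
    ... | no _ | no _ | yes refl | yes e      = ⊥-elim (φ-≢ (φ² r) e₂ e)
    ... | yes _ | no _ | no _ | no _ = ≤-refl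
    ... | no _ | yes _ | no _ | no _ = ≤-refl
    ... | no _ | no _ | yes _ | no _ = ≤-refl
    ... | no _ | no _ | no _ | yes _ = ≤-refl
    ... | no _ | no _ | no _ | no _  = z≤n

  -- All representatives that cover a dart lie on its face, and a face has a single representative.
  cov-column : ∀ d → sumD (λ r → cov r d) ≤ ι (adj G (proj₁ d) (proj₂ d))
  cov-column d with adj G (proj₁ d) (proj₂ d) in eq
  ... | true  = sumD-unique (λ r → rep r ∧ mem r d) λ r s er es →
    let rr , mr = ∧-true er ; rs , ms = ∧-true es
    in rep-unique r s rr rs (reach-trans (mem-reach r d mr) (reach-sym s d (rep-dart s rs) (mem-reach s d ms)))
  ... | false = ≤-reflexive (sumD-0 λ r → cong ι (¬true⇒false λ er →
    let rr , mr = ∧-true er ; i , e = mem-reach r d mr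
    in true≢false (subst (IsDart G) e (iter-dart i r (rep-dart r rr))) eq))

  #digons : ℕ
  #digons = sumD (ι ∘ digon)

  4*faces≤ : 4 * #faces G ρ ≤ #darts G ρ + 2 * #digons
  4*faces≤ = begin
    4 * #faces G ρ                                            ≡⟨ cong (4 *_) #faces-sumD ⟩
    4 * sumD (ι ∘ rep)                                        ≡⟨ ≡-sym (sumD-* 4 (ι ∘ rep)) ⟩
    sumD (λ r → 4 * ι (rep r))                                ≤⟨ sumD-mono cov-row ⟩
    sumD (λ r → sumD (cov r) + 2 * ι (digon r))               ≡⟨ sumD-+ (sumD ∘ cov) (λ r → 2 * ι (digon r)) ⟩
    sumD (sumD ∘ cov) + sumD (λ r → 2 * ι (digon r))          ≡⟨ cong₂ _+_ (sumD-swap cov) (sumD-* 2 (ι ∘ digon)) ⟩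
    sumD (λ d → sumD (λ r → cov r d)) + 2 * #digons           ≤⟨ +-monoˡ-≤ (2 * #digons) (sumD-mono cov-column) ⟩
    sumD (λ d → ι (adj G (proj₁ d) (proj₂ d))) + 2 * #digons  ≡⟨ cong (_+ 2 * #digons) (≡-sym (#darts-sumD G ρ)) ⟩
    #darts G ρ + 2 * #digons ∎
    where open ≤-Reasoning

  module _ {u v} (g : digon (u , v) ≡ true) where

    digon-rep : rep (u , v) ≡ true
    digon-rep = proj₁ (∧-true g)

    digon-adj : Adj G u v
    digon-adj = rep-dart (u , v) digon-rep

    digon-φ² : φ² (u , v) ≡ (u , v)
    digon-φ² = ⌊⌋-true (φ² (u , v) ≟D (u , v)) (proj₂ (∧-true {rep (u , v)} g))

    -- The rotation at `x` runs from `y` through all neighbours, so a fixed point leaves room for no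
    -- other neighbour.
    fixed-nbr : ∀ x {y} → Adj G x y → ρ x y ≡ y → ∀ w → Adj G x w → w ≡ y
    fixed-nbr x {y} e fix w e′ with proj₂ isRot x y w e e′
    ... | i , eq = trans (≡-sym eq) (stay i)
      where
      stay : ∀ i → iter (ρ x) i y ≡ y
      stay zero = refl
      stay (suc i) = trans (cong (ρ x) (stay i)) fix

    digon-nbrʳ : ∀ w → Adj G v w → w ≡ u
    digon-nbrʳ = fixed-nbr v (adj-sym G digon-adj) (cong proj₁ digon-φ²)

    digon-nbrˡ : ∀ w → Adj G u w → w ≡ v
    digon-nbrˡ = fixed-nbr u digon-adj
      (trans (cong (λ x → ρ x v) (≡-sym (cong proj₁ digon-φ²))) (cong proj₂ digon-φ²))

    digon-reach : ∀ k w → reach G ρ k u w ≡ true → w ≡ u ⊎ w ≡ v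
    digon-reach zero w e = inj₁ (≡-sym (eqF-true e))
    digon-reach (suc k) w e with ∨-true {reach G ρ k u w} e
    ... | inj₁ e′ = digon-reach k w e′
    ... | inj₂ e′ with anyF-true e′
    ...   | x , e″ with ∧-true {reach G ρ k u x} e″
    ...     | rx , ax with digon-reach k x rx
    ...       | inj₁ refl = inj₂ (digon-nbrˡ w ax)
    ...       | inj₂ refl = inj₁ (digon-nbrʳ w ax)

    digon-≤ : toℕ u ≤ toℕ v
    digon-≤ = ≮⇒≥ λ v<u → <⇒≱
      (begin-strict
        toℕ v * N + toℕ u   <⟨ +-monoʳ-< (toℕ v * N) (toℕ<n u) ⟩
        toℕ v * N + N       ≡⟨ +-comm (toℕ v * N) N ⟩
        suc (toℕ v) * N     ≤⟨ *-monoˡ-≤ N v<u ⟩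
        toℕ u * N           ≤⟨ m≤m+n _ (toℕ v) ⟩
        toℕ u * N + toℕ v   ∎)
      (subst (λ x → toℕ u * N + toℕ v ≤ toℕ v * N + toℕ x) (cong proj₁ digon-φ²)
        (rep-least (u , v) (φ (u , v)) digon-rep (1 , refl)))
      where open ≤-Reasoning

    -- The component consists of the edge `uv`, and `u` is its smaller end because the
    -- representative has the least key on the face. Thus digons can be charged to components
    -- without repetition.
    digon-comp : compRep G ρ u ∧ hasNbr G ρ u ≡ true
    digon-comp = ∧-intro (allF-intro below) (hasNbr-intro digon-adj)
      where
      below : ∀ w → not (reach G ρ N u w) ∨ (toℕ u ≤ᵇ toℕ w) ≡ true
      below w with reach G ρ N u w in eq
      ... | false = refl
      ... | true with digon-reach N w eq
      ...   | inj₁ refl = ≤ᵇ-true {toℕ u} ≤-refl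
      ...   | inj₂ refl = ≤ᵇ-true digon-≤

  digons≤comps : #digons ≤ #bigComps G ρ
  digons≤comps = ≤-trans (sumF-mono row) (≤-reflexive (≡-sym (count-sum λ u → compRep G ρ u ∧ hasNbr G ρ u)))
    where
    row : ∀ u → sumF (λ v → ι (digon (u , v))) ≤ ι (compRep G ρ u ∧ hasNbr G ρ u)
    row u with compRep G ρ u ∧ hasNbr G ρ u in eq
    ... | true  = sumF-unique (λ v → digon (u , v)) λ v w gv gw → digon-nbrˡ gw v (digon-adj gv)
    ... | false = ≤-reflexive (sumF-0 {f = λ v → ι (digon (u , v))} λ v → cong ι (¬true⇒false λ g → true≢false (digon-comp {u} {v} g) eq))

  darts<4N : 1 ≤ N → EulerGenus0 G ρ → #darts G ρ < 4 * N
  darts<4N 1≤N euler with anyF (hasNbr G ρ) in eq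
  ... | false = ≤-trans (s≤s (≤-reflexive (trans (#darts-sumD G ρ) (sumD-0 λ (u , v) → cong ι (¬true⇒false λ e →
    true≢false (anyF-intro {p = hasNbr G ρ} u (hasNbr-intro e)) eq))))) (≤-trans 1≤N (m≤m+n N _))
  ... | true with anyF-true {p = hasNbr G ρ} eq
  ...   | u , h with hasNbr-elim {u} h
  ...     | v , e = arith N (#faces G ρ) (#darts G ρ) (#bigComps G ρ) (#isolated G ρ) #digons
              euler 4*faces≤ digons≤comps (#bigComps-positive e)
    where
    -- Doubling Euler's formula and inserting 4F ≤ D + 2C leaves D + 6C + 4I ≤ 4N, which is strict
    -- for D since C ≥ 1.
    arith : ∀ N F D C I f → 2 * N + 2 * F ≡ D + 4 * C + 2 * I → 4 * F ≤ D + 2 * f → f ≤ C → 1 ≤ C → D < 4 * N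
    arith N F D C I f eu 4F≤ f≤C 1≤C = +-cancelʳ-≤ (D + 2 * C) (suc D) (4 * N) (begin
      suc D + (D + 2 * C)                    ≡⟨ l₁ D C ⟩
      2 * D + 2 * C + 1                      ≤⟨ +-monoʳ-≤ (2 * D + 2 * C) (≤-trans 1≤C (m≤m+n C (5 * C + 4 * I))) ⟩
      2 * D + 2 * C + (C + (5 * C + 4 * I))  ≡⟨ l₂ D C I ⟩
      2 * (D + 4 * C + 2 * I)                ≡⟨ cong (2 *_) (≡-sym eu) ⟩
      2 * (2 * N + 2 * F)                    ≡⟨ l₃ N F ⟩
      4 * N + 4 * F                          ≤⟨ +-monoʳ-≤ (4 * N) (≤-trans 4F≤ (+-monoʳ-≤ D (*-monoʳ-≤ 2 f≤C))) ⟩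
      4 * N + (D + 2 * C)                    ∎)
      where
      open ≤-Reasoning
      l₁ : ∀ D C → suc D + (D + 2 * C) ≡ 2 * D + 2 * C + 1
      l₁ = solve-∀
      l₂ : ∀ D C I → 2 * D + 2 * C + (C + (5 * C + 4 * I)) ≡ 2 * (D + 4 * C + 2 * I)
      l₂ = solve-∀
      l₃ : ∀ N F → 2 * (2 * N + 2 * F) ≡ 4 * N + 4 * F
      l₃ = solve-∀

-- K_{n,n,n} × K₂ is the blow-up of the hexagon 0, …, 5: the class of part a and side s is the
-- residue k mod 6 with k ≡ a mod 3 and k ≡ s mod 2.

pattern 0F = zero
pattern 1F = suc zero
pattern 2F = suc (suc zero)
pattern 3F = suc (suc (suc zero))
pattern 4F = suc (suc (suc (suc zero)))
pattern 5F = suc (suc (suc (suc (suc zero))))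

mod3 : Fin 6 → Fin 3
mod3 0F = 0F
mod3 1F = 1F
mod3 2F = 2F
mod3 3F = 0F
mod3 4F = 1F
mod3 5F = 2F

mod2 : Fin 6 → Fin 2
mod2 0F = 0F
mod2 1F = 1F
mod2 2F = 0F
mod2 3F = 1F
mod2 4F = 0F
mod2 5F = 1F

crt : Fin 3 → Fin 2 → Fin 6
crt 0F 0F = 0F
crt 1F 1F = 1F
crt 2F 0F = 2F
crt 0F 1F = 3F
crt 1F 0F = 4F
crt 2F 1F = 5F

crt-mod : ∀ k → crt (mod3 k) (mod2 k) ≡ k
crt-mod 0F = refl
crt-mod 1F = refl
crt-mod 2F = refl
crt-mod 3F = refl
crt-mod 4F = refl
crt-mod 5F = refl

mod-crt : ∀ a s → mod3 (crt a s) ≡ a × mod2 (crt a s) ≡ s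
mod-crt 0F 0F = refl , refl
mod-crt 1F 1F = refl , refl
mod-crt 2F 0F = refl , refl
mod-crt 0F 1F = refl , refl
mod-crt 1F 0F = refl , refl
mod-crt 2F 1F = refl , refl

-- Residues that differ both modulo 3 and modulo 2 differ by 1 or 5 modulo 6, so this is adjacency
-- in the hexagon.
link : Fin 6 → Fin 6 → Bool
link k l = not (eqF (mod3 k) (mod3 l)) ∧ not (eqF (mod2 k) (mod2 l))

module Hexagon (n : ℕ) where

  N : ℕ
  N = 3 * n * 2

  V : Set
  V = Fin N

  opaque

    H : Graph N
    H = Knnn n ⊗ K₂

    H-def : H ≡ Knnn n ⊗ K₂
    H-def = refl

    vtx : Fin 6 → Fin n → V
    vtx k j = combine (combine (mod3 k) j) (mod2 k)

    pt : V → Fin 6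
    pt x = crt (proj₁ (remQuot {3} n (proj₁ (remQuot {3 * n} 2 x)))) (proj₂ (remQuot {3 * n} 2 x))

    ix : V → Fin n
    ix x = proj₂ (remQuot {3} n (proj₁ (remQuot {3 * n} 2 x)))

    pt-combine : ∀ a (j : Fin n) s → pt (combine (combine a j) s) ≡ crt a s
    pt-combine a j s = trans
      (cong (λ q → crt (proj₁ (remQuot {3} n (proj₁ q))) (proj₂ q)) (remQuot-combine {3 * n} {2} (combine a j) s))
      (cong (λ q → crt (proj₁ q) s) (remQuot-combine {3} {n} a j))

    pt-vtx : ∀ k j → pt (vtx k j) ≡ k
    pt-vtx k j = trans (pt-combine (mod3 k) j (mod2 k)) (crt-mod k)

    ix-vtx : ∀ k j → ix (vtx k j) ≡ j
    ix-vtx k j = trans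
      (cong (λ q → proj₂ (remQuot {3} n (proj₁ q))) (remQuot-combine {3 * n} {2} (combine (mod3 k) j) (mod2 k)))
      (cong proj₂ (remQuot-combine {3} {n} (mod3 k) j))

    vtx-pt : ∀ x → vtx (pt x) (ix x) ≡ x
    vtx-pt x = trans
      (cong₂ (λ a s → combine (combine a (ix x)) s) (proj₁ (mod-crt a s)) (proj₂ (mod-crt a s)))
      (trans (cong (λ y → combine y s) (combine-remQuot {3} n (proj₁ (remQuot {3 * n} 2 x)))) (combine-remQuot {3 * n} 2 x))
      where
      a : Fin 3
      a = proj₁ (remQuot {3} n (proj₁ (remQuot {3 * n} 2 x)))
      s : Fin 2
      s = proj₂ (remQuot {3 * n} 2 x)

    adj-link : ∀ x y → adj H x y ≡ link (pt x) (pt y)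
    adj-link x y = cong₂ (λ b c → not b ∧ not c)
      (≡-sym (cong₂ eqF (proj₁ (mod-crt (a x) s)) (proj₁ (mod-crt (a y) t))))
      (≡-sym (cong₂ eqF (proj₂ (mod-crt (a x) s)) (proj₂ (mod-crt (a y) t))))
      where
      a : V → Fin 3
      a x = proj₁ (remQuot {3} n (proj₁ (remQuot {3 * n} 2 x)))
      s : Fin 2
      s = proj₂ (remQuot {3 * n} 2 x)
      t : Fin 2
      t = proj₂ (remQuot {3 * n} 2 y)

    adj-vtx : ∀ k j l i → adj H (vtx k j) (vtx l i) ≡ link k l
    adj-vtx k j l i = trans (adj-link (vtx k j) (vtx l i)) (cong₂ link (pt-vtx k j) (pt-vtx l i))

  degree : ∀ x → sumF (λ y → ι (adj H x y)) ≡ 2 * n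
  degree x = begin
    sumF (λ y → ι (adj H x y))
      ≡⟨ sumF-combine (3 * n) {2} (λ y → ι (adj H x y)) ⟩
    sumF {3 * n} (λ b → sumF {2} λ s → ι (adj H x (combine b s)))
      ≡⟨ sumF-combine 3 {n} (λ b → sumF {2} λ s → ι (adj H x (combine b s))) ⟩
    sumF {3} (λ a → sumF {n} λ j → sumF {2} λ s → ι (adj H x (combine (combine a j) s)))
      ≡⟨ sumF-cong {3} (λ a → trans
           (sumF-cong {n} λ j → sumF-cong {2} λ s → cong ι (trans (adj-link x _) (cong (link (pt x)) (pt-combine a j s))))
           (sumF-const n (sumF {2} λ s → ι (link (pt x) (crt a s))))) ⟩
    sumF {3} (λ a → n * sumF {2} λ s → ι (link (pt x) (crt a s)))
      ≡⟨ cases (pt x) ⟩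
    2 * n ∎
    where
    open ≡-Reasoning
    l₁ : ∀ n → n * 0 + (n * 1 + (n * 1 + 0)) ≡ 2 * n
    l₁ = solve-∀
    l₂ : ∀ n → n * 1 + (n * 0 + (n * 1 + 0)) ≡ 2 * n
    l₂ = solve-∀
    l₃ : ∀ n → n * 1 + (n * 1 + (n * 0 + 0)) ≡ 2 * n
    l₃ = solve-∀
    cases : ∀ k → sumF {3} (λ a → n * sumF {2} λ s → ι (link k (crt a s))) ≡ 2 * n
    cases 0F = l₁ n
    cases 1F = l₂ n
    cases 2F = l₃ n
    cases 3F = l₁ n
    cases 4F = l₂ n
    cases 5F = l₃ n

  -- The lower bound by counting darts

  colour : V → Bool
  colour x = eqF (mod2 (pt x)) 0F

  link-mod2 : ∀ k l → link k l ≡ true → eqF (mod2 l) 0F ≡ not (eqF (mod2 k) 0F)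
  link-mod2 k l e = lem (mod2 k) (mod2 l) (proj₂ (∧-true {not (eqF (mod3 k) (mod3 l))} e))
    where
    lem : ∀ (a b : Fin 2) → not (eqF a b) ≡ true → eqF b 0F ≡ not (eqF a 0F)
    lem 0F 1F _ = refl
    lem 1F 0F _ = refl
    lem 0F 0F ()
    lem 1F 1F ()

  lower-bound : n ≥ 1 → ∀ k → PlanarDecomposition H k → ⌈ n + 1 /2⌉ ≤ k
  lower-bound n≥1 k (L , planar , sub , cover) =
    ≤-trans (⌈n/2⌉-mono n+1≤2k) (≤-reflexive (≡-sym (n≡⌈n+n/2⌉ k)))
    where
    open ≤-Reasoning
    D : Fin k → ℕ
    D i = sumD (λ (u , v) → ι (adj (L i) u v))
    N≥1 : 1 ≤ N
    N≥1 = ≤-trans n≥1 (≤-trans (m≤n*m n 3) (m≤m*n (3 * n) 2))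
    D< : ∀ i → suc (D i) ≤ 4 * N
    D< i with planar i
    ... | ρ , isRot , euler = subst (λ z → suc z ≤ 4 * N) (#darts-sumD (L i) ρ)
      (Bipartite.darts<4N (L i) ρ isRot colour
        (λ u v e → link-mod2 (pt u) (pt v) (trans (≡-sym (adj-link u v)) (sub i u v e))) N≥1 euler)
    covered : ∀ d → ι (adj H (proj₁ d) (proj₂ d)) ≤ sumF (λ i → ι (adj (L i) (proj₁ d) (proj₂ d)))
    covered (u , v) with adj H u v in eq
    ... | false = z≤n
    ... | true with cover u v eq
    ...   | i , e = ≤-trans (≤-reflexive (cong ι (≡-sym e))) (sumF-≥ i (λ i → ι (adj (L i) u v)))
    total : N * (2 * n) + k ≤ k * (4 * N)
    total = begin
      N * (2 * n) + k
        ≡⟨ cong (_+ k) (≡-sym (trans (sumF-cong {N} degree) (sumF-const N (2 * n)))) ⟩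
      sumD (λ d → ι (adj H (proj₁ d) (proj₂ d))) + k
        ≤⟨ +-monoˡ-≤ k (sumD-mono covered) ⟩
      sumD (λ d → sumF (λ i → ι (adj (L i) (proj₁ d) (proj₂ d)))) + k
        ≡⟨ cong (_+ k) (sumDF-swap (λ d i → ι (adj (L i) (proj₁ d) (proj₂ d)))) ⟩
      sumF D + k
        ≡⟨ cong (sumF D +_) (≡-sym (trans (sumF-const k 1) (*-identityʳ k))) ⟩
      sumF D + sumF {k} (λ _ → 1)
        ≡⟨ ≡-sym (sumF-+ D (λ _ → 1)) ⟩
      sumF (λ i → D i + 1)
        ≤⟨ sumF-mono (λ i → ≤-trans (≤-reflexive (+-comm (D i) 1)) (D< i)) ⟩
      sumF {k} (λ _ → 4 * N)
        ≡⟨ sumF-const k (4 * N) ⟩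
      k * (4 * N) ∎
    l₁ : ∀ a b → a * (4 * b) ≡ b * (2 * (a + a))
    l₁ = solve-∀
    n+1≤2k : n + 1 ≤ k + k
    n+1≤2k = ≮⇒≥ λ 2k<n+1 → <⇒≱ (pos (≤-pred (≤-trans 2k<n+1 (≤-reflexive (+-comm n 1))))) total
      where
      -- Contradicts `total`. The strictness comes from the summand `k`, one dart spared in every
      -- layer; for k = 0 it comes from N * (2 * n) being positive.
      pos : k + k ≤ n → k * (4 * N) < N * (2 * n) + k
      pos 2k≤n with k ℕ.≟ 0
      ... | no k≢0 = begin-strict
        k * (4 * N)        ≡⟨ l₁ k N ⟩
        N * (2 * (k + k))  ≤⟨ *-monoʳ-≤ N (*-monoʳ-≤ 2 2k≤n) ⟩
        N * (2 * n)        <⟨ m<m+n _ (n≢0⇒n>0 k≢0) ⟩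
        N * (2 * n) + k    ∎
      ... | yes k≡0 = begin-strict
        k * (4 * N)        ≡⟨ cong (_* (4 * N)) k≡0 ⟩
        0                  <⟨ *-mono-≤ N≥1 (≤-trans n≥1 (m≤n*m n 2)) ⟩
        N * (2 * n)        ≤⟨ m≤m+n _ k ⟩
        N * (2 * n) + k    ∎

-- Inserting two elements into a permutation

-- φ′ extends φ by the new elements α and β: α is put before dc and β before da, but the old
-- predecessor of da is now followed by α and that of dc by β.
record Insertion {D : Set} (P P′ : D → Set) (φ φ′ : D → D) (α β da dc : D) : Set where
  field
    closed : Closed P φ
    ¬Pα    : ¬ P α
    ¬Pβ    : ¬ P β
    α≢β    : α ≢ β
    keep   : ∀ d → P d → P′ d
    P′α    : P′ α
    P′β    : P′ β
    cases  : ∀ d → P′ d → P d ⊎ d ≡ α ⊎ d ≡ β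
    at-α   : φ′ α ≡ dc
    at-β   : φ′ β ≡ da
    to-α   : ∀ d → P d → φ d ≡ da → φ′ d ≡ α
    to-β   : ∀ d → P d → φ d ≡ dc → φ′ d ≡ β
    same   : ∀ d → P d → φ d ≢ da → φ d ≢ dc → φ′ d ≡ φ d

module _ {D : Set} (_≟ᴰ_ : (d e : D) → Dec (d ≡ e)) {P P′ : D → Set} {φ φ′ : D → D} {α β da dc : D}
  (I : Insertion P P′ φ φ′ α β da dc) (L : OrbitLabelling P φ) (Pda : P da) where

  open Insertion I
  open OrbitLabelling L

  -- The orbit of `da` merely makes a detour through `α` and `β` before it enters `da`, so no orbit
  -- is created and both new elements take over the label of `da`.
  extend-labelling : dc ≡ β → Σ (OrbitLabelling P′ φ′) λ L′ → OrbitLabelling.size L′ ≡ size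
  extend-labelling dc≡β = record
    { size  = size
    ; lab   = lab ∘ base
    ; inv   = inv′
    ; conn  = λ d e pd pe eq → reach-trans (to-base d pd) (reach-trans
        (reach-map (λ x → x) closed lift (base d) (base e) (base-P d pd)
          (conn _ _ (base-P d pd) (base-P e pe) eq)) (from-base e pe))
    ; bound = λ d pd → bound (base d) (base-P d pd)
    ; onto  = λ l l< → let d , pd , e = onto l l< in d , keep d pd , trans (cong lab (base-old d pd)) e
    } , refl
    where
    base : D → D
    base d with d ≟ᴰ α | d ≟ᴰ β
    ... | no _ | no _ = d
    ... | _    | _    = da
    base-old : ∀ d → P d → base d ≡ d
    base-old d pd with d ≟ᴰ α | d ≟ᴰ β
    ... | no _     | no _     = refl
    ... | yes refl | _        = ⊥-elim (¬Pα pd)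
    ... | no _     | yes refl = ⊥-elim (¬Pβ pd)
    base-α : base α ≡ da
    base-α with α ≟ᴰ α | α ≟ᴰ β
    ... | no h  | _ = ⊥-elim (h refl)
    ... | yes _ | _ = refl
    base-β : base β ≡ da
    base-β with β ≟ᴰ α | β ≟ᴰ β
    ... | yes _ | _     = refl
    ... | no _  | no h  = ⊥-elim (h refl)
    ... | no _  | yes _ = refl
    base-P : ∀ d → P′ d → P (base d)
    base-P d pd with cases d pd
    ... | inj₁ p           = subst P (≡-sym (base-old d p)) p
    ... | inj₂ (inj₁ refl) = subst P (≡-sym base-α) Pda
    ... | inj₂ (inj₂ refl) = subst P (≡-sym base-β) Pda
    step : ∀ d → P d → φ d ≢ da → φ′ d ≡ φ d
    step d pd h = same d pd h λ e → ¬Pβ (subst P (trans e dc≡β) (closed d pd))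
    αβ : φ′ α ≡ β
    αβ = trans at-α dc≡β
    lift : ∀ d → P d → Reach φ′ d (φ d)
    lift d pd with φ d ≟ᴰ da
    ... | no h  = reach-step (step d pd h)
    ... | yes e = 3 , trans (cong (φ′ ∘ φ′) (to-α d pd e)) (trans (cong φ′ αβ) (trans at-β (≡-sym e)))
    da→α : Reach φ′ da α
    da→α with conn (φ da) da (closed da Pda) Pda (inv da Pda)
    ... | i , e = reach-trans
      (reach-map (λ x → x) closed lift da (iter φ i da) Pda (i , refl))
      (reach-step (to-α _ (iter-closed {P = P} closed i da Pda) (trans (≡-sym (iter-suc φ i da)) e)))
    to-base : ∀ d → P′ d → Reach φ′ d (base d)
    to-base d pd with cases d pd
    ... | inj₁ p           = 0 , ≡-sym (base-old d p)
    ... | inj₂ (inj₁ refl) = 2 , trans (cong φ′ αβ) (trans at-β (≡-sym base-α))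
    ... | inj₂ (inj₂ refl) = 1 , trans at-β (≡-sym base-β)
    from-base : ∀ d → P′ d → Reach φ′ (base d) d
    from-base d pd with cases d pd
    ... | inj₁ p           = 0 , base-old d p
    ... | inj₂ (inj₁ refl) = subst (λ x → Reach φ′ x α) (≡-sym base-α) da→α
    ... | inj₂ (inj₂ refl) = subst (λ x → Reach φ′ x β) (≡-sym base-β) (reach-trans da→α (reach-step αβ))
    inv′ : ∀ d → P′ d → lab (base (φ′ d)) ≡ lab (base d)
    inv′ d pd with cases d pd
    ... | inj₂ (inj₁ refl) = cong lab (trans (cong base αβ) (trans base-β (≡-sym base-α)))
    ... | inj₂ (inj₂ refl) = cong lab (trans (cong base at-β) (trans (base-old da Pda) (≡-sym base-β)))
    ... | inj₁ p with φ d ≟ᴰ da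
    ...   | yes e = trans (cong lab (trans (cong base (to-α d p e)) (trans base-α (≡-sym e))))
                      (trans (inv d p) (cong lab (≡-sym (base-old d p))))
    ...   | no h  = trans (cong lab (trans (cong base (step d p h)) (base-old (φ d) (closed d p))))
                      (trans (inv d p) (cong lab (≡-sym (base-old d p))))

  -- The arc da, …, φᵏ da becomes an orbit closed up by β; α takes its place in the old orbit.
  split-labelling : InjOn P φ → ∀ k → dc ≡ iter φ (suc k) da → (∀ i → i < suc k → iter φ (suc i) da ≢ da) →
    Σ (OrbitLabelling P′ φ′) λ L′ → OrbitLabelling.size L′ ≡ suc size
  split-labelling inj k dc≡ simple = record
    { size  = suc size
    ; lab   = lab′
    ; inv   = inv′
    ; conn  = conn′
    ; bound = bound′
    ; onto  = onto′
    } , refl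
    where
    Arc : D → Set
    Arc d = ∃ λ i → i < suc k × iter φ i da ≡ d
    arc? : ∀ d → Dec (Arc d)
    arc? d = anyUpTo? (λ i → iter φ i da ≟ᴰ d) (suc k)
    P-iter : ∀ i → P (iter φ i da)
    P-iter i = iter-closed {P = P} closed i da Pda
    arc-P : ∀ d → Arc d → P d
    arc-P d (i , _ , refl) = P-iter i
    Pdc : P dc
    Pdc = subst P (≡-sym dc≡) (P-iter (suc k))
    -- Were `dc` already met on the arc, cancelling the steps up to it would bring the arc back to
    -- `da` too early, against `simple`.
    dc∉ : ¬ Arc dc
    dc∉ (i , i< , e) with m≤n⇒∃[o]m+o≡n i<
    ... | o , i+o≡k = simple o (s≤s (≤-trans (m≤n+m o i) (≤-reflexive (suc-injective i+o≡k))))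
      (≡-sym (iter-cancel {P = P} closed inj i da (iter φ (suc o) da) Pda (P-iter (suc o))
        (trans e (trans dc≡ (trans (cong (λ z → iter φ z da) (trans (≡-sym i+o≡k) (≡-sym (+-suc i o)))) (iter-+ φ i (suc o) da))))))
    α∉ : ¬ Arc α
    α∉ h = ¬Pα (arc-P α h)
    da∈ : Arc da
    da∈ = 0 , s≤s z≤n , refl
    old : D → ℕ
    old d with d ≟ᴰ α
    ... | yes _ = lab da
    ... | no _  = lab d
    old-α : old α ≡ lab da
    old-α with α ≟ᴰ α
    ... | yes _ = refl
    ... | no h  = ⊥-elim (h refl)
    old-P : ∀ d → P d → old d ≡ lab d
    old-P d pd with d ≟ᴰ α
    ... | yes refl = ⊥-elim (¬Pα pd)
    ... | no _     = refl
    New : D → Set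
    New d = Arc d ⊎ d ≡ β
    lab′ : D → ℕ
    lab′ d with arc? d | d ≟ᴰ β
    ... | no _ | no _ = old d
    ... | _    | _    = size
    lab′-new : ∀ d → New d → lab′ d ≡ size
    lab′-new d h with arc? d | d ≟ᴰ β
    ... | yes _ | _     = refl
    ... | no _  | yes _ = refl
    ... | no a  | no b  = ⊥-elim ([ a , b ]′ h)
    lab′-old : ∀ d → ¬ New d → lab′ d ≡ old d
    lab′-old d h with arc? d | d ≟ᴰ β
    ... | yes a | _     = ⊥-elim (h (inj₁ a))
    ... | no _  | yes b = ⊥-elim (h (inj₂ b))
    ... | no _  | no _  = refl
    new? : ∀ d → Dec (New d)
    new? d with arc? d | d ≟ᴰ β
    ... | yes a | _     = yes (inj₁ a)
    ... | no _  | yes b = yes (inj₂ b)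
    ... | no a  | no b  = no [ a , b ]′
    α∉New : ¬ New α
    α∉New = [ α∉ , α≢β ]′
    P∉New : ∀ d → P d → ¬ Arc d → ¬ New d
    P∉New d pd h = [ h , (λ { refl → ¬Pβ pd }) ]′
    lab-arc : ∀ d → Arc d → lab d ≡ lab da
    lab-arc d (i , _ , refl) = lab-iter closed i da Pda
    lab-dc : lab dc ≡ lab da
    lab-dc = trans (cong lab dc≡) (lab-iter closed (suc k) da Pda)
    before-da : ∀ d → P d → φ d ≡ da → ¬ Arc d
    before-da d pd e (i , i< , refl) = simple i i< e
    before-dc : ∀ d → P d → φ d ≡ dc → d ≡ iter φ k da
    before-dc d pd e = inj d (iter φ k da) pd (P-iter k) (trans e dc≡)
    arc-next : ∀ d → Arc d → φ d ≢ dc → Arc (φ d)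
    arc-next d (i , i< , refl) h with m≤n⇒m<n∨m≡n (≤-pred i<)
    ... | inj₁ i<k  = suc i , s≤s i<k , refl
    ... | inj₂ refl = ⊥-elim (h (≡-sym dc≡))
    arc-prev : ∀ d → P d → Arc (φ d) → φ d ≢ da → Arc d
    arc-prev d pd (zero , _ , e) h = ⊥-elim (h (≡-sym e))
    arc-prev d pd (suc i , i< , e) h = i , m<n⇒m<1+n (≤-pred i<) , inj (iter φ i da) d (P-iter i) pd e
    inv-old : ∀ d → ¬ New d → P′ d → ¬ New (φ′ d) × old (φ′ d) ≡ old d
    inv-old d h pd with cases d pd
    ... | inj₂ (inj₁ refl) = (λ x → P∉New dc Pdc dc∉ (subst New at-α x)) ,
      trans (cong old at-α) (trans (old-P dc Pdc) (trans lab-dc (≡-sym old-α)))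
    ... | inj₂ (inj₂ refl) = ⊥-elim (h (inj₂ refl))
    ... | inj₁ p with φ d ≟ᴰ da
    ...   | yes e = (λ x → α∉New (subst New (to-α d p e) x)) ,
      trans (cong old (to-α d p e)) (trans old-α (trans (cong lab (≡-sym e)) (trans (inv d p) (≡-sym (old-P d p)))))
    ...   | no ¬a with φ d ≟ᴰ dc
    ...     | yes e = ⊥-elim (h (inj₁ (k , ≤-refl , ≡-sym (before-dc d p e))))
    ...     | no ¬c = (λ x → P∉New (φ d) (closed d p) (λ y → h (inj₁ (arc-prev d p y ¬a))) (subst New e x)) ,
      trans (cong old e) (trans (old-P (φ d) (closed d p)) (trans (inv d p) (≡-sym (old-P d p))))
      where e = same d p ¬a ¬c
    inv-new : ∀ d → New d → New (φ′ d)
    inv-new d (inj₂ refl) = inj₁ (subst Arc (≡-sym at-β) da∈)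
    inv-new d (inj₁ a) with φ d ≟ᴰ dc
    ... | yes e = inj₂ (to-β d (arc-P d a) e)
    ... | no h  = inj₁ (subst Arc (≡-sym (same d (arc-P d a) (λ e → before-da d (arc-P d a) e a) h)) (arc-next d a h))
    inv′ : ∀ d → P′ d → lab′ (φ′ d) ≡ lab′ d
    inv′ d pd with new? d
    ... | yes h = trans (lab′-new _ (inv-new d h)) (≡-sym (lab′-new d h))
    ... | no h  = let h′ , e = inv-old d h pd in trans (lab′-old _ h′) (trans e (≡-sym (lab′-old d h)))
    -- Collapsing the arc to `α` turns a path of `φ` into a path of `φ′` that stays off the new
    -- orbit.
    m : D → D
    m d with arc? d
    ... | yes _ = α
    ... | no _  = d
    m-arc : ∀ d → Arc d → m d ≡ α
    m-arc d a with arc? d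
    ... | yes _ = refl
    ... | no h  = ⊥-elim (h a)
    m-off : ∀ d → ¬ Arc d → m d ≡ d
    m-off d h with arc? d
    ... | yes a = ⊥-elim (h a)
    ... | no _  = refl
    lift : ∀ d → P d → Reach φ′ (m d) (m (φ d))
    lift d pd with φ d ≟ᴰ da
    ... | yes e = 1 , trans (cong φ′ (m-off d (before-da d pd e)))
      (trans (to-α d pd e) (≡-sym (trans (cong m e) (m-arc da da∈))))
    ... | no ¬a with φ d ≟ᴰ dc
    ...   | yes e = 1 , trans (cong φ′ (m-arc d (k , ≤-refl , ≡-sym (before-dc d pd e))))
      (trans at-α (≡-sym (trans (cong m e) (m-off dc dc∉))))
    ...   | no ¬c with arc? d
    ...     | yes a = 0 , ≡-sym (m-arc (φ d) (arc-next d a ¬c))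
    ...     | no h  = 1 , trans (same d pd ¬a ¬c) (≡-sym (m-off (φ d) λ y → h (arc-prev d pd y ¬a)))
    source : ∀ d → P′ d → ¬ New d → ∃ λ d₀ → P d₀ × m d₀ ≡ d × lab d₀ ≡ old d
    source d pd h with cases d pd
    ... | inj₁ p           = d , p , m-off d (h ∘ inj₁) , ≡-sym (old-P d p)
    ... | inj₂ (inj₁ refl) = da , Pda , m-arc da da∈ , ≡-sym old-α
    ... | inj₂ (inj₂ refl) = ⊥-elim (h (inj₂ refl))
    along : ∀ i → i < suc k → Reach φ′ da (iter φ i da)
    along zero    _  = reach-refl
    along (suc i) i< = reach-trans (along i i<′) (reach-step (same _ (P-iter i)
      (simple i i<′) (λ e → dc∉ (suc i , i< , e))))
      where i<′ = m<n⇒m<1+n (≤-pred i<)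
    ends : Reach φ′ (iter φ k da) β
    ends = reach-step (to-β _ (P-iter k) (≡-sym dc≡))
    from-β : ∀ d → New d → Reach φ′ β d
    from-β d (inj₂ refl) = reach-refl
    from-β d (inj₁ (i , i< , refl)) = reach-trans (reach-step at-β) (along i i<)
    arc-to-β : ∀ o i → i + o ≡ k → Reach φ′ (iter φ i da) β
    arc-to-β zero    i e = subst (λ z → Reach φ′ (iter φ z da) β) (≡-sym (trans (≡-sym (+-identityʳ i)) e)) ends
    arc-to-β (suc o) i e = reach-trans
      (reach-step (same _ (P-iter i) (simple i (m<n⇒m<1+n i<k)) (λ e′ → dc∉ (suc i , s≤s i<k , e′))))
      (arc-to-β o (suc i) (trans (≡-sym (+-suc i o)) e))
      where
      i<k : i < k
      i<k = ≤-trans (≤-trans (s≤s (m≤m+n i o)) (≤-reflexive (≡-sym (+-suc i o)))) (≤-reflexive e)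
    to-β′ : ∀ d → New d → Reach φ′ d β
    to-β′ d (inj₂ refl) = reach-refl
    to-β′ d (inj₁ (i , i< , refl)) = let o , e = m≤n⇒∃[o]m+o≡n i< in arc-to-β o i (suc-injective e)
    old-bound : ∀ d → P′ d → ¬ New d → old d < size
    old-bound d pd h = let d₀ , p , _ , e = source d pd h in subst (_< size) e (bound d₀ p)
    conn′ : ∀ d e → P′ d → P′ e → lab′ d ≡ lab′ e → Reach φ′ d e
    conn′ d e pd pe eq with new? d | new? e
    ... | yes a | yes b = reach-trans (to-β′ d a) (from-β e b)
    ... | yes a | no b  = ⊥-elim (<-irrefl (trans (≡-sym (lab′-old e b)) (trans (≡-sym eq) (lab′-new d a))) (old-bound e pe b))
    ... | no a  | yes b = ⊥-elim (<-irrefl (trans (≡-sym (lab′-old d a)) (trans eq (lab′-new e b))) (old-bound d pd a))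
    ... | no a  | no b  =
      let d₀ , p , md , ld = source d pd a
          e₀ , q , me , le = source e pe b
      in subst₂ (Reach φ′) md me (reach-map m closed lift d₀ e₀ p (conn d₀ e₀ p q
           (trans ld (trans (≡-sym (lab′-old d a)) (trans eq (trans (lab′-old e b) (≡-sym le)))))))
    bound′ : ∀ d → P′ d → lab′ d < suc size
    bound′ d pd with new? d
    ... | yes h = s≤s (≤-reflexive (lab′-new d h))
    ... | no h  = m<n⇒m<1+n (subst (_< size) (≡-sym (lab′-old d h)) (old-bound d pd h))
    onto′ : ∀ l → l < suc size → ∃ λ d → P′ d × lab′ d ≡ l
    onto′ l l< with m≤n⇒m<n∨m≡n (≤-pred l<)
    ... | inj₂ refl = β , P′β , lab′-new β (inj₂ refl)
    ... | inj₁ l<s with onto l l<s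
    ...   | d , pd , e with arc? d
    ...     | yes a = α , P′α , trans (lab′-old α α∉New) (trans old-α (trans (≡-sym (lab-arc d a)) e))
    ...     | no h  = d , keep d pd , trans (lab′-old d (P∉New d pd h)) (trans (old-P d pd) e)

-- Inserting an edge into a rotation system

module _ {A : Set} (_≟ᴬ_ : (x y : A) → Dec (x ≡ y)) where

  -- the cyclic order σ with n put before b
  ins : A → A → (A → A) → A → A
  ins b n σ t with t ≟ᴬ n | σ t ≟ᴬ b
  ... | yes _ | _     = b
  ... | no _  | yes _ = n
  ... | no _  | no _  = σ t

  module _ {b n : A} {σ : A → A} where

    ins-new : ins b n σ n ≡ b
    ins-new with n ≟ᴬ n | σ n ≟ᴬ b
    ... | yes _ | _ = refl
    ... | no h  | _ = ⊥-elim (h refl)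

    ins-hit : ∀ {t} → t ≢ n → σ t ≡ b → ins b n σ t ≡ n
    ins-hit {t} h e with t ≟ᴬ n | σ t ≟ᴬ b
    ... | yes e′ | _     = ⊥-elim (h e′)
    ... | no _   | yes _ = refl
    ... | no _   | no h′ = ⊥-elim (h′ e)

    ins-miss : ∀ {t} → t ≢ n → σ t ≢ b → ins b n σ t ≡ σ t
    ins-miss {t} h h′ with t ≟ᴬ n | σ t ≟ᴬ b
    ... | yes e | _     = ⊥-elim (h e)
    ... | no _  | yes e = ⊥-elim (h′ e)
    ... | no _  | no _  = refl

    -- The step into `b` is replaced by two steps through `n`. The alternative `b ≡ n` is for an
    -- isolated vertex, whose first neighbour becomes a fixed point of its rotation.
    ins-cyc : ∀ {P P′ : A → Set} → CycOn P σ → ¬ P n → P b ⊎ (b ≡ n × (∀ t → ¬ P t)) →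
      P′ n → (∀ t → P t → P′ t) → (∀ t → P′ t → P t ⊎ t ≡ n) → CycOn P′ (ins b n σ)
    ins-cyc {P} {P′} _ ¬Pn (inj₂ (refl , empty)) P′n keep cases =
      (λ t pt → subst P′ (≡-sym (trans (cong (ins n n σ) (only t pt)) ins-new)) P′n) ,
      (λ t u pt pu → 0 , trans (only t pt) (≡-sym (only u pu)))
      where
      only : ∀ t → P′ t → t ≡ n
      only t pt = [ ⊥-elim ∘ empty t , (λ e → e) ]′ (cases t pt)
    ins-cyc {P} {P′} (closed , reach) ¬Pn (inj₁ Pb) P′n keep cases = closed′ , reach′
      where
      ≢n : ∀ {t} → P t → t ≢ n
      ≢n pt refl = ¬Pn pt
      closed′ : Closed P′ (ins b n σ)
      closed′ t pt with cases t pt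
      ... | inj₂ refl = subst P′ (≡-sym ins-new) (keep b Pb)
      ... | inj₁ p = case σ t ≟ᴬ b of λ where
        (yes e) → subst P′ (≡-sym (ins-hit (≢n p) e)) P′n
        (no h)  → subst P′ (≡-sym (ins-miss (≢n p) h)) (keep _ (closed t p))
      lift : ∀ t → P t → Reach (ins b n σ) t (σ t)
      lift t p = case σ t ≟ᴬ b of λ where
        (yes e) → 2 , trans (cong (ins b n σ) (ins-hit (≢n p) e)) (trans ins-new (≡-sym e))
        (no h)  → 1 , ins-miss (≢n p) h
      old : ∀ t u → P t → P u → Reach (ins b n σ) t u
      old t u p q = reach-map (λ x → x) closed lift t u p (reach t u p q)
      b→n : Reach (ins b n σ) b n
      b→n with reach (σ b) b (closed b Pb) Pb
      ... | i , e = reach-trans (old b (iter σ i b) Pb pi)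
        (reach-step (ins-hit (≢n pi) (trans (≡-sym (iter-suc σ i b)) e)))
        where pi = iter-closed {P = P} closed i b Pb
      reach′ : ∀ t u → P′ t → P′ u → Reach (ins b n σ) t u
      reach′ t u pt pu with cases t pt | cases u pu
      ... | inj₁ p    | inj₁ q    = old t u p q
      ... | inj₁ p    | inj₂ refl = reach-trans (old t b p Pb) b→n
      ... | inj₂ refl | inj₁ q    = reach-trans (reach-step ins-new) (old b u Pb q)
      ... | inj₂ refl | inj₂ refl = reach-refl

cyc-iff : ∀ {A : Set} {P Q : A → Set} {σ : A → A} → (∀ t → P t → Q t) → (∀ t → Q t → P t) → CycOn P σ → CycOn Q σ
cyc-iff f g (c , r) = (λ t q → f _ (c t (g t q))) , λ t u p q → r t u (g t p) (g u q)

Iso : ∀ {N} → Graph N → Fin N → Set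
Iso G u = ∀ v → ¬ Adj G u v

emptyGraph : ∀ {N} → Graph N
emptyGraph = record { adj = λ _ _ → false ; sym = λ _ _ → refl ; irrefl = λ _ → refl }

is : ∀ {N} → Fin N → Fin N → Bool
is a u = ⌊ a ≟ u ⌋

is-true : ∀ {N} {a u : Fin N} → is a u ≡ true → u ≡ a
is-true {a = a} {u} e = ≡-sym (⌊⌋-true (a ≟ u) e)

is-refl : ∀ {N} (a : Fin N) → is a a ≡ true
is-refl a = ⌊⌋-intro (a ≟ a) refl

module AddEdge {N : ℕ} (G : Graph N) (a c : Fin N) (a≢c : a ≢ c) where

  edge : Fin N → Fin N → Bool
  edge u v = (is a u ∧ is c v) ∨ (is c u ∧ is a v)

  edge-elim : ∀ u v → edge u v ≡ true → (u ≡ a × v ≡ c) ⊎ (u ≡ c × v ≡ a)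
  edge-elim u v e with ∨-true {is a u ∧ is c v} e
  ... | inj₁ e′ = let p , q = ∧-true {is a u} e′ in inj₁ (is-true p , is-true q)
  ... | inj₂ e′ = let p , q = ∧-true {is c u} e′ in inj₂ (is-true p , is-true q)

  G′ : Graph N
  G′ = record
    { adj    = λ u v → adj G u v ∨ edge u v
    ; sym    = λ u v → cong₂ _∨_ (sym G u v)
        (trans (∨-comm (is a u ∧ is c v) _) (cong₂ _∨_ (∧-comm (is c u) _) (∧-comm (is a u) _)))
    ; irrefl = λ v → ¬true⇒false λ e → case ∨-true {adj G v v} e of λ where
        (inj₁ e′) → true≢false e′ (irrefl G v)
        (inj₂ e′) → [ (λ (p , q) → a≢c (trans (≡-sym p) q)) , (λ (p , q) → a≢c (trans (≡-sym q) p)) ]′ (edge-elim v v e′)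
    }

  keep : ∀ {u v} → Adj G u v → Adj G′ u v
  keep = ∨-introˡ

  newˡ : Adj G′ a c
  newˡ = ∨-introʳ {adj G a c} (∨-introˡ (∧-intro (is-refl a) (is-refl c)))

  newʳ : Adj G′ c a
  newʳ = adj-sym G′ newˡ

  cases : ∀ u v → Adj G′ u v → Adj G u v ⊎ (u ≡ a × v ≡ c) ⊎ (u ≡ c × v ≡ a)
  cases u v e = [ inj₁ , (λ e′ → inj₂ (edge-elim u v e′)) ]′ (∨-true {adj G u v} e)

  module _ (ρ : Fin N → Fin N → Fin N) (¬ac : ¬ Adj G a c) where

    #darts′ : #darts G′ ρ ≡ #darts G ρ + 2
    #darts′ = begin
      #darts G′ ρ                                                     ≡⟨ #darts-sumD G′ ρ ⟩
      sumD (λ (u , v) → ι (adj G u v ∨ edge u v))                     ≡⟨ sumD-cong pointwise ⟩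
      sumD (λ (u , v) → ι (adj G u v) + (δ (a , c) (u , v) + δ (c , a) (u , v)))
        ≡⟨ sumD-+ (λ (u , v) → ι (adj G u v)) (λ d → δ (a , c) d + δ (c , a) d) ⟩
      sumD (λ (u , v) → ι (adj G u v)) + sumD (λ d → δ (a , c) d + δ (c , a) d)
        ≡⟨ cong₂ _+_ (≡-sym (#darts-sumD G ρ)) (trans (sumD-+ (δ (a , c)) (δ (c , a))) (cong₂ _+_ (sumD-δ (a , c)) (sumD-δ (c , a)))) ⟩
      #darts G ρ + 2 ∎
      where
      open ≡-Reasoning
      pointwise : ∀ d → ι (adj G (proj₁ d) (proj₂ d) ∨ edge (proj₁ d) (proj₂ d)) ≡
        ι (adj G (proj₁ d) (proj₂ d)) + (δ (a , c) d + δ (c , a) d)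
      pointwise (u , v) with (a , c) ≟D (u , v) | (c , a) ≟D (u , v)
      ... | yes refl | yes e = ⊥-elim (a≢c (≡-sym (cong proj₁ e)))
      ... | yes refl | no _ rewrite newˡ | ¬true⇒false ¬ac = refl
      ... | no _ | yes refl rewrite newʳ | ¬true⇒false (¬ac ∘ adj-sym G) = refl
      ... | no h | no h′ = trans (cong ι old) (≡-sym (+-identityʳ _))
        where
        old : adj G u v ∨ edge u v ≡ adj G u v
        old = bool-ext (λ e → case cases u v e of λ where
            (inj₁ e′) → e′
            (inj₂ (inj₁ (refl , refl))) → ⊥-elim (h refl)
            (inj₂ (inj₂ (refl , refl))) → ⊥-elim (h′ refl))
          keep

    #isolated′ : #isolated G′ ρ + (ι (not (hasNbr G ρ a)) + ι (not (hasNbr G ρ c))) ≡ #isolated G ρ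
    #isolated′ = begin
      #isolated G′ ρ + (ι (not (hasNbr G ρ a)) + ι (not (hasNbr G ρ c)))
        ≡⟨ cong₂ _+_ (count-sum (λ v → not (hasNbr G′ ρ v))) (cong₂ _+_ (≡-sym (at a)) (≡-sym (at c))) ⟩
      sumF f + (sumF (g a) + sumF (g c))
        ≡⟨ cong (sumF f +_) (≡-sym (sumF-+ (g a) (g c))) ⟩
      sumF f + sumF (λ v → g a v + g c v)
        ≡⟨ ≡-sym (sumF-+ f (λ v → g a v + g c v)) ⟩
      sumF (λ v → f v + (g a v + g c v))
        ≡⟨ sumF-cong pointwise ⟩
      sumF (λ v → ι (not (hasNbr G ρ v)))
        ≡⟨ ≡-sym (count-sum (λ v → not (hasNbr G ρ v))) ⟩
      #isolated G ρ ∎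
      where
      open ≡-Reasoning
      f : Fin N → ℕ
      f v = ι (not (hasNbr G′ ρ v))
      g : Fin N → Fin N → ℕ
      g w v = if is w v then ι (not (hasNbr G ρ w)) else 0
      g-self : ∀ w → g w w ≡ ι (not (hasNbr G ρ w))
      g-self w rewrite is-refl w = refl
      g-≢ : ∀ {w v} → v ≢ w → g w v ≡ 0
      g-≢ {w} {v} h with is w v in eq
      ... | true  = ⊥-elim (h (is-true eq))
      ... | false = refl
      at : ∀ w → sumF (g w) ≡ ι (not (hasNbr G ρ w))
      at w = trans (sumF-point w (λ i i≢w → g-≢ i≢w)) (g-self w)
      f-0 : ∀ {v w} → Adj G′ v w → f v ≡ 0
      f-0 e = cong (ι ∘ not) (Components.hasNbr-intro G′ ρ e)
      pointwise : ∀ v → f v + (g a v + g c v) ≡ ι (not (hasNbr G ρ v))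
      pointwise v with v ≟ a | v ≟ c
      ... | yes refl | yes e = ⊥-elim (a≢c e)
      ... | yes refl | no h = trans (cong₂ _+_ (f-0 newˡ) (cong₂ _+_ (g-self a) (g-≢ h))) (+-identityʳ _)
      ... | no h | yes refl = cong₂ _+_ (f-0 newʳ) (cong₂ _+_ (g-≢ h) (g-self c))
      ... | no h | no h′ = trans (cong₂ _+_ (cong (ι ∘ not) nbr) (cong₂ _+_ (g-≢ h) (g-≢ h′))) (+-identityʳ _)
        where
        nbr : hasNbr G′ ρ v ≡ hasNbr G ρ v
        nbr = bool-ext
          (λ e → let w , ew = Components.hasNbr-elim G′ ρ {v} e in case cases v w ew of λ where
              (inj₁ e′) → Components.hasNbr-intro G ρ e′
              (inj₂ (inj₁ (e′ , _))) → ⊥-elim (h e′)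
              (inj₂ (inj₂ (e′ , _))) → ⊥-elim (h′ e′))
          (λ e → let w , ew = Components.hasNbr-elim G ρ {v} e in Components.hasNbr-intro G′ ρ (keep ew))

    -- The condition on `a` makes the new edge start in the old component, unless there are no old
    -- edges at all, as for the very first edge.
    connected′ : Components.Connected G ρ → (∀ w → hasNbr G ρ w ≡ true → hasNbr G ρ a ≡ true) → Components.Connected G′ ρ
    connected′ conn nbr P closed {u} {v} hu hv pu = fromA v hv (toA u hu pu)
      where
      closedG : Components.ClosedUnder G ρ P
      closedG x y e = closed x y (keep e)
      toA : ∀ u → hasNbr G′ ρ u ≡ true → P u ≡ true → P a ≡ true
      toA u hu pu with Components.hasNbr-elim G′ ρ {u} hu
      ... | w , e with cases u w e
      ...   | inj₁ e′ = let h = Components.hasNbr-intro G ρ e′ in conn P closedG {u} {a} h (nbr u h) pu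
      ...   | inj₂ (inj₁ (refl , _)) = pu
      ...   | inj₂ (inj₂ (refl , _)) = closed c a newʳ pu
      fromA : ∀ u → hasNbr G′ ρ u ≡ true → P a ≡ true → P u ≡ true
      fromA u hu pa with Components.hasNbr-elim G′ ρ {u} hu
      ... | w , e with cases u w e
      ...   | inj₁ e′ = let h = Components.hasNbr-intro G ρ e′ in conn P closedG {a} {u} (nbr u h) h pa
      ...   | inj₂ (inj₁ (refl , _)) = pa
      ...   | inj₂ (inj₂ (refl , _)) = closed a c newˡ pa

  module Rot (ρ : Fin N → Fin N → Fin N) (isRot : IsRotation G ρ) (¬ac : ¬ Adj G a c) (p q : Fin N) where

    open Rotation G ρ isRot using (φ; ρ-cyc; φ-closed)

    ρ′ : Fin N → Fin N → Fin N
    ρ′ u with u ≟ a | u ≟ c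
    ... | yes _ | _     = ins _≟_ p c (ρ a)
    ... | no _  | yes _ = ins _≟_ q a (ρ c)
    ... | no _  | no _  = ρ u

    ρ′-a : ∀ t → ρ′ a t ≡ ins _≟_ p c (ρ a) t
    ρ′-a t with a ≟ a | a ≟ c
    ... | yes _ | _ = refl
    ... | no h  | _ = ⊥-elim (h refl)

    ρ′-c : ∀ t → ρ′ c t ≡ ins _≟_ q a (ρ c) t
    ρ′-c t with c ≟ a | c ≟ c
    ... | yes e | _     = ⊥-elim (a≢c (≡-sym e))
    ... | no _  | yes _ = refl
    ... | no _  | no h  = ⊥-elim (h refl)

    ρ′-same : ∀ {u t} → Adj G u t → ¬ (u ≡ a × ρ u t ≡ p) → ¬ (u ≡ c × ρ u t ≡ q) → ρ′ u t ≡ ρ u t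
    ρ′-same {u} {t} e h h′ with u ≟ a
    ... | yes refl = ins-miss _≟_ {n = c} {ρ u} {t} (λ { refl → ¬ac e }) (λ x → h (refl , x))
    ... | no _ with u ≟ c
    ...   | yes refl = ins-miss _≟_ {n = a} {ρ u} {t} (λ { refl → ¬ac (adj-sym G e) }) (λ x → h′ (refl , x))
    ...   | no _     = refl

    isRot′ : Adj G a p ⊎ (p ≡ c × Iso G a) → Adj G c q ⊎ (q ≡ a × Iso G c) → IsRotation G′ ρ′
    isRot′ hp hq = (λ u → proj₁ (cyc u)) , (λ u → proj₂ (cyc u))
      where
      cyc : ∀ u → CycOn (Adj G′ u) (ρ′ u)
      cyc u with u ≟ a
      ... | yes refl = ins-cyc _≟_ (ρ-cyc a) ¬ac hp newˡ (λ t → keep) λ t e → case cases a t e of λ where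
          (inj₁ e′) → inj₁ e′
          (inj₂ (inj₁ (_ , e′))) → inj₂ e′
          (inj₂ (inj₂ (e′ , _))) → ⊥-elim (a≢c e′)
      ... | no u≢a with u ≟ c
      ...   | yes refl = ins-cyc _≟_ (ρ-cyc c) (¬ac ∘ adj-sym G) hq newʳ (λ t → keep) λ t e → case cases c t e of λ where
          (inj₁ e′) → inj₁ e′
          (inj₂ (inj₁ (e′ , _))) → ⊥-elim (a≢c (≡-sym e′))
          (inj₂ (inj₂ (_ , e′))) → inj₂ e′
      ...   | no u≢c = cyc-iff (λ t → keep) (λ t e → case cases u t e of λ where
          (inj₁ e′) → e′
          (inj₂ (inj₁ (e′ , _))) → ⊥-elim (u≢a e′)
          (inj₂ (inj₂ (e′ , _))) → ⊥-elim (u≢c e′)) (ρ-cyc u)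

    -- A face step turns at the head of the dart. Hence putting `c` before `p` at `a` and `a` before
    -- `q` at `c` diverts exactly the old steps into `(a , p)` and `(c , q)`, while the new dart
    -- towards `c` continues with `(c , q)` and the one towards `a` with `(a , p)`.
    insertion : Insertion (IsDart G) (IsDart G′) φ (faceStep G′ ρ′) (a , c) (c , a) (a , p) (c , q)
    insertion = record
      { closed = φ-closed
      ; ¬Pα    = ¬ac
      ; ¬Pβ    = ¬ac ∘ adj-sym G
      ; α≢β    = a≢c ∘ cong proj₁
      ; keep   = λ _ → keep
      ; P′α    = newˡ
      ; P′β    = newʳ
      ; cases  = λ (u , v) e → case cases u v e of λ where
          (inj₁ e′) → inj₁ e′
          (inj₂ (inj₁ (e′ , e″))) → inj₂ (inj₁ (cong₂ _,_ e′ e″))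
          (inj₂ (inj₂ (e′ , e″))) → inj₂ (inj₂ (cong₂ _,_ e′ e″))
      ; at-α   = cong (c ,_) (trans (ρ′-c a) (ins-new _≟_ {n = a} {ρ c}))
      ; at-β   = cong (a ,_) (trans (ρ′-a c) (ins-new _≟_ {n = c} {ρ a}))
      ; to-α   = to-α
      ; to-β   = to-β
      ; same   = λ (t , u) e h h′ → cong (u ,_) (ρ′-same (adj-sym G e)
          (λ (x , y) → h (cong₂ _,_ x y)) (λ (x , y) → h′ (cong₂ _,_ x y)))
      }
      where
      to-α : ∀ d → IsDart G d → φ d ≡ (a , p) → faceStep G′ ρ′ d ≡ (a , c)
      to-α (t , u) e eq with cong proj₁ eq
      ... | refl = cong (a ,_) (trans (ρ′-a t) (ins-hit _≟_ {σ = ρ u} {t} (λ { refl → ¬ac (adj-sym G e) }) (cong proj₂ eq)))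
      to-β : ∀ d → IsDart G d → φ d ≡ (c , q) → faceStep G′ ρ′ d ≡ (c , a)
      to-β (t , u) e eq with cong proj₁ eq
      ... | refl = cong (c ,_) (trans (ρ′-c t) (ins-hit _≟_ {σ = ρ u} {t} (λ { refl → ¬ac e }) (cong proj₂ eq)))

-- Connected plane graphs, built up edge by edge

record Emb (N : ℕ) : Set where
  field
    gr    : Graph N
    rot   : Fin N → Fin N → Fin N
    isRot : IsRotation gr rot
    faces : OrbitLabelling (IsDart gr) (faceStep gr rot)
    conn  : Components.Connected gr rot
    dart  : ∃ λ u → ∃ λ v → Adj gr u v
    euler : 2 * N + 2 * OrbitLabelling.size faces ≡ #darts gr rot + 4 + 2 * #isolated gr rot

open Emb

-- In `euler` faces are counted by labels and the number of components is fixed at one, so the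
-- counts of representatives in the definition of planarity do not have to be followed edge by edge.
-- They are brought in here, once.
emb⇒planar : ∀ {N} (E : Emb N) → Planar (gr E)
emb⇒planar {N} E = rot E , isRot E , (begin
  2 * N + 2 * #faces (gr E) (rot E)
    ≡⟨ cong (λ f → 2 * N + 2 * f) (#faces-labelling (gr E) (rot E) (isRot E) (faces E)) ⟩
  2 * N + 2 * OrbitLabelling.size (faces E)
    ≡⟨ euler E ⟩
  D + 4 * 1 + 2 * I
    ≡⟨ cong (λ c → D + 4 * c + 2 * I) (≡-sym (Components.#bigComps-connected (gr E) (rot E) (proj₂ (proj₂ (dart E))) (conn E))) ⟩
  D + 4 * #bigComps (gr E) (rot E) + 2 * I ∎)
  where
  open ≡-Reasoning
  D : ℕ
  D = #darts (gr E) (rot E)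
  I : ℕ
  I = #isolated (gr E) (rot E)

hasNbr-iso : ∀ {N} (G : Graph N) ρ {u} → Iso G u → hasNbr G ρ u ≡ false
hasNbr-iso G ρ {u} iso = ¬true⇒false λ e → let v , a = Components.hasNbr-elim G ρ {u} e in iso v a

iso? : ∀ {N} (G : Graph N) u → Iso G u ⊎ ∃ λ v → Adj G u v
iso? G u with anyF (adj G u) in eq
... | true  = inj₂ (anyF-true eq)
... | false = inj₁ λ v a → true≢false (anyF-intro {p = adj G u} v a) eq

opaque

  singleEdge : ∀ {N} {a c : Fin N} → a ≢ c → Σ (Emb N) λ E →
    Adj (gr E) a c × (∀ u v → Adj (gr E) u v → (u ≡ a × v ≡ c) ⊎ (u ≡ c × v ≡ a)) ×
    rot E a c ≡ c × rot E c a ≡ a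
  singleEdge {N} {a} {c} a≢c = record
    { gr    = G′
    ; rot   = ρ′
    ; isRot = isRot′ (inj₂ (refl , λ _ ())) (inj₂ (refl , λ _ ()))
    ; faces = record
      { size  = 1
      ; lab   = λ _ → 0
      ; inv   = λ _ _ → refl
      ; conn  = λ d e pd pe _ → join d e (only _ _ pd) (only _ _ pe)
      ; bound = λ _ _ → ≤-refl
      ; onto  = λ { zero _ → (a , c) , newˡ , refl ; (suc _) (s≤s ()) }
      }
    ; conn  = connected′ ρ₀ (λ ()) (λ P _ {u} h → ⊥-elim (no-nbr u h)) (λ w h → ⊥-elim (no-nbr w h))
    ; dart  = a , c , newˡ
    ; euler = eu
    } , newˡ , only , trans (ρ′-a c) (ins-new _≟_ {n = c} {ρ₀ a}) , trans (ρ′-c a) (ins-new _≟_ {n = a} {ρ₀ c})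
    where
    G₀ : Graph N
    G₀ = emptyGraph {N}
    ρ₀ : Fin N → Fin N → Fin N
    ρ₀ _ v = v
    open AddEdge G₀ a c a≢c
    -- Both ends are isolated so far, so at each of them the new neighbour is placed before itself.
    open Rot ρ₀ ((λ _ _ ()) , (λ _ _ _ ())) (λ ()) c a
    open Insertion insertion using (at-α; at-β)
    only : ∀ u v → Adj G′ u v → (u ≡ a × v ≡ c) ⊎ (u ≡ c × v ≡ a)
    only u v e = [ (λ ()) , (λ x → x) ]′ (cases u v e)
    join : ∀ (d e : Dart N) → (proj₁ d ≡ a × proj₂ d ≡ c) ⊎ (proj₁ d ≡ c × proj₂ d ≡ a) →
      (proj₁ e ≡ a × proj₂ e ≡ c) ⊎ (proj₁ e ≡ c × proj₂ e ≡ a) → Reach (faceStep G′ ρ′) d e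
    join d e (inj₁ (refl , refl)) (inj₁ (refl , refl)) = reach-refl
    join d e (inj₁ (refl , refl)) (inj₂ (refl , refl)) = reach-step at-α
    join d e (inj₂ (refl , refl)) (inj₁ (refl , refl)) = reach-step at-β
    join d e (inj₂ (refl , refl)) (inj₂ (refl , refl)) = reach-refl
    no-nbr : ∀ u → hasNbr G₀ ρ₀ u ≡ true → ⊥
    no-nbr u h = true≢false h (hasNbr-iso G₀ ρ₀ {u} λ _ ())
    eu : 2 * N + 2 * 1 ≡ #darts G′ ρ′ + 4 + 2 * #isolated G′ ρ′
    eu = begin
      2 * N + 2 * 1                                      ≡⟨ cong (λ m → 2 * m + 2) (≡-sym isoN) ⟩
      2 * (#isolated G′ ρ′ + 2) + 2                      ≡⟨ l₁ (#isolated G′ ρ′) ⟩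
      0 + 2 + 4 + 2 * #isolated G′ ρ′                    ≡⟨ cong (λ m → m + 2 + 4 + 2 * #isolated G′ ρ′) (≡-sym darts₀) ⟩
      #darts G₀ ρ₀ + 2 + 4 + 2 * #isolated G′ ρ′         ≡⟨ cong (λ m → m + 4 + 2 * #isolated G′ ρ′) (≡-sym (#darts′ ρ₀ λ ())) ⟩
      #darts G′ ρ₀ + 4 + 2 * #isolated G′ ρ′             ∎
      where
      open ≡-Reasoning
      l₁ : ∀ i → 2 * (i + 2) + 2 ≡ 0 + 2 + 4 + 2 * i
      l₁ = solve-∀
      darts₀ : #darts G₀ ρ₀ ≡ 0
      darts₀ = trans (#darts-sumD G₀ ρ₀) (sumD-0 {N} λ _ → refl)
      isoN : #isolated G′ ρ′ + 2 ≡ N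
      isoN = trans
        (cong (#isolated G′ ρ′ +_) (≡-sym (cong₂ (λ x y → ι (not x) + ι (not y)) (hasNbr-iso G₀ ρ₀ {a} λ _ ()) (hasNbr-iso G₀ ρ₀ {c} λ _ ()))))
        (trans (#isolated′ ρ₀ λ ()) (trans (count-sum (λ v → not (hasNbr G₀ ρ₀ v)))
          (trans (sumF-cong {N} λ v → cong (ι ∘ not) (hasNbr-iso G₀ ρ₀ {v} λ _ ())) (trans (sumF-const N 1) (*-identityʳ N)))))

-- E′ is E with the new vertex x hung on w, right after b
record Pendant {N} (E : Emb N) (w b x : Fin N) (E′ : Emb N) : Set where
  field
    keep  : ∀ {u v} → Adj (gr E) u v → Adj (gr E′) u v
    new   : Adj (gr E′) w x
    cases : ∀ u v → Adj (gr E′) u v → Adj (gr E) u v ⊎ (u ≡ w × v ≡ x) ⊎ (u ≡ x × v ≡ w)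
    rot-b : rot E′ w b ≡ x
    rot-x : rot E′ w x ≡ rot E w b
    rot-w : rot E′ x w ≡ w
    same  : ∀ {u t} → Adj (gr E) u t → ¬ (u ≡ w × t ≡ b) → rot E′ u t ≡ rot E u t

opaque

  -- At the isolated `x` the reference neighbour can only be `w`, so `dc` is the new dart `(x , w)`
  -- and `extend-labelling` applies. In `euler` two more darts balance one isolated vertex less.
  pendant : ∀ {N} (E : Emb N) {w b x} → Adj (gr E) w b → Iso (gr E) x → ∃ (Pendant E w b x)
  pendant {N} E {w} {b} {x} wb iso = record
    { gr    = G′
    ; rot   = ρ′
    ; isRot = isRot′ (inj₁ wp) (inj₂ (refl , iso))
    ; faces = proj₁ L
    ; conn  = connected′ (rot E) ¬wx (conn E) (λ _ _ → nbr-w)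
    ; dart  = w , x , newˡ
    ; euler = eu
    } , record
    { keep  = keep
    ; new   = newˡ
    ; cases = cases
    ; rot-b = trans (ρ′-a b) (ins-hit _≟_ {n = x} {rot E w} {b} (λ { refl → ¬wx wb }) refl)
    ; rot-x = trans (ρ′-a x) (ins-new _≟_ {n = x} {rot E w})
    ; rot-w = trans (ρ′-c w) (ins-new _≟_ {n = w} {rot E x})
    ; same  = λ {u} {t} e h → ρ′-same e
        (λ { (refl , eq) → h (refl , Rotation.ρ-inj (gr E) (rot E) (isRot E) w t b e wb eq) })
        (λ { (refl , _) → iso t e })
    }
    where
    w≢x : w ≢ x
    w≢x refl = iso b wb
    ¬wx : ¬ Adj (gr E) w x
    ¬wx e = iso w (adj-sym (gr E) e)
    wp : Adj (gr E) w (rot E w b)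
    wp = proj₁ (isRot E) w b wb
    open AddEdge (gr E) w x w≢x
    open Rot (rot E) (isRot E) ¬wx (rot E w b) w
    L : Σ (OrbitLabelling (IsDart G′) (faceStep G′ ρ′)) λ L′ → OrbitLabelling.size L′ ≡ OrbitLabelling.size (faces E)
    L = extend-labelling _≟D_ insertion (faces E) wp refl
    nbr-w : hasNbr (gr E) (rot E) w ≡ true
    nbr-w = Components.hasNbr-intro (gr E) (rot E) wb
    eu : 2 * N + 2 * OrbitLabelling.size (proj₁ L) ≡ #darts G′ ρ′ + 4 + 2 * #isolated G′ ρ′
    eu = begin
      2 * N + 2 * OrbitLabelling.size (proj₁ L)                   ≡⟨ cong (λ f → 2 * N + 2 * f) (proj₂ L) ⟩
      2 * N + 2 * OrbitLabelling.size (faces E)                   ≡⟨ euler E ⟩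
      #darts (gr E) (rot E) + 4 + 2 * #isolated (gr E) (rot E)    ≡⟨ cong (λ i → D + 4 + 2 * i) isoN ⟩
      D + 4 + 2 * (#isolated G′ ρ′ + 1)                           ≡⟨ l₁ D (#isolated G′ ρ′) ⟩
      D + 2 + 4 + 2 * #isolated G′ ρ′                             ≡⟨ cong (λ m → m + 4 + 2 * #isolated G′ ρ′) (≡-sym (#darts′ (rot E) ¬wx)) ⟩
      #darts G′ ρ′ + 4 + 2 * #isolated G′ ρ′                      ∎
      where
      open ≡-Reasoning
      D : ℕ
      D = #darts (gr E) (rot E)
      l₁ : ∀ d i → d + 4 + 2 * (i + 1) ≡ d + 2 + 4 + 2 * i
      l₁ = solve-∀
      isoN : #isolated (gr E) (rot E) ≡ #isolated G′ ρ′ + 1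
      isoN = trans (≡-sym (#isolated′ (rot E) ¬wx)) (cong (#isolated G′ ρ′ +_)
        (cong₂ (λ x y → ι (not x) + ι (not y)) nbr-w (hasNbr-iso (gr E) (rot E) iso)))

-- E′ is E with the edge ac, put before p at a and before q at c
record Chord {N} (E : Emb N) (a p c q : Fin N) (E′ : Emb N) : Set where
  field
    keep  : ∀ {u v} → Adj (gr E) u v → Adj (gr E′) u v
    new   : Adj (gr E′) a c
    cases : ∀ u v → Adj (gr E′) u v → Adj (gr E) u v ⊎ (u ≡ a × v ≡ c) ⊎ (u ≡ c × v ≡ a)
    rot-a : rot E′ a c ≡ p
    rot-c : rot E′ c a ≡ q
    to-c  : ∀ {t} → Adj (gr E) a t → rot E a t ≡ p → rot E′ a t ≡ c
    to-a  : ∀ {t} → Adj (gr E) c t → rot E c t ≡ q → rot E′ c t ≡ a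
    same  : ∀ {u t} → Adj (gr E) u t → ¬ (u ≡ a × rot E u t ≡ p) → ¬ (u ≡ c × rot E u t ≡ q) → rot E′ u t ≡ rot E u t

opaque

  -- By `path` the two places where the edge is inserted lie on one face, which the edge splits; in
  -- `euler` one more face balances two more darts. `simple` keeps the walk between the two places
  -- away from `a`, as `split-labelling` requires of its arc.
  chord : ∀ {N} (E : Emb N) {a p c q} → Adj (gr E) a p → a ≢ c → ¬ Adj (gr E) a c → ∀ k →
    iter (faceStep (gr E) (rot E)) (suc k) (a , p) ≡ (c , q) →
    (∀ i → i < suc k → proj₁ (iter (faceStep (gr E) (rot E)) (suc i) (a , p)) ≢ a) →
    ∃ (Chord E a p c q)
  chord {N} E {a} {p} {c} {q} ap a≢c ¬ac k path simple = record
    { gr    = G′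
    ; rot   = ρ′
    ; isRot = isRot′ (inj₁ ap) (inj₁ cq)
    ; faces = proj₁ L
    ; conn  = connected′ (rot E) ¬ac (conn E) (λ _ _ → nbr-a)
    ; dart  = a , c , newˡ
    ; euler = eu
    } , record
    { keep  = keep
    ; new   = newˡ
    ; cases = cases
    ; rot-a = trans (ρ′-a c) (ins-new _≟_ {n = c} {rot E a})
    ; rot-c = trans (ρ′-c a) (ins-new _≟_ {n = a} {rot E c})
    ; to-c  = λ {t} e eq → trans (ρ′-a t) (ins-hit _≟_ {n = c} {rot E a} {t} (λ { refl → ¬ac e }) eq)
    ; to-a  = λ {t} e eq → trans (ρ′-c t) (ins-hit _≟_ {n = a} {rot E c} {t} (λ { refl → ¬ac (adj-sym (gr E) e) }) eq)
    ; same  = ρ′-same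
    }
    where
    cq : Adj (gr E) c q
    cq = subst (IsDart (gr E)) path (Rotation.iter-dart (gr E) (rot E) (isRot E) (suc k) (a , p) ap)
    open AddEdge (gr E) a c a≢c
    open Rot (rot E) (isRot E) ¬ac p q
    L : Σ (OrbitLabelling (IsDart G′) (faceStep G′ ρ′)) λ L′ → OrbitLabelling.size L′ ≡ suc (OrbitLabelling.size (faces E))
    L = split-labelling _≟D_ insertion (faces E) ap (Rotation.φ-inj (gr E) (rot E) (isRot E)) k (≡-sym path)
          (λ i i< e → simple i i< (cong proj₁ e))
    nbr-a : hasNbr (gr E) (rot E) a ≡ true
    nbr-a = Components.hasNbr-intro (gr E) (rot E) ap
    nbr-c : hasNbr (gr E) (rot E) c ≡ true
    nbr-c = Components.hasNbr-intro (gr E) (rot E) cq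
    eu : 2 * N + 2 * OrbitLabelling.size (proj₁ L) ≡ #darts G′ ρ′ + 4 + 2 * #isolated G′ ρ′
    eu = begin
      2 * N + 2 * OrbitLabelling.size (proj₁ L)                     ≡⟨ cong (λ f → 2 * N + 2 * f) (proj₂ L) ⟩
      2 * N + 2 * suc (OrbitLabelling.size (faces E))               ≡⟨ l₀ N (OrbitLabelling.size (faces E)) ⟩
      2 * N + 2 * OrbitLabelling.size (faces E) + 2                 ≡⟨ cong (_+ 2) (euler E) ⟩
      D + 4 + 2 * #isolated (gr E) (rot E) + 2                      ≡⟨ cong (λ i → D + 4 + 2 * i + 2) isoN ⟩
      D + 4 + 2 * (#isolated G′ ρ′ + 0) + 2                         ≡⟨ l₁ D (#isolated G′ ρ′) ⟩
      D + 2 + 4 + 2 * #isolated G′ ρ′                               ≡⟨ cong (λ m → m + 4 + 2 * #isolated G′ ρ′) (≡-sym (#darts′ (rot E) ¬ac)) ⟩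
      #darts G′ ρ′ + 4 + 2 * #isolated G′ ρ′                        ∎
      where
      open ≡-Reasoning
      D : ℕ
      D = #darts (gr E) (rot E)
      l₀ : ∀ n f → 2 * n + 2 * suc f ≡ 2 * n + 2 * f + 2
      l₀ = solve-∀
      l₁ : ∀ d i → d + 4 + 2 * (i + 0) + 2 ≡ d + 2 + 4 + 2 * i
      l₁ = solve-∀
      isoN : #isolated (gr E) (rot E) ≡ #isolated G′ ρ′ + 0
      isoN = trans (≡-sym (#isolated′ (rot E) ¬ac)) (cong (#isolated G′ ρ′ +_)
        (cong₂ (λ x y → ι (not x) + ι (not y)) nbr-a nbr-c))

-- v, b, w are consecutive on a face
Corner : ∀ {N} → Emb N → Fin N → Fin N → Fin N → Set
Corner E v b w = Adj (gr E) b v × rot E b v ≡ w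

-- E′ is E with a new vertex x, joined to v and w, in the face at the corner v, b, w.
record Cut {N} (E : Emb N) (v b w x : Fin N) (E′ : Emb N) : Set where
  field
    keep    : ∀ {u t} → Adj (gr E) u t → Adj (gr E′) u t
    new-v   : Adj (gr E′) x v
    new-w   : Adj (gr E′) x w
    cases   : ∀ u t → Adj (gr E′) u t → Adj (gr E) u t ⊎ (u ≡ x × (t ≡ v ⊎ t ≡ w)) ⊎ (t ≡ x × (u ≡ v ⊎ u ≡ w))
    rot-v   : rot E′ v x ≡ b
    to-x    : ∀ {t} → Adj (gr E) v t → rot E v t ≡ b → rot E′ v t ≡ x
    persist : ∀ {v₀ b₀ w₀} → Corner E v₀ b₀ w₀ → ¬ (b₀ ≡ w × v₀ ≡ b) → ¬ (b₀ ≡ v × w₀ ≡ b) → Corner E′ v₀ b₀ w₀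

opaque

  -- The vertex is hung on `w` right after `b` and then joined to `v`, three face steps after the
  -- dart from `v` to `b`. It occupies the angle after `b` at `w` and the angle before `b` at `v`;
  -- these are the two corners that `persist` excludes. The corner `v`, `b`, `w` itself survives, so
  -- it can receive any number of vertices.
  cut : ∀ {N} (E : Emb N) {v b w x} → Corner E v b w → v ≢ w → Iso (gr E) x → ∃ (Cut E v b w x)
  cut {N} E {v} {b} {w} {x} (bv , rot-bv) v≢w iso = E₂ , record
    { keep    = C.keep ∘ P.keep
    ; new-v   = adj-sym (gr E₂) C.new
    ; new-w   = C.keep (adj-sym (gr E₁) P.new)
    ; cases   = λ u t e → case C.cases u t e of λ where
        (inj₂ (inj₁ (p , q))) → inj₂ (inj₂ (q , inj₁ p))
        (inj₂ (inj₂ (p , q))) → inj₂ (inj₁ (p , inj₁ q))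
        (inj₁ e′) → case P.cases u t e′ of λ where
          (inj₁ e″) → inj₁ e″
          (inj₂ (inj₁ (p , q))) → inj₂ (inj₂ (q , inj₂ p))
          (inj₂ (inj₂ (p , q))) → inj₂ (inj₁ (p , inj₂ q))
    ; rot-v   = C.rot-a
    ; to-x    = λ e eq → C.to-c (P.keep e) (trans (P.same e (v≢w ∘ proj₁)) eq)
    ; persist = λ { {v₀} {b₀} (e , refl) h h′ → let eq = P.same e h in C.keep (P.keep e) ,
        trans (C.same (P.keep e) (λ (p , q) → h′ (p , trans (≡-sym eq) q)) (λ { (refl , _) → iso v₀ e })) eq }
    }
    where
    bw : Adj (gr E) b w
    bw = subst (Adj (gr E) b) rot-bv (proj₁ (isRot E) b v bv)
    step₁ : ∃ (Pendant E w b x)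
    step₁ = pendant E (adj-sym (gr E) bw) iso
    E₁ : Emb N
    E₁ = proj₁ step₁
    module P = Pendant (proj₂ step₁)
    x≢v : x ≢ v
    x≢v refl = iso b (adj-sym (gr E) bv)
    ¬vx : ¬ Adj (gr E₁) v x
    ¬vx e = case P.cases v x e of λ where
      (inj₁ e′) → iso v (adj-sym (gr E) e′)
      (inj₂ (inj₁ (p , _))) → v≢w p
      (inj₂ (inj₂ (p , _))) → x≢v (≡-sym p)
    φ₁ : Dart N → Dart N
    φ₁ = faceStep (gr E₁) (rot E₁)
    f₁ : φ₁ (v , b) ≡ (b , w)
    f₁ = cong (b ,_) (trans (P.same bv (adj-≢ (gr E) bw ∘ proj₁)) rot-bv)
    f₂ : iter φ₁ 2 (v , b) ≡ (w , x)
    f₂ = trans (cong φ₁ f₁) (cong (w ,_) P.rot-b)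
    f₃ : iter φ₁ 3 (v , b) ≡ (x , w)
    f₃ = trans (cong φ₁ f₂) (cong (x ,_) P.rot-w)
    simple : ∀ i → i < 3 → proj₁ (iter φ₁ (suc i) (v , b)) ≢ v
    simple 0 _ e = adj-≢ (gr E) bv (trans (≡-sym (cong proj₁ f₁)) e)
    simple 1 _ e = v≢w (≡-sym (trans (≡-sym (cong proj₁ f₂)) e))
    simple 2 _ e = x≢v (trans (≡-sym (cong proj₁ f₃)) e)
    simple (suc (suc (suc _))) (s≤s (s≤s (s≤s ())))
    step₂ : ∃ (Chord E₁ v b x w)
    step₂ = chord E₁ {v} {b} {x} {w} (P.keep (adj-sym (gr E) bv)) (x≢v ∘ ≡-sym) ¬vx 2 f₃ simple
    E₂ : Emb N
    E₂ = proj₁ step₂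
    module C = Chord (proj₂ step₂)

-- Pairing up indices

pr : ∀ {n} → Bool → Fin ⌊ n /2⌋ → Fin n
pr {suc (suc n)} a zero    = if a then suc zero else zero
pr {suc (suc n)} a (suc r) = suc (suc (pr a r))

pr-next : ∀ {n} (r : Fin ⌊ n /2⌋) → toℕ (pr {n} true r) ≡ suc (toℕ (pr {n} false r))
pr-next {suc (suc n)} zero    = refl
pr-next {suc (suc n)} (suc r) = cong (λ k → 2 + k) (pr-next r)

pr-inj : ∀ {n} a b {r s : Fin ⌊ n /2⌋} → pr {n} a r ≡ pr b s → r ≡ s
pr-inj {suc (suc n)} a     b     {zero}  {zero}  e = refl
pr-inj {suc (suc n)} a     b     {suc r} {suc s} e = cong suc (pr-inj a b (F.suc-injective (F.suc-injective e)))
pr-inj {suc (suc n)} false b     {zero}  {suc s} ()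
pr-inj {suc (suc n)} true  b     {zero}  {suc s} ()
pr-inj {suc (suc n)} a     false {suc r} {zero}  ()
pr-inj {suc (suc n)} a     true  {suc r} {zero}  ()

-- The second alternative arises for odd `n` only; for even `n` the last index is returned with its
-- pair.
paired : ∀ {n} (j : Fin n) → (∃ λ r → ∃ λ a → j ≡ pr {n} a r) ⊎ suc (toℕ j) ≡ n
paired {suc zero}    zero          = inj₂ refl
paired {suc (suc n)} zero          = inj₁ (zero , false , refl)
paired {suc (suc n)} (suc zero)    = inj₁ (zero , true , refl)
paired {suc (suc n)} (suc (suc j)) with paired j
... | inj₁ (r , a , e) = inj₁ (suc r , a , cong (λ i → Fin.suc (Fin.suc i)) e)
... | inj₂ e           = inj₂ (cong (λ k → 2 + k) e)

-- The classes around the hexagon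

nxt : Fin 6 → Fin 6
nxt 0F = 1F
nxt 1F = 2F
nxt 2F = 3F
nxt 3F = 4F
nxt 4F = 5F
nxt 5F = 0F

prv : Fin 6 → Fin 6
prv 0F = 5F
prv 1F = 0F
prv 2F = 1F
prv 3F = 2F
prv 4F = 3F
prv 5F = 4F

prv-nxt : ∀ k → prv (nxt k) ≡ k
prv-nxt = toWitness {a? = all? λ k → prv (nxt k) ≟ k} tt

link-nxt : ∀ k → link k (nxt k) ≡ true
link-nxt = toWitness {a? = all? λ k → link k (nxt k) B.≟ true} tt

link-prv : ∀ k → link k (prv k) ≡ true
link-prv = toWitness {a? = all? λ k → link k (prv k) B.≟ true} tt

link-cases : ∀ k l → link k l ≡ true → l ≡ nxt k ⊎ k ≡ nxt l
link-cases = toWitness {a? = all? λ k → all? λ l → (link k l B.≟ true) →-dec ((l ≟ nxt k) ⊎-dec (k ≟ nxt l))} tt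

link-suc : ∀ k l → toℕ l ≡ suc (toℕ k) → link l k ≡ true
link-suc = toWitness {a? = all? λ k → all? λ l → (toℕ l ℕ.≟ suc (toℕ k)) →-dec (link l k B.≟ true)} tt

nxt-suc : ∀ k → k ≢ 5F → toℕ (nxt k) ≡ suc (toℕ k)
nxt-suc = toWitness {a? = all? λ k → ¬? (k ≟ 5F) →-dec (toℕ (nxt k) ℕ.≟ suc (toℕ k))} tt

-- The corner reserved between the two paired vertices of class k has its middle in class `apex k`.
-- The pairs of classes 0 and 1 span the first 4-cycle. Its side with middle in class 0 takes the
-- later pairs; the side with middle in class 1 is kept for vertices attached to the pair of class
-- 0, which explains the exceptional value.
apex : Fin 6 → Fin 6
apex 0F = 1F
apex k  = prv k

apex-suc : ∀ k l → toℕ l ≡ suc (toℕ k) → apex l ≡ k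
apex-suc = toWitness {a? = all? λ k → all? λ l → (toℕ l ℕ.≟ suc (toℕ k)) →-dec (apex l ≟ k)} tt

-- true at k when, in the extra layer, the last vertex of class k sees all of the class nxt k
-- (and false when it sees all of the class prv k); it is chosen so that no such star ends in class 0.
ascending : Fin 6 → Bool
ascending 1F = true
ascending 2F = true
ascending 4F = true
ascending _  = false

_⊑_ : ∀ {N} → Emb N → Emb N → Set
E ⊑ F = ∀ {u v} → Adj (gr E) u v → Adj (gr F) u v

-- Goals are reached one at a time: `I` is what each step may rely on, and monotonicity preserves
-- the goals reached before.
saturate : ∀ {N M} (I : Emb N → Set) (Q : Fin M → Emb N → Set) →
  (∀ x {E F} → E ⊑ F → Q x E → Q x F) →
  (∀ x E → I E → Σ (Emb N) λ F → I F × E ⊑ F × Q x F) →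
  ∀ E → I E → Σ (Emb N) λ F → I F × (∀ x → Q x F)
saturate {M = zero}  I Q mono step E h = E , h , λ ()
saturate {M = suc M} I Q mono step E h with saturate I (Q ∘ suc) (mono ∘ suc) (step ∘ suc) E h
... | E₁ , h₁ , q₁ with step zero E₁ h₁
...   | E₂ , h₂ , ⊑₂ , q₀ = E₂ , h₂ , λ { zero → q₀ ; (suc x) → mono (suc x) (λ {u} {v} → ⊑₂ {u} {v}) (q₁ x) }

-- The layer of one pair

module Construction (m : ℕ) where

  open Hexagon (suc m)

  last : Fin (suc m)
  last = fromℕ m

  toℕ-last : toℕ last ≡ m
  toℕ-last = toℕ-fromℕ m

  vtx-inj : ∀ {k l j i} → vtx k j ≡ vtx l i → k ≡ l × j ≡ i
  vtx-inj {k} {l} {j} {i} e =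
    trans (≡-sym (pt-vtx k j)) (trans (cong pt e) (pt-vtx l i)) ,
    trans (≡-sym (ix-vtx k j)) (trans (cong ix e) (ix-vtx l i))

  linked : ∀ {k l j i} → link k l ≡ true → Adj H (vtx k j) (vtx l i)
  linked {k} {l} {j} {i} e = trans (adj-vtx k j l i) e

  cut-sub : ∀ {E E′ v b w x} → Cut E v b w x E′ → gr E ⊆G H → Adj H x v → Adj H x w → gr E′ ⊆G H
  cut-sub C sub xv xw u t e = case Cut.cases C u t e of λ where
    (inj₁ e′) → sub u t e′
    (inj₂ (inj₁ (refl , inj₁ refl))) → xv
    (inj₂ (inj₁ (refl , inj₂ refl))) → xw
    (inj₂ (inj₂ (refl , inj₁ refl))) → adj-sym H xv
    (inj₂ (inj₂ (refl , inj₂ refl))) → adj-sym H xw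

  module Layer (r : Fin ⌊ suc m /2⌋) where

    sp : Bool → Fin 6 → V
    sp a k = vtx k (pr a r)

    s t : Fin 6 → V
    s = sp false
    t = sp true

    s≢t : ∀ k l → s k ≢ t l
    s≢t k l e = 1+n≢n (trans (≡-sym (pr-next r)) (cong toℕ (≡-sym (proj₂ (vtx-inj e)))))

    Special : Fin (suc m) → Set
    Special j = ∃ λ a → j ≡ pr a r

    special-sp : ∀ a k → Special (ix (sp a k))
    special-sp a k = a , ix-vtx k (pr a r)

    -- The paired vertices up to class `i`. `supp` keeps those of later classes isolated, and the
    -- reserved corners are all that is remembered of the rotation.
    record Core (i : Fin 6) (E : Emb N) : Set where
      field
        sub     : gr E ⊆G H
        supp    : ∀ u v → Adj (gr E) u v → toℕ (pt u) ≤ toℕ i × Special (ix u)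
        corners : ∀ k → toℕ k ≤ toℕ i → Corner E (s k) (s (apex k)) (t k)
        edges   : ∀ k l → toℕ l ≡ suc (toℕ k) → toℕ l ≤ toℕ i → ∀ a b → Adj (gr E) (sp b l) (sp a k)

    -- Both new vertices go to the corner of class `i`, which survives the first cut. At `s i` the
    -- second one then comes directly after the first, and this is the corner reserved for the new
    -- class.
    core-step : ∀ {E} i i′ → toℕ i′ ≡ suc (toℕ i) → Core i E → ∃ (Core i′)
    core-step {E} i i′ i′≡ core = E₂ , record
      { sub     = cut-sub C₂ (cut-sub C₁ sub (linked li) (linked li)) (linked li) (linked li)
      ; supp    = supp′
      ; corners = corners′
      ; edges   = edges′
      }
      where
      open Core core
      li : link i′ i ≡ true
      li = link-suc i i′ i′≡
      i<i′ : toℕ i < toℕ i′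
      i<i′ = ≤-reflexive (≡-sym i′≡)
      i≢i′ : i ≢ i′
      i≢i′ refl = <-irrefl refl i<i′
      far : ∀ a u → ¬ Adj (gr E) (sp a i′) u
      far a u e = <⇒≱ i<i′ (subst (λ k → toℕ k ≤ toℕ i) (pt-vtx i′ (pr a r)) (proj₁ (supp _ u e)))
      s₁ = cut E (corners i ≤-refl) (s≢t i i) (far false)
      E₁ = proj₁ s₁
      C₁ = proj₂ s₁
      module C₁ = Cut C₁
      free : Iso (gr E₁) (t i′)
      free u e = case C₁.cases (t i′) u e of λ where
        (inj₁ e′) → far true u e′
        (inj₂ (inj₁ (e′ , _))) → s≢t i′ i′ (≡-sym e′)
        (inj₂ (inj₂ (_ , inj₁ e′))) → i≢i′ (≡-sym (proj₁ (vtx-inj e′)))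
        (inj₂ (inj₂ (_ , inj₂ e′))) → i≢i′ (≡-sym (proj₁ (vtx-inj e′)))
      persist₁ : ∀ k → toℕ k ≤ toℕ i → Corner E₁ (s k) (s (apex k)) (t k)
      persist₁ k le = C₁.persist (corners k le) (λ (e , _) → s≢t (apex k) i e) (λ (_ , e) → s≢t (apex i) k (≡-sym e))
      s₂ = cut E₁ (persist₁ i ≤-refl) (s≢t i i) free
      E₂ = proj₁ s₂
      C₂ = proj₂ s₂
      module C₂ = Cut C₂
      keep₂ : ∀ {u v} → Adj (gr E) u v → Adj (gr E₂) u v
      keep₂ = C₂.keep ∘ C₁.keep
      Supp′ : V → Set
      Supp′ u = toℕ (pt u) ≤ toℕ i′ × Special (ix u)
      sp-supp : ∀ a k → toℕ k ≤ toℕ i′ → Supp′ (sp a k)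
      sp-supp a k le = subst (λ l → toℕ l ≤ toℕ i′) (≡-sym (pt-vtx k (pr a r))) le , special-sp a k
      supp′ : ∀ u v → Adj (gr E₂) u v → Supp′ u
      supp′ u v e with C₂.cases u v e
      ... | inj₂ (inj₁ (refl , _)) = sp-supp true i′ ≤-refl
      ... | inj₂ (inj₂ (_ , inj₁ refl)) = sp-supp false i (<⇒≤ i<i′)
      ... | inj₂ (inj₂ (_ , inj₂ refl)) = sp-supp true i (<⇒≤ i<i′)
      ... | inj₁ e₁ with C₁.cases u v e₁
      ...   | inj₂ (inj₁ (refl , _)) = sp-supp false i′ ≤-refl
      ...   | inj₂ (inj₂ (_ , inj₁ refl)) = sp-supp false i (<⇒≤ i<i′)
      ...   | inj₂ (inj₂ (_ , inj₂ refl)) = sp-supp true i (<⇒≤ i<i′)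
      ...   | inj₁ e₀ = let p , q = supp u v e₀ in ≤-trans p (<⇒≤ i<i′) , q
      below : ∀ k → toℕ k ≤ toℕ i′ → toℕ k ≤ toℕ i ⊎ k ≡ i′
      below k le with m≤n⇒m<n∨m≡n le
      ... | inj₁ lt = inj₁ (≤-pred (≤-trans lt (≤-reflexive i′≡)))
      ... | inj₂ e  = inj₂ (toℕ-injective e)
      corners′ : ∀ k → toℕ k ≤ toℕ i′ → Corner E₂ (s k) (s (apex k)) (t k)
      corners′ k le with below k le
      ... | inj₁ le′ = C₂.persist (persist₁ k le′) (λ (e , _) → s≢t (apex k) i e) (λ (_ , e) → s≢t (apex i) k (≡-sym e))
      ... | inj₂ refl = subst (λ l → Corner E₂ (s i′) (s l) (t i′)) (≡-sym (apex-suc i i′ i′≡))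
        (C₂.keep ss , C₂.to-x ss C₁.rot-v)
        where
        ss : Adj (gr E₁) (s i) (s i′)
        ss = adj-sym (gr E₁) C₁.new-v
      edges′ : ∀ k l → toℕ l ≡ suc (toℕ k) → toℕ l ≤ toℕ i′ → ∀ a b → Adj (gr E₂) (sp b l) (sp a k)
      edges′ k l l≡ le a b with below l le
      ... | inj₁ le′ = keep₂ (edges k l l≡ le′ a b)
      ... | inj₂ refl with toℕ-injective {i = k} {i} (suc-injective (trans (≡-sym l≡) i′≡))
      ...   | refl = new a b
        where
        new : ∀ a b → Adj (gr E₂) (sp b i′) (sp a i)
        new false false = C₂.keep C₁.new-v
        new true  false = C₂.keep C₁.new-w
        new false true  = C₂.new-v
        new true  true  = C₂.new-w

    -- The path `s 0F`, `s 1F`, `t 0F` is closed to a 4-cycle by `t 1F`, and each of the two sides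
    -- of the cycle supplies one corner.
    core₁ : ∃ (Core 1F)
    core₁ = E₃ , record
      { sub     = sub₃
      ; supp    = supp₃
      ; corners = corners₃
      ; edges   = edges₃
      }
      where
      pt≢ : ∀ {a b k l} → k ≢ l → sp a k ≢ sp b l
      pt≢ h e = h (proj₁ (vtx-inj e))
      s₁ = singleEdge (pt≢ {false} {false} {0F} {1F} λ ())
      E₁ = proj₁ s₁
      e₀₁ : Adj (gr E₁) (s 0F) (s 1F)
      e₀₁ = proj₁ (proj₂ s₁)
      only₁ = proj₁ (proj₂ (proj₂ s₁))
      rot-s₀ : rot E₁ (s 0F) (s 1F) ≡ s 1F
      rot-s₀ = proj₁ (proj₂ (proj₂ (proj₂ s₁)))
      s₂ = pendant E₁ {s 1F} {s 0F} {t 0F} (adj-sym (gr E₁) e₀₁) λ v e → case only₁ (t 0F) v e of λ where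
        (inj₁ (e′ , _)) → s≢t 0F 0F (≡-sym e′)
        (inj₂ (e′ , _)) → s≢t 1F 0F (≡-sym e′)
      E₂ = proj₁ s₂
      module P = Pendant (proj₂ s₂)
      K₀ : Corner E₂ (s 0F) (s 1F) (t 0F)
      K₀ = P.keep (adj-sym (gr E₁) e₀₁) , P.rot-b
      free : Iso (gr E₂) (t 1F)
      free v e = case P.cases (t 1F) v e of λ where
        (inj₁ e′) → case only₁ (t 1F) v e′ of λ where
          (inj₁ (e″ , _)) → s≢t 0F 1F (≡-sym e″)
          (inj₂ (e″ , _)) → s≢t 1F 1F (≡-sym e″)
        (inj₂ (inj₁ (e′ , _))) → s≢t 1F 1F (≡-sym e′)
        (inj₂ (inj₂ (e′ , _))) → pt≢ {true} {true} (λ ()) e′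
      s₃ = cut E₂ {x = t 1F} K₀ (s≢t 0F 0F) free
      E₃ = proj₁ s₃
      C₃ = proj₂ s₃
      module C = Cut C₃
      sub₁ : gr E₁ ⊆G H
      sub₁ u v e = case only₁ u v e of λ where
        (inj₁ (refl , refl)) → linked {0F} {1F} refl
        (inj₂ (refl , refl)) → linked {1F} {0F} refl
      sub₂ : gr E₂ ⊆G H
      sub₂ u v e = case P.cases u v e of λ where
        (inj₁ e′) → sub₁ u v e′
        (inj₂ (inj₁ (refl , refl))) → linked {1F} {0F} refl
        (inj₂ (inj₂ (refl , refl))) → linked {0F} {1F} refl
      sub₃ : gr E₃ ⊆G H
      sub₃ = cut-sub C₃ sub₂ (linked {1F} {0F} refl) (linked {1F} {0F} refl)
      Supp : V → Set
      Supp u = toℕ (pt u) ≤ 1 × Special (ix u)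
      sp-supp : ∀ a k → toℕ k ≤ 1 → Supp (sp a k)
      sp-supp a k le = subst (λ l → toℕ l ≤ 1) (≡-sym (pt-vtx k (pr a r))) le , special-sp a k
      supp₃ : ∀ u v → Adj (gr E₃) u v → Supp u
      supp₃ u v e with C.cases u v e
      ... | inj₂ (inj₁ (refl , _)) = sp-supp true 1F ≤-refl
      ... | inj₂ (inj₂ (_ , inj₁ refl)) = sp-supp false 0F z≤n
      ... | inj₂ (inj₂ (_ , inj₂ refl)) = sp-supp true 0F z≤n
      ... | inj₁ e₂ with P.cases u v e₂
      ...   | inj₂ (inj₁ (refl , _)) = sp-supp false 1F ≤-refl
      ...   | inj₂ (inj₂ (refl , _)) = sp-supp true 0F z≤n
      ...   | inj₁ e₁ with only₁ u v e₁
      ...     | inj₁ (refl , _) = sp-supp false 0F z≤n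
      ...     | inj₂ (refl , _) = sp-supp false 1F ≤-refl
      corners₃ : ∀ k → toℕ k ≤ 1 → Corner E₃ (s k) (s (apex k)) (t k)
      corners₃ 0F _ = C.persist K₀ (λ (e , _) → s≢t 1F 0F e) (λ (_ , e) → s≢t 1F 0F (≡-sym e))
      corners₃ 1F _ = C.keep (P.keep e₀₁) ,
        C.to-x (P.keep e₀₁) (trans (P.same e₀₁ (λ (e , _) → pt≢ {false} {false} (λ ()) e)) rot-s₀)
      corners₃ (suc (suc _)) (s≤s ())
      edges₃ : ∀ k l → toℕ l ≡ suc (toℕ k) → toℕ l ≤ 1 → ∀ a b → Adj (gr E₃) (sp b l) (sp a k)
      edges₃ 0F 1F _ _ false false = C.keep (P.keep (adj-sym (gr E₁) e₀₁))
      edges₃ 0F 1F _ _ true  false = C.keep P.new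
      edges₃ 0F 1F _ _ false true  = C.new-v
      edges₃ 0F 1F _ _ true  true  = C.new-w
      edges₃ (suc _) 1F () _
      edges₃ _ (suc (suc _)) _ (s≤s ())

    core₅ : ∃ (Core 5F)
    core₅ =
      let _ , c₂ = core-step 1F 2F refl (proj₂ core₁)
          _ , c₃ = core-step 2F 3F refl c₂
          _ , c₄ = core-step 3F 4F refl c₃
      in core-step 4F 5F refl c₄

    -- the class whose special pair the vertex (k , j) is joined to
    τ : Fin 6 → Fin (suc m) → Fin 6
    τ k j = if ⌊ j ≟ last ⌋ ∧ ascending k then prv k else nxt k

    link-τ : ∀ k j → link k (τ k j) ≡ true
    link-τ k j with ⌊ j ≟ last ⌋ ∧ ascending k
    ... | true  = link-prv k
    ... | false = link-nxt k

    Attached : Fin 6 → Fin (suc m) → Emb N → Set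
    Attached k j E = Special j ⊎ (∀ a → Adj (gr E) (vtx k j) (sp a (τ k j)))

    -- By `att` a vertex that is no longer isolated already has its final neighbours, so only
    -- isolated vertices have to be placed.
    record Inv (E : Emb N) : Set where
      field
        sub     : gr E ⊆G H
        corners : ∀ k → Corner E (s k) (s (apex k)) (t k)
        edges   : ∀ k l → toℕ l ≡ suc (toℕ k) → ∀ a b → Adj (gr E) (sp b l) (sp a k)
        att     : ∀ k j v → Adj (gr E) (vtx k j) v → Attached k j E

    attached-mono : ∀ {k j E F} → E ⊑ F → Attached k j E → Attached k j F
    attached-mono le (inj₁ h) = inj₁ h
    attached-mono le (inj₂ h) = inj₂ λ a → le (h a)

    inv₀ : Inv (proj₁ core₅)
    inv₀ = record
      { sub     = sub
      ; corners = λ k → corners k (≤-pred (toℕ<n k))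
      ; edges   = λ k l e → edges k l e (≤-pred (toℕ<n l))
      ; att     = λ k j v e → inj₁ (subst Special (ix-vtx k j) (proj₂ (supp (vtx k j) v e)))
      }
      where open Core (proj₂ core₅)

    step : ∀ x E → Inv E → Σ (Emb N) λ F → Inv F × E ⊑ F × Attached (pt x) (ix x) F
    step x E inv with iso? (gr E) (vtx (pt x) (ix x))
    ... | inj₂ (v , e) = E , inv , (λ e → e) , Inv.att inv (pt x) (ix x) v e
    ... | inj₁ iso = F , record
      { sub     = cut-sub C sub (linked lk) (linked lk)
      -- Every reserved corner has an `s` in the middle and runs from an `s` to a `t`. A cut at one
      -- of them could destroy another only if some `s` were a `t`.
      ; corners = λ l → C.persist (corners l) (λ (e , _) → s≢t (apex l) _ e) (λ (_ , e) → s≢t _ l (≡-sym e))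
      ; edges   = λ k l e a b → C.keep (edges k l e a b)
      ; att     = att′
      } , C.keep , inj₂ new
      where
      open Inv inv
      k = pt x
      j = ix x
      lk : link k (τ k j) ≡ true
      lk = link-τ k j
      c = cut E (corners (τ k j)) (s≢t _ _) iso
      F = proj₁ c
      C = proj₂ c
      module C = Cut C
      new : ∀ a → Adj (gr F) (vtx k j) (sp a (τ k j))
      new false = C.new-v
      new true  = C.new-w
      att′ : ∀ l i v → Adj (gr F) (vtx l i) v → Attached l i F
      att′ l i v e with C.cases (vtx l i) v e
      ... | inj₁ e′ = attached-mono {l} {i} {E} {F} C.keep (att l i v e′)
      ... | inj₂ (inj₂ (_ , inj₁ e′)) = inj₁ (false , proj₂ (vtx-inj e′))
      ... | inj₂ (inj₂ (_ , inj₂ e′)) = inj₁ (true , proj₂ (vtx-inj e′))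
      ... | inj₂ (inj₁ (e′ , _)) = let p , q = vtx-inj {l} {k} {i} {j} e′ in
        subst₂ (λ l i → Attached l i F) (≡-sym p) (≡-sym q) (inj₂ new)

    opaque

      full : Σ (Emb N) λ F → Inv F × (∀ x → Attached (pt x) (ix x) F)
      full = saturate Inv (λ x → Attached (pt x) (ix x)) (λ x {E} {F} → attached-mono {pt x} {ix x} {E} {F}) step (proj₁ core₅) inv₀

    emb : Emb N
    emb = proj₁ full

    open Inv (proj₁ (proj₂ full)) public using (sub; edges)

    attached : ∀ k j → Attached k j emb
    attached k j = subst₂ (λ k j → Attached k j emb) (pt-vtx k j) (ix-vtx k j) (proj₂ (proj₂ full) (vtx k j))

-- The extra layer

module LastLayer (m : ℕ) where

  open Hexagon (suc m)
  open Construction m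

  z : Fin 6 → V
  z k = vtx k last

  z-inj : ∀ {k l} → z k ≡ z l → k ≡ l
  z-inj e = proj₁ (vtx-inj e)

  -- The rotation at inner vertices is recorded in both directions because vertices will be placed
  -- on both sides of the hexagon. `tip` expresses that the end of the path has a single neighbour.
  record Path (i : Fin 6) (E : Emb N) : Set where
    field
      sub   : gr E ⊆G H
      supp  : ∀ u v → Adj (gr E) u v → toℕ (pt u) ≤ toℕ i × ix u ≡ last
      edge  : ∀ k l → toℕ l ≡ suc (toℕ k) → toℕ l ≤ toℕ i → Adj (gr E) (z l) (z k)
      fwd   : ∀ k l o → toℕ l ≡ suc (toℕ k) → toℕ o ≡ suc (toℕ l) → toℕ o ≤ toℕ i → rot E (z l) (z k) ≡ z o
      bwd   : ∀ k l o → toℕ l ≡ suc (toℕ k) → toℕ o ≡ suc (toℕ l) → toℕ o ≤ toℕ i → rot E (z l) (z o) ≡ z k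
      tip   : ∀ k → toℕ i ≡ suc (toℕ k) → rot E (z i) (z k) ≡ z k

  path₁ : ∃ (Path 1F)
  path₁ = E , record
    { sub  = λ u v e → case only u v e of λ where
        (inj₁ (refl , refl)) → linked {0F} {1F} refl
        (inj₂ (refl , refl)) → linked {1F} {0F} refl
    ; supp = λ u v e → case only u v e of λ where
        (inj₁ (refl , _)) → z-supp 0F z≤n
        (inj₂ (refl , _)) → z-supp 1F ≤-refl
    ; edge = edge′
    ; fwd  = λ k l o p q le → ⊥-elim (none k l o p q le)
    ; bwd  = λ k l o p q le → ⊥-elim (none k l o p q le)
    ; tip  = λ { 0F _ → proj₂ (proj₂ (proj₂ (proj₂ s₁))) ; (suc _) () }
    }
    where
    s₁ = singleEdge {a = z 0F} {z 1F} (λ e → case z-inj e of λ ())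
    E = proj₁ s₁
    only = proj₁ (proj₂ (proj₂ s₁))
    z-supp : ∀ k → toℕ k ≤ 1 → toℕ (pt (z k)) ≤ 1 × ix (z k) ≡ last
    z-supp k le = subst (λ l → toℕ l ≤ 1) (≡-sym (pt-vtx k last)) le , ix-vtx k last
    edge′ : ∀ k l → toℕ l ≡ suc (toℕ k) → toℕ l ≤ 1 → Adj (gr E) (z l) (z k)
    edge′ 0F 1F _ _ = adj-sym (gr E) (proj₁ (proj₂ s₁))
    edge′ (suc _) 1F () _
    edge′ _ (suc (suc _)) _ (s≤s ())
    none : ∀ (k l o : Fin 6) → toℕ l ≡ suc (toℕ k) → toℕ o ≡ suc (toℕ l) → toℕ o ≤ 1 → ⊥
    none k l o p q le = <⇒≱ (≤-trans (s≤s (s≤s z≤n)) (≤-reflexive (≡-sym (trans q (cong suc p))))) le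

  path-step : ∀ {E} h i i′ → toℕ i ≡ suc (toℕ h) → toℕ i′ ≡ suc (toℕ i) → Path i E → ∃ (Path i′)
  path-step {E} h i i′ i≡ i′≡ path = E′ , record
    { sub  = λ u v e → case P.cases u v e of λ where
        (inj₁ e′) → sub u v e′
        (inj₂ (inj₁ (refl , refl))) → adj-sym H (linked {i′} {i} (link-suc i i′ i′≡))
        (inj₂ (inj₂ (refl , refl))) → linked {i′} {i} (link-suc i i′ i′≡)
    ; supp = λ u v e → case P.cases u v e of λ where
        (inj₁ e′) → let p , q = supp u v e′ in ≤-trans p (<⇒≤ i<i′) , q
        (inj₂ (inj₁ (refl , _))) → z-supp i (<⇒≤ i<i′)
        (inj₂ (inj₂ (refl , _))) → z-supp i′ ≤-refl
    ; edge = edge′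
    ; fwd  = fwd′
    ; bwd  = bwd′
    ; tip  = λ k e → case toℕ-injective {i = k} {i} (suc-injective (trans (≡-sym e) i′≡)) of λ { refl → P.rot-w }
    }
    where
    open Path path
    i<i′ : toℕ i < toℕ i′
    i<i′ = ≤-reflexive (≡-sym i′≡)
    far : Iso (gr E) (z i′)
    far v e = <⇒≱ i<i′ (subst (λ k → toℕ k ≤ toℕ i) (pt-vtx i′ last) (proj₁ (supp _ v e)))
    ih : Adj (gr E) (z i) (z h)
    ih = edge h i i≡ ≤-refl
    p = pendant E {x = z i′} ih far
    E′ = proj₁ p
    module P = Pendant (proj₂ p)
    z-supp : ∀ k → toℕ k ≤ toℕ i′ → toℕ (pt (z k)) ≤ toℕ i′ × ix (z k) ≡ last
    z-supp k le = subst (λ l → toℕ l ≤ toℕ i′) (≡-sym (pt-vtx k last)) le , ix-vtx k last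
    below : ∀ k → toℕ k ≤ toℕ i′ → toℕ k ≤ toℕ i ⊎ k ≡ i′
    below k le with m≤n⇒m<n∨m≡n le
    ... | inj₁ lt = inj₁ (≤-pred (≤-trans lt (≤-reflexive i′≡)))
    ... | inj₂ e  = inj₂ (toℕ-injective e)
    pred≡ : ∀ {k l l′ : Fin 6} → toℕ l ≡ suc (toℕ k) → l ≡ l′ → ∀ k′ → toℕ l′ ≡ suc (toℕ k′) → k ≡ k′
    pred≡ p refl k′ q = toℕ-injective (suc-injective (trans (≡-sym p) q))
    edge′ : ∀ k l → toℕ l ≡ suc (toℕ k) → toℕ l ≤ toℕ i′ → Adj (gr E′) (z l) (z k)
    edge′ k l l≡ le with below l le
    ... | inj₁ le′ = P.keep (edge k l l≡ le′)
    ... | inj₂ refl with pred≡ {k} l≡ refl i i′≡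
    ...   | refl = adj-sym (gr E′) P.new
    inner : ∀ l o → toℕ o ≡ suc (toℕ l) → toℕ o ≤ toℕ i → z l ≢ z i
    inner l o o≡ le e with z-inj e
    ... | refl = <⇒≱ (≤-reflexive (≡-sym o≡)) le
    fwd′ : ∀ k l o → toℕ l ≡ suc (toℕ k) → toℕ o ≡ suc (toℕ l) → toℕ o ≤ toℕ i′ → rot E′ (z l) (z k) ≡ z o
    fwd′ k l o l≡ o≡ le with below o le
    ... | inj₁ le′ = trans (P.same (edge k l l≡ (≤-trans (≤-trans (n≤1+n _) (≤-reflexive (≡-sym o≡))) le′)) (inner l o o≡ le′ ∘ proj₁))
      (fwd k l o l≡ o≡ le′)
    ... | inj₂ refl with pred≡ {l} o≡ refl i i′≡
    ...   | refl with pred≡ {k} l≡ refl h i≡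
    ...     | refl = P.rot-b
    bwd′ : ∀ k l o → toℕ l ≡ suc (toℕ k) → toℕ o ≡ suc (toℕ l) → toℕ o ≤ toℕ i′ → rot E′ (z l) (z o) ≡ z k
    bwd′ k l o l≡ o≡ le with below o le
    ... | inj₁ le′ = trans (P.same (adj-sym (gr E) (edge l o o≡ le′)) (inner l o o≡ le′ ∘ proj₁))
      (bwd k l o l≡ o≡ le′)
    ... | inj₂ refl with pred≡ {l} o≡ refl i i′≡
    ...   | refl with pred≡ {k} l≡ refl h i≡
    ...     | refl = trans P.rot-x (tip h i≡)

  path₅ : ∃ (Path 5F)
  path₅ =
    let _ , p₂ = path-step 0F 1F 2F refl refl (proj₂ path₁)
        _ , p₃ = path-step 1F 2F 3F refl refl p₂
        _ , p₄ = path-step 2F 3F 4F refl refl p₃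
    in path-step 3F 4F 5F refl refl p₄

  -- The vertices of class 5 other than z 5F go, in their order, to the corner z 0F, z 5F, z 4F.
  record Fan (k : ℕ) (E : Emb N) : Set where
    field
      sub    : gr E ⊆G H
      hex    : ∀ i → Adj (gr E) (z i) (z (nxt i))
      c₂     : Corner E (z 1F) (z 2F) (z 3F)
      c₃     : Corner E (z 4F) (z 3F) (z 2F)
      c₄     : Corner E (z 3F) (z 4F) (z 5F)
      c₅     : Corner E (z 0F) (z 5F) (z 4F)
      supp   : ∀ u v → Adj (gr E) u v → ix u ≡ last ⊎ (pt u ≡ 5F × toℕ (ix u) < k)
      spokes : ∀ j → toℕ j < k → Adj (gr E) (vtx 5F j) (z 0F) × Adj (gr E) (vtx 5F j) (z 4F)
      order  : ∀ j j′ → toℕ j′ ≡ suc (toℕ j) → toℕ j < k →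
        (toℕ j′ < k → Corner E (vtx 5F j) (z 0F) (vtx 5F j′)) × (toℕ j′ ≡ k → Corner E (vtx 5F j) (z 0F) (z 5F))

  fan₀ : ∃ (Fan 0)
  fan₀ = E′ , record
    { sub    = λ u v e → case C.cases u v e of λ where
        (inj₁ e′) → sub u v e′
        (inj₂ (inj₁ (refl , refl))) → linked {0F} {5F} refl
        (inj₂ (inj₂ (refl , refl))) → linked {5F} {0F} refl
    ; hex    = hex
    -- The corners at `z 2F` and `z 4F` are on one side of the hexagon, those at `z 3F` and `z 5F`
    -- on the other. A cut at one corner of the hexagon spoils only the adjacent corners on the same
    -- side, so these four do not interfere.
    ; c₂     = stay 1F 2F 3F (λ ()) (λ ()) (adj-≤ 1F 2F refl) (fwd 1F 2F 3F refl refl (leq 3F))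
    ; c₃     = stay 4F 3F 2F (λ ()) (λ ()) (adj-sym (gr E) (adj-≤ 3F 4F refl)) (bwd 2F 3F 4F refl refl (leq 4F))
    ; c₄     = stay 3F 4F 5F (λ ()) (λ ()) (adj-≤ 3F 4F refl) (fwd 3F 4F 5F refl refl (leq 5F))
    ; c₅     = adj-sym (gr E′) C.new , C.rot-c
    ; supp   = λ u v e → inj₁ (case C.cases u v e of λ where
        (inj₁ e′) → proj₂ (supp u v e′)
        (inj₂ (inj₁ (refl , _))) → ix-vtx 0F last
        (inj₂ (inj₂ (refl , _))) → ix-vtx 5F last)
    ; spokes = λ _ ()
    ; order  = λ _ _ _ ()
    }
    where
    E = proj₁ path₅
    open Path (proj₂ path₅)
    leq : ∀ (k : Fin 6) → toℕ k ≤ 5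
    leq k = ≤-pred (toℕ<n k)
    adj-≤ : ∀ k l → toℕ l ≡ suc (toℕ k) → Adj (gr E) (z l) (z k)
    adj-≤ k l e = edge k l e (leq l)
    φ : Dart N → Dart N
    φ = faceStep (gr E) (rot E)
    f₁ : iter φ 1 (z 0F , z 1F) ≡ (z 1F , z 2F)
    f₁ = cong (z 1F ,_) (fwd 0F 1F 2F refl refl (leq 2F))
    f₂ : iter φ 2 (z 0F , z 1F) ≡ (z 2F , z 3F)
    f₂ = trans (cong φ f₁) (cong (z 2F ,_) (fwd 1F 2F 3F refl refl (leq 3F)))
    f₃ : iter φ 3 (z 0F , z 1F) ≡ (z 3F , z 4F)
    f₃ = trans (cong φ f₂) (cong (z 3F ,_) (fwd 2F 3F 4F refl refl (leq 4F)))
    f₄ : iter φ 4 (z 0F , z 1F) ≡ (z 4F , z 5F)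
    f₄ = trans (cong φ f₃) (cong (z 4F ,_) (fwd 3F 4F 5F refl refl (leq 5F)))
    f₅ : iter φ 5 (z 0F , z 1F) ≡ (z 5F , z 4F)
    f₅ = trans (cong φ f₄) (cong (z 5F ,_) (tip 4F refl))
    off : ∀ {d : Dart N} {k l} → d ≡ (z k , z l) → k ≢ 0F → proj₁ d ≢ z 0F
    off refl h e = h (z-inj e)
    simple : ∀ i → i < 5 → proj₁ (iter φ (suc i) (z 0F , z 1F)) ≢ z 0F
    simple 0 _ = off f₁ λ ()
    simple 1 _ = off f₂ λ ()
    simple 2 _ = off f₃ λ ()
    simple 3 _ = off f₄ λ ()
    simple 4 _ = off f₅ λ ()
    simple (suc (suc (suc (suc (suc _))))) (s≤s (s≤s (s≤s (s≤s (s≤s ())))))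
    -- The rotation at the tip z 5F fixes z 4F, so z 4F is its only neighbour.
    ¬05 : ¬ Adj (gr E) (z 0F) (z 5F)
    ¬05 e = case z-inj (trans (≡-sym (stuck i)) eq) of λ ()
      where
      r₅ = proj₂ (isRot E) (z 5F) (z 4F) (z 0F) (adj-≤ 4F 5F refl) (adj-sym (gr E) e)
      i = proj₁ r₅
      eq = proj₂ r₅
      stuck : ∀ i → iter (rot E (z 5F)) i (z 4F) ≡ z 4F
      stuck zero    = refl
      stuck (suc i) = trans (cong (rot E (z 5F)) (stuck i)) (tip 4F refl)
    -- The face of the path leads from `(z 0F , z 1F)` to `(z 5F , z 4F)` in five steps; `chord`
    -- takes the number of steps less one.
    s₁ = chord E {z 0F} {z 1F} {z 5F} {z 4F} (adj-sym (gr E) (adj-≤ 0F 1F refl)) (λ e → case z-inj e of λ ()) ¬05 4 f₅ simple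
    E′ = proj₁ s₁
    module C = Chord (proj₂ s₁)
    hex : ∀ i → Adj (gr E′) (z i) (z (nxt i))
    hex 0F = C.keep (adj-sym (gr E) (adj-≤ 0F 1F refl))
    hex 1F = C.keep (adj-sym (gr E) (adj-≤ 1F 2F refl))
    hex 2F = C.keep (adj-sym (gr E) (adj-≤ 2F 3F refl))
    hex 3F = C.keep (adj-sym (gr E) (adj-≤ 3F 4F refl))
    hex 4F = C.keep (adj-sym (gr E) (adj-≤ 4F 5F refl))
    hex 5F = adj-sym (gr E′) C.new
    stay : ∀ k l o → l ≢ 0F → l ≢ 5F → Adj (gr E) (z l) (z k) → rot E (z l) (z k) ≡ z o → Corner E′ (z k) (z l) (z o)
    stay k l o h h′ e eq = C.keep e , trans (C.same e (λ (p , _) → h (z-inj p)) (λ (p , _) → h′ (z-inj p))) eq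

  fan-step : ∀ {E} k → k < m → Fan k E → ∃ (Fan (suc k))
  fan-step {E} k k<m fan = E′ , record
    { sub    = cut-sub C sub (linked {5F} {0F} refl) (linked {5F} {4F} refl)
    ; hex    = λ i → C.keep (hex i)
    ; c₂     = stay 2F (λ ()) (λ ()) c₂
    ; c₃     = stay 3F (λ ()) (λ ()) c₃
    ; c₄     = C.persist c₄ (λ (_ , e) → case z-inj e of λ ()) (λ (e , _) → case z-inj e of λ ())
    ; c₅     = stay 5F (λ ()) (λ ()) c₅
    ; supp   = supp′
    ; spokes = spokes′
    ; order  = order′
    }
    where
    open Fan fan
    k<n : k < suc m
    k<n = m<n⇒m<1+n k<m
    jk : Fin (suc m)
    jk = fromℕ< k<n
    toℕ-jk : toℕ jk ≡ k
    toℕ-jk = toℕ-fromℕ< k<n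
    x : V
    x = vtx 5F jk
    low≢last : ∀ {j : Fin (suc m)} → toℕ j ≤ k → j ≢ last
    low≢last le refl = <⇒≱ k<m (≤-trans (≤-reflexive (≡-sym toℕ-last)) le)
    iso : Iso (gr E) x
    iso v e with supp x v e
    ... | inj₁ e′ = low≢last (≤-reflexive toℕ-jk) (trans (≡-sym (ix-vtx 5F jk)) e′)
    ... | inj₂ (_ , lt) = <-irrefl (trans (cong toℕ (ix-vtx 5F jk)) toℕ-jk) lt
    s₁ = cut E {x = x} c₅ (λ e → case z-inj e of λ ()) iso
    E′ = proj₁ s₁
    C = proj₂ s₁
    module C = Cut C
    stay : ∀ l {v w} → l ≢ 4F → l ≢ 0F → Corner E v (z l) w → Corner E′ v (z l) w
    stay l h h′ c = C.persist c (λ (e , _) → h (z-inj e)) (λ (e , _) → h′ (z-inj e))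
    supp′ : ∀ u v → Adj (gr E′) u v → ix u ≡ last ⊎ (pt u ≡ 5F × toℕ (ix u) < suc k)
    supp′ u v e with C.cases u v e
    ... | inj₁ e′ = [ inj₁ , (λ (p , q) → inj₂ (p , m<n⇒m<1+n q)) ]′ (supp u v e′)
    ... | inj₂ (inj₁ (refl , _)) = inj₂ (pt-vtx 5F jk , s≤s (≤-reflexive (trans (cong toℕ (ix-vtx 5F jk)) toℕ-jk)))
    ... | inj₂ (inj₂ (_ , inj₁ refl)) = inj₁ (ix-vtx 0F last)
    ... | inj₂ (inj₂ (_ , inj₂ refl)) = inj₁ (ix-vtx 4F last)
    at-k : ∀ {j : Fin (suc m)} → toℕ j ≡ k → j ≡ jk
    at-k e = toℕ-injective (trans e (≡-sym toℕ-jk))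
    spokes′ : ∀ j → toℕ j < suc k → Adj (gr E′) (vtx 5F j) (z 0F) × Adj (gr E′) (vtx 5F j) (z 4F)
    spokes′ j lt with m≤n⇒m<n∨m≡n (≤-pred lt)
    ... | inj₁ lt′ = let p , q = spokes j lt′ in C.keep p , C.keep q
    ... | inj₂ e with at-k e
    ...   | refl = C.new-v , C.new-w
    order′ : ∀ j j′ → toℕ j′ ≡ suc (toℕ j) → toℕ j < suc k →
      (toℕ j′ < suc k → Corner E′ (vtx 5F j) (z 0F) (vtx 5F j′)) × (toℕ j′ ≡ suc k → Corner E′ (vtx 5F j) (z 0F) (z 5F))
    order′ j j′ j′≡ lt with m≤n⇒m<n∨m≡n (≤-pred lt)
    ... | inj₁ lt′ = inside , λ e → ⊥-elim (<-irrefl (suc-injective (trans (≡-sym j′≡) e)) lt′)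
      where
      inside : toℕ j′ < suc k → Corner E′ (vtx 5F j) (z 0F) (vtx 5F j′)
      inside j′< with m≤n⇒m<n∨m≡n (≤-pred j′<)
      ... | inj₁ j′<k = C.persist (proj₁ (order j j′ j′≡ lt′) j′<k)
        (λ (e , _) → case z-inj e of λ ()) (λ (_ , e) → low≢last (<⇒≤ j′<k) (proj₂ (vtx-inj e)))
      -- So far `z 5F` has held the place after index `j` in the rotation at `z 0F`; the new vertex
      -- is put in between.
      ... | inj₂ j′≡k with proj₂ (order j j′ j′≡ lt′) j′≡k
      ...   | e , eq = C.keep e , trans (C.to-x e eq) (cong (vtx 5F) (≡-sym (at-k j′≡k)))
    ... | inj₂ e with at-k e
    ...   | refl = (λ j′< → ⊥-elim (<-irrefl (trans j′≡ (cong suc e)) j′<)) ,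
      (λ _ → adj-sym (gr E′) C.new-v , C.rot-v)

  fan : ∀ k → k ≤ m → ∃ (Fan k)
  fan zero    _  = fan₀
  fan (suc k) lt = fan-step k lt (proj₂ (fan k (<⇒≤ lt)))

  -- The corners at which the vertices of the classes 0, 2, 3, 4 are put.
  data Spot : Fin 6 → V → V → V → Set where
    spot₀ : ∀ r → Spot 0F (vtx 5F (pr false r)) (z 0F) (vtx 5F (pr true r))
    spot₂ : Spot 2F (z 1F) (z 2F) (z 3F)
    spot₃ : Spot 3F (z 4F) (z 3F) (z 2F)
    spot₄ : Spot 4F (z 3F) (z 4F) (z 5F)

  -- The classes of the two ends of a spot. The value `0F` at 1 and 5 is a placeholder, since no
  -- spot has its middle in these classes.
  fst-class snd-class : Fin 6 → Fin 6
  fst-class 0F = 5F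
  fst-class 2F = 1F
  fst-class 3F = 4F
  fst-class 4F = 3F
  fst-class _  = 0F
  snd-class 0F = 5F
  snd-class 2F = 3F
  snd-class 3F = 2F
  snd-class 4F = 5F
  snd-class _  = 0F

  spot-classes : ∀ {k v b w} → Spot k v b w → pt v ≡ fst-class k × pt b ≡ k × pt w ≡ snd-class k
  spot-classes (spot₀ r) = pt-vtx 5F (pr false r) , pt-vtx 0F last , pt-vtx 5F (pr true r)
  spot-classes spot₂     = pt-vtx 1F last , pt-vtx 2F last , pt-vtx 3F last
  spot-classes spot₃     = pt-vtx 4F last , pt-vtx 3F last , pt-vtx 2F last
  spot-classes spot₄     = pt-vtx 3F last , pt-vtx 4F last , pt-vtx 5F last

  spot-class : ∀ {k v b w} → Spot k v b w → k ≢ 1F × k ≢ 5F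
  spot-class (spot₀ _) = (λ ()) , λ ()
  spot-class spot₂     = (λ ()) , λ ()
  spot-class spot₃     = (λ ()) , λ ()
  spot-class spot₄     = (λ ()) , λ ()

  spot-end : ∀ {k v b w} → Spot k v b w → ∀ l i → vtx l i ≡ v ⊎ vtx l i ≡ w → i ≡ last ⊎ l ≡ 5F
  spot-end (spot₀ _) l i = [ inj₂ ∘ proj₁ ∘ vtx-inj , inj₂ ∘ proj₁ ∘ vtx-inj ]′
  spot-end spot₂     l i = [ inj₁ ∘ proj₂ ∘ vtx-inj , inj₁ ∘ proj₂ ∘ vtx-inj ]′
  spot-end spot₃     l i = [ inj₁ ∘ proj₂ ∘ vtx-inj , inj₁ ∘ proj₂ ∘ vtx-inj ]′
  spot-end spot₄     l i = [ inj₁ ∘ proj₂ ∘ vtx-inj , inj₁ ∘ proj₂ ∘ vtx-inj ]′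

  spot-≢ : ∀ {k v b w} → Spot k v b w → v ≢ w
  spot-≢ (spot₀ r) e = 1+n≢n (trans (≡-sym (pr-next r)) (cong toℕ (≡-sym (proj₂ (vtx-inj e)))))
  spot-≢ spot₂     e = case z-inj e of λ ()
  spot-≢ spot₃     e = case z-inj e of λ ()
  spot-≢ spot₄     e = case z-inj e of λ ()

  -- The two exclusions of `persist`, reduced to classes, where all cases can be checked. Taking `k`
  -- and `l` both 0 settles the spots of different pairs as well.
  clash-free : ∀ k l → k ≢ 1F × k ≢ 5F → l ≢ 1F × l ≢ 5F →
    ¬ (l ≡ snd-class k × fst-class l ≡ k) × ¬ (l ≡ fst-class k × snd-class l ≡ k)
  clash-free = toWitness {a? = all? λ k → all? λ l →
    (¬? (k ≟ 1F) ×-dec ¬? (k ≟ 5F)) →-dec ((¬? (l ≟ 1F) ×-dec ¬? (l ≟ 5F)) →-dec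
    (¬? ((l ≟ snd-class k) ×-dec (fst-class l ≟ k)) ×-dec ¬? ((l ≟ fst-class k) ×-dec (snd-class l ≟ k))))} tt

  spot-link : ∀ {k v b w} → Spot k v b w → ∀ j → Adj H (vtx k j) v × Adj H (vtx k j) w
  spot-link (spot₀ _) j = linked {0F} {5F} refl , linked {0F} {5F} refl
  spot-link spot₂     j = linked {2F} {1F} refl , linked {2F} {3F} refl
  spot-link spot₃     j = linked {3F} {4F} refl , linked {3F} {2F} refl
  spot-link spot₄     j = linked {4F} {3F} refl , linked {4F} {5F} refl

  -- No star ends in class 1, and class 5 is already placed by `Fan`. In class 0 the condition is
  -- void for an index without a pair. Class 2 receives the stars of `z 1F` and `z 3F`; classes 3
  -- and 4 receive those of `z 2F` and `z 5F`, and the second edge there gives the vertex the degree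
  -- two with which `cut` places it.
  Attached : Fin 6 → Fin (suc m) → Emb N → Set
  Attached 0F j E = ∀ r a → j ≡ pr a r → ∀ b → Adj (gr E) (vtx 0F j) (vtx 5F (pr b r))
  Attached 2F j E = Adj (gr E) (vtx 2F j) (z 1F) × Adj (gr E) (vtx 2F j) (z 3F)
  Attached 3F j E = Adj (gr E) (vtx 3F j) (z 4F) × Adj (gr E) (vtx 3F j) (z 2F)
  Attached 4F j E = Adj (gr E) (vtx 4F j) (z 3F) × Adj (gr E) (vtx 4F j) (z 5F)
  Attached _  j E = ⊤

  attached-mono : ∀ k j {E F} → E ⊑ F → Attached k j E → Attached k j F
  attached-mono 0F j le h = λ r a e b → le (h r a e b)
  attached-mono 1F j le h = tt
  attached-mono 2F j le (p , q) = le p , le q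
  attached-mono 3F j le (p , q) = le p , le q
  attached-mono 4F j le (p , q) = le p , le q
  attached-mono 5F j le h = tt

  Done : Fin 6 → Fin (suc m) → Emb N → Set
  Done k j E = j ≡ last ⊎ Attached k j E

  done-mono : ∀ k j {E F} → E ⊑ F → Done k j E → Done k j F
  done-mono k j le (inj₁ e) = inj₁ e
  done-mono k j {E} {F} le (inj₂ h) = inj₂ (attached-mono k j {E} {F} le h)

  record Inv (E : Emb N) : Set where
    field
      sub    : gr E ⊆G H
      hex    : ∀ i → Adj (gr E) (z i) (z (nxt i))
      spots  : ∀ {k v b w} → Spot k v b w → Corner E v b w
      spokes : ∀ j → Adj (gr E) (vtx 5F j) (z 0F) × Adj (gr E) (vtx 5F j) (z 4F)
      att    : ∀ k j v → Adj (gr E) (vtx k j) v → Done k j E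

  inv₀ : ∃ Inv
  inv₀ = E , record
    { sub    = sub
    ; hex    = hex
    ; spots  = spots
    ; spokes = spokes′
    ; att    = att
    }
    where
    E = proj₁ (fan m ≤-refl)
    open Fan (proj₂ (fan m ≤-refl))
    top : ∀ {j : Fin (suc m)} → toℕ j ≡ m → j ≡ last
    top e = toℕ-injective (trans e (≡-sym toℕ-last))
    spokes′ : ∀ j → Adj (gr E) (vtx 5F j) (z 0F) × Adj (gr E) (vtx 5F j) (z 4F)
    spokes′ j with m≤n⇒m<n∨m≡n (≤-pred (toℕ<n j))
    ... | inj₁ lt = spokes j lt
    ... | inj₂ e with top e
    ...   | refl = hex 5F , adj-sym (gr E) (hex 4F)
    spots : ∀ {k v b w} → Spot k v b w → Corner E v b w
    spots spot₂ = c₂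
    spots spot₃ = c₃
    spots spot₄ = c₄
    spots (spot₀ r) with order (pr false r) (pr true r) (pr-next r) lo<m
      where
      lo<m : toℕ (pr {suc m} false r) < m
      lo<m = ≤-trans (≤-reflexive (≡-sym (pr-next r))) (≤-pred (toℕ<n (pr true r)))
    ... | inside , end with m≤n⇒m<n∨m≡n (≤-pred (toℕ<n (pr {suc m} true r)))
    ...   | inj₁ lt = inside lt
    -- Index `m` is the last one, so `z 5F` is the second vertex of this pair and closes the order
    -- at `z 0F`.
    ...   | inj₂ e  = subst (λ j → Corner E (vtx 5F (pr false r)) (z 0F) (vtx 5F j)) (≡-sym (top e)) (end e)
    att : ∀ k j v → Adj (gr E) (vtx k j) v → Done k j E
    att k j v e with supp (vtx k j) v e
    ... | inj₁ e′ = inj₁ (trans (≡-sym (ix-vtx k j)) e′)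
    ... | inj₂ (e′ , _) with trans (≡-sym (pt-vtx k j)) e′
    ...   | refl = inj₂ tt

  put : ∀ {k v b w} E → Inv E → Spot k v b w → ∀ j → Iso (gr E) (vtx k j) →
    (∀ F → Adj (gr F) (vtx k j) v → Adj (gr F) (vtx k j) w → Attached k j F) →
    Σ (Emb N) λ F → Inv F × E ⊑ F × Done k j F
  put {k} {v} {b} {w} E inv spot j iso goal = F , record
    { sub    = let p , q = spot-link spot j in cut-sub C sub p q
    ; hex    = λ i → C.keep (hex i)
    ; spots  = λ sp → let p , q = clash spot sp in C.persist (spots sp) p q
    ; spokes = λ i → let p , q = spokes i in C.keep p , C.keep q
    ; att    = att′
    } , C.keep , new
    where
    open Inv inv
    s₁ = cut E {x = vtx k j} (spots spot) (spot-≢ spot) iso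
    F = proj₁ s₁
    C = proj₂ s₁
    module C = Cut C
    new : Done k j F
    new = inj₂ (goal F C.new-v C.new-w)
    clash : ∀ {k v b w l v₀ b₀ w₀} → Spot k v b w → Spot l v₀ b₀ w₀ → ¬ (b₀ ≡ w × v₀ ≡ b) × ¬ (b₀ ≡ v × w₀ ≡ b)
    clash {k} {l = l} S S₀ =
      let pv , pb , pw = spot-classes S
          qv , qb , qw = spot-classes S₀
          no₁ , no₂ = clash-free k l (spot-class S) (spot-class S₀)
      in (λ (e , e′) → no₁ (trans (≡-sym qb) (trans (cong pt e) pw) , trans (≡-sym qv) (trans (cong pt e′) pb))) ,
         (λ (e , e′) → no₂ (trans (≡-sym qb) (trans (cong pt e) pv) , trans (≡-sym qw) (trans (cong pt e′) pb)))
    att′ : ∀ l i u → Adj (gr F) (vtx l i) u → Done l i F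
    att′ l i u e with C.cases (vtx l i) u e
    ... | inj₁ e′ = done-mono l i {E} {F} C.keep (att l i u e′)
    ... | inj₂ (inj₁ (e′ , _)) = let p , q = vtx-inj {l} {k} {i} {j} e′ in
      subst₂ (λ l i → Done l i F) (≡-sym p) (≡-sym q) new
    ... | inj₂ (inj₂ (_ , e′)) with spot-end spot l i e′
    ...   | inj₁ e″   = inj₁ e″
    ...   | inj₂ refl = inj₂ tt

  step′ : ∀ k j E → Inv E → Σ (Emb N) λ F → Inv F × E ⊑ F × Done k j F
  step′ k j E inv with iso? (gr E) (vtx k j)
  ... | inj₂ (v , e) = E , inv , (λ e → e) , Inv.att inv k j v e
  step′ 1F j E inv | inj₁ iso = E , inv , (λ e → e) , inj₂ tt
  step′ 5F j E inv | inj₁ iso = E , inv , (λ e → e) , inj₂ tt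
  step′ 2F j E inv | inj₁ iso = put E inv spot₂ j iso λ F p q → p , q
  step′ 3F j E inv | inj₁ iso = put E inv spot₃ j iso λ F p q → p , q
  step′ 4F j E inv | inj₁ iso = put E inv spot₄ j iso λ F p q → p , q
  step′ 0F j E inv | inj₁ iso with paired j
  ... | inj₂ e = E , inv , (λ e → e) , inj₁ (toℕ-injective (trans (suc-injective e) (≡-sym toℕ-last)))
  ... | inj₁ (r , a , j≡) = put E inv (spot₀ r) j iso λ F p q r′ a′ e → goal F p q r′ (pr-inj a′ a (trans (≡-sym e) j≡))
    where
    goal : ∀ F → Adj (gr F) (vtx 0F j) (vtx 5F (pr false r)) → Adj (gr F) (vtx 0F j) (vtx 5F (pr true r)) →
      ∀ r′ → r′ ≡ r → ∀ b → Adj (gr F) (vtx 0F j) (vtx 5F (pr b r′))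
    goal F p q r′ refl false = p
    goal F p q r′ refl true  = q

  opaque

    full : Σ (Emb N) λ F → Inv F × (∀ x → Done (pt x) (ix x) F)
    full = saturate Inv (λ x → Done (pt x) (ix x)) (λ x {E} {F} → done-mono (pt x) (ix x) {E} {F})
      (λ x → step′ (pt x) (ix x)) (proj₁ inv₀) (proj₂ inv₀)

  emb : Emb N
  emb = proj₁ full

  open Inv (proj₁ (proj₂ full)) public using (sub; hex; spokes)

  done : ∀ k j → Done k j emb
  done k j = subst₂ (λ k j → Done k j emb) (pt-vtx k j) (ix-vtx k j) (proj₂ (proj₂ full) (vtx k j))

  flip : ∀ {u v} → Adj (gr emb) u v → Adj (gr emb) v u
  flip = adj-sym (gr emb)

  star-up : ∀ k → ascending k ≡ true → ∀ j → Adj (gr emb) (z k) (vtx (nxt k) j)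
  star-up 1F _ j = case done 2F j of λ { (inj₁ refl) → hex 1F ; (inj₂ (p , _)) → flip p }
  star-up 2F _ j = case done 3F j of λ { (inj₁ refl) → hex 2F ; (inj₂ (_ , p)) → flip p }
  star-up 4F _ j = flip (proj₂ (spokes j))

  star-down : ∀ k → ascending k ≡ false → ∀ j → Adj (gr emb) (vtx (prv k) j) (z k)
  star-down 0F _ j = proj₁ (spokes j)
  star-down 3F _ j = case done 2F j of λ { (inj₁ refl) → hex 2F ; (inj₂ (_ , p)) → p }
  star-down 5F _ j = case done 4F j of λ { (inj₁ refl) → hex 4F ; (inj₂ (_ , p)) → p }

  -- The vertex of class 0 may be `z 0F` itself, when the last index has a partner; then the edge is
  -- a spoke.
  pairs-50 : ∀ r a b → Adj (gr emb) (vtx 5F (pr b r)) (vtx 0F (pr a r))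
  pairs-50 r a b with done 0F (pr a r)
  ... | inj₁ e = subst (λ j → Adj (gr emb) (vtx 5F (pr b r)) (vtx 0F j)) (≡-sym e) (proj₁ (spokes (pr b r)))
  ... | inj₂ h = flip (h r a refl b)

-- Every edge lies in a layer

module Decomposition (m : ℕ) where

  open Hexagon (suc m)
  open Construction m
  module Z = LastLayer m

  layer : Fin (suc ⌊ suc m /2⌋) → Emb N
  layer zero    = Z.emb
  layer (suc r) = Layer.emb r

  Covered : V → V → Set
  Covered u v = ∃ λ i → Adj (gr (layer i)) u v

  -- In the layer of the pair of `j′`, the vertex `(k , j)` is attached to that pair unless it has
  -- been redirected, and then its star in the extra layer contains the edge. If `j′` has no pair,
  -- it is the last index: either the star of that vertex points to class `k`, or the vertex has
  -- been redirected and the layer of the pair of `j` contains the edge. When `j` is also last and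
  -- unpaired, the redirected case is an edge of the hexagon.
  covered-nxt : ∀ k j j′ → Covered (vtx k j) (vtx (nxt k) j′)
  covered-nxt k j j′ with paired j′
  ... | inj₁ (r , a , refl) with Layer.attached r k j
  ...   | inj₂ att with j ≟ last | ascending k in up
  ...     | yes refl | true  = zero , Z.star-up k up (pr a r)
  ...     | yes refl | false = suc r , att a
  ...     | no _     | _     = suc r , att a
  -- Both ends belong to the same pair, whose layer has all such edges except those between classes
  -- 5 and 0.
  covered-nxt k j j′ | inj₁ (r , a , refl) | inj₁ (b , refl) with k ≟ 5F
  ...     | yes refl = zero , Z.pairs-50 r a b
  ...     | no k≢5   = suc r , adj-sym (gr (Layer.emb r)) (Layer.edges r k (nxt k) (nxt-suc k k≢5) b a)
  covered-nxt k j j′ | inj₂ e with toℕ-injective {i = j′} {last} (trans (suc-injective e) (≡-sym toℕ-last))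
  ... | refl with ascending (nxt k) in up
  ...   | false = zero , subst (λ l → Adj (gr Z.emb) (vtx l j) (Z.z (nxt k))) (prv-nxt k) (Z.star-down (nxt k) up j)
  ...   | true with paired j
  ...     | inj₂ e′ with toℕ-injective {i = j} {last} (trans (suc-injective e′) (≡-sym toℕ-last))
  ...       | refl = zero , Z.hex k
  covered-nxt k j j′ | inj₂ e | refl | true | inj₁ (r , b , refl) with Layer.attached r (nxt k) last
  ...       | inj₁ (a , last≡) = suc r , subst (λ i → Adj (gr (Layer.emb r)) (vtx k (pr b r)) (vtx (nxt k) i)) (≡-sym last≡)
    (adj-sym (gr (Layer.emb r)) (Layer.edges r k (nxt k) (nxt-suc k λ { refl → case up of λ () }) b a))
  ...       | inj₂ att = suc r , adj-sym (gr (Layer.emb r))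
    (subst (λ l → Adj (gr (Layer.emb r)) (vtx (nxt k) last) (vtx l (pr b r))) τ≡ (att b))
    where
    τ≡ : Layer.τ r (nxt k) last ≡ k
    τ≡ rewrite up with last ≟ last
    ... | yes _ = prv-nxt k
    ... | no h  = ⊥-elim (h refl)

  covered : ∀ u v → Adj H u v → Covered u v
  covered u v e with link-cases (pt u) (pt v) (trans (≡-sym (adj-link u v)) e)
  ... | inj₁ v≡ = subst₂ Covered (vtx-pt u) (trans (cong (λ k → vtx k (ix v)) (≡-sym v≡)) (vtx-pt v))
    (covered-nxt (pt u) (ix u) (ix v))
  ... | inj₂ u≡ with covered-nxt (pt v) (ix v) (ix u)
  ...   | i , e′ = i , adj-sym (gr (layer i)) (subst₂ (Adj (gr (layer i))) (vtx-pt v)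
    (trans (cong (λ k → vtx k (ix u)) (≡-sym u≡)) (vtx-pt u)) e′)

  layer-sub : ∀ i → gr (layer i) ⊆G H
  layer-sub zero    = Z.sub
  layer-sub (suc r) = Layer.sub r

  decomposition : PlanarDecomposition H (suc ⌊ suc m /2⌋)
  decomposition = gr ∘ layer , (λ i → emb⇒planar (layer i)) , layer-sub , covered

theorem4p6 : (n : ℕ) → n ≥ 1 → Thickness (Knnn n ⊗ K₂) ⌈ n + 1 /2⌉
theorem4p6 (suc m) n≥1 = subst (λ G → Thickness G ⌈ suc m + 1 /2⌉) H-def
  -- `⌈ 1 + suc m /2⌉` computes to `suc ⌊ suc m /2⌋`, one layer for each pair and the extra one.
  (subst (PlanarDecomposition H) (cong (λ k → ⌈ k /2⌉) (+-comm 1 (suc m))) decomposition , lower-bound n≥1)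
  where
  open Hexagon (suc m)
  open Decomposition m
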